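{- There is an absolute constant $C$ such that for every $n\ge 1$ the transience class of the grid sandpile satisfies $\mathrm{tcl}(\texttt{GRID}_n)\le C\,n^{7}$, i.e. $\mathrm{tcl}(\texttt{GRID}_n)=O(n^7)$.
   Context: A sandpile is a finite connected multigraph $G$ with a distinguished vertex $s$ (the sink); $V_o=V(G)\setminus\{s\}$ are the ordinary vertices, $d(v)$ denotes degree (counting multiplicities, including edges to $s$). A configuration is a map $c:V_o\to\mathbb{N}$. An ordinary vertex $v$ is unstable if $c(v)\ge d(v)$; toppling $v$ removes $d(v)$ particles from $v$ and gives each neighbour one particle per common edge (particles sent to $s$ disappear); the sink never topples. Every configuration relaxes by topplings to a unique stable configuration. A configuration $c_2$ is reachable from $c_1$ if particles can be added to $c_1$ so that the result relaxes to $c_2$; a configuration is recurrent if it is reachable from every configuration. The transience class $\mathrm{tcl}(S)$ is the maximum number of particles that can be added (one at a time, starting from the empty configuration, relaxing after each addition) before a recurrent configuration is reached. $\texttt{GRID}_n$ is the sandpile obtained from the $n\times n$ grid graph (vertices $(i,j)$, $1\le i,j\le n$) by adding a sink joined by one edge to each non-corner boundary vertex and by two edges to each of the four corner vertices (so every ordinary vertex has degree 4). -}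

module Defs where

open import Data.Nat using (ℕ; zero; suc; _+_; _∸_; _≤_; _<_)
open import Data.Nat.Properties using () renaming (_≟_ to _≟ℕ_)
open import Data.Fin using (Fin; toℕ)
open import Data.Fin.Properties using () renaming (_≟_ to _≟F_)
open import Data.List using (List; map; allFin; cartesianProduct)
open import Data.Nat.ListAction using (sum)
open import Data.Product using (Σ; _×_; _,_)
open import Data.Product.Properties using (≡-dec)
open import Relation.Nullary using (¬_; yes; no)
open import Relation.Binary.Definitions using (DecidableEquality)
open import Relation.Binary.PropositionalEquality using (_≡_)
open import Relation.Binary.Construct.Closure.ReflexiveTransitive using (Star)

-- A sandpile: a finite multigraph on ordinary vertices V (enumerated by
-- the list `verts`, each vertex exactly once), edge multiplicities `mult`
-- between ordinary vertices, and `sinkMult v` edges from v to the sink.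

record Sandpile : Set₁ where
  field
    V        : Set
    _≟V_     : DecidableEquality V
    verts    : List V
    mult     : V → V → ℕ
    sinkMult : V → ℕ

  deg : V → ℕ
  deg v = sum (map (mult v) verts) + sinkMult v

  Config : Set
  Config = V → ℕ

  empty : Config
  empty _ = 0

  add : V → Config → Config
  add v c u with u ≟V v
  ... | yes _ = suc (c u)
  ... | no  _ = c u

  topple : V → Config → Config
  topple v c u with u ≟V v
  ... | yes _ = (c u + mult v u) ∸ deg v
  ... | no  _ = c u + mult v u

  Unstable : Config → V → Set
  Unstable c v = deg v ≤ c v

  Stable : Config → Set
  Stable c = ∀ v → c v < deg v

  TopStep : Config → Config → Set
  TopStep c c' = Σ V λ v → Unstable c v × (∀ u → c' u ≡ topple v c u)

  Relaxes : Config → Config → Set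
  Relaxes c c' = Star TopStep c c' × Stable c'

  Reachable : Config → Config → Set
  Reachable c₁ c₂ = Σ Config λ a → Relaxes (λ v → c₁ v + a v) c₂

  Recurrent : Config → Set
  Recurrent c = ∀ c₁ → Reachable c₁ c

  data NonRecRun : Config → ℕ → Set where
    done : ∀ c → NonRecRun c 0
    step : ∀ {c c' k} (v : V) → ¬ Recurrent c → Relaxes (add v c) c' →
           NonRecRun c' k → NonRecRun c (suc k)

  TclAtMost : ℕ → Set
  TclAtMost B = ∀ k → NonRecRun empty k → k ≤ B

private
  b2n : {A : Set} → (x y : A) → DecidableEquality A → ℕ
  b2n x y eq with eq x y
  ... | yes _ = 1
  ... | no  _ = 0

  adjℕ : ℕ → ℕ → ℕ
  adjℕ a b = b2n (suc a) b _≟ℕ_ + b2n (suc b) a _≟ℕ_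

GRID : ℕ → Sandpile
GRID n = record
  { V        = Fin n × Fin n
  ; _≟V_     = ≡-dec _≟F_ _≟F_
  ; verts    = cartesianProduct (allFin n) (allFin n)
  ; mult     = λ { (i , j) (i' , j') →
                   b2n i i' _≟F_ * adjℕ (toℕ j) (toℕ j')
                 + b2n j j' _≟F_ * adjℕ (toℕ i) (toℕ i') }
  ; sinkMult = λ { (i , j) →
                   b2n (toℕ i) 0 _≟ℕ_ + b2n (suc (toℕ i)) n _≟ℕ_
                 + b2n (toℕ j) 0 _≟ℕ_ + b2n (suc (toℕ j)) n _≟ℕ_ }
  }
  where open import Data.Nat using (_*_)

{-# OPTIONS --safe #-}
module Submission where

open import Defs

-- Let u count the topplings of each vertex.  If every vertex has toppled, there is no forbidden
-- subconfiguration (in any set F, the vertex whose last toppling is the oldest has since received a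
-- particle along every edge from F), hence the configuration is recurrent.  Otherwise u vanishes at
-- some w.  Extended by zero to the sink, u satisfies Δu ≤ 3, and the number of particles added so far
-- is Σ c plus the flux Σ sinkMult · u, so it remains to bound u on the boundary, given u(w) = 0.
--
-- Testing against h = xy (1/S² - 1/r²)₊ with S = (x-a)² + (y-b)² + c gives Σ u Δh ≤ 3 Σ h.  The
-- factor xy makes h vanish on two sides of the grid, the truncation on the other two; and Δh is at
-- least of order (ay + bx)/S³ off a neighbourhood of (a,b).  With (a,b) = w in the first quadrant and
-- c = 1 this bounds the mass of u on a ball of radius n/16 about (n/4, n/4) by O(n⁶), because near w
-- itself u is bounded by Δu ≤ 3 alone.  With (a,b) the centre of that ball and c of order n²,
-- it bounds the mass on the reflected balls by that on the first one, and the sum of u over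
-- the nearby half sides by n times it, which is O(n⁷).

-- The function xy/(x² + y²)² is harmonic, a multiple of the imaginary part of 1/z². Moving the pole
-- of the denominator alone to (a,b) leaves the leading Laplacian 8(ay + bx)/S³, positive in the
-- whole quadrant; this is where the exponent 2 comes from. The constant c and the discretisation
-- cost `error`/S⁴, which is dominated only away from the pole. The delicate point is uniformity
-- when the untoppled vertex is close to a side. On the ball the gain is at least of order t(a +
-- b)/t⁶, and Σ xy/S² is O(t(a + b)): both carry the factor a + b, which cancels. Next to the pole
-- the loss is at most a constant times xy/S², so the same sum covers it. Everything is compared in
-- ℕ: reciprocals are multiplied by a common T divisible by every S that occurs, and negative terms
-- are moved to the other side. Lengths are measured in t = (n + 1)/64, rounded down, and 64t ≤ n +
-- 1 ≤ 68t once t ≥ 16; for smaller t the grid has bounded size.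

-- The discrete Laplacian of xy/S² over the integers

module Taylor where
  open import Data.Integer hiding (∣_∣)
  open import Data.Integer.Properties
  open import Data.Integer.Tactic.RingSolver using (solve-∀)
  open import Data.Nat as ℕ using (ℕ; z≤n; s≤s; ∣_-_∣)
  import Data.Nat.Properties as ℕ
  open import Data.Sum using (inj₁; inj₂; _⊎_)
  open import Relation.Binary.PropositionalEquality

  square-nonNeg : ∀ i → 0ℤ ≤ i * i
  square-nonNeg (+ n)      = subst (0ℤ ≤_) (pos-* n n) (+≤+ z≤n)
  square-nonNeg (-[1+ n ]) = +≤+ z≤n

  *-nonNeg : ∀ {i j} → 0ℤ ≤ i → 0ℤ ≤ j → 0ℤ ≤ i * j
  *-nonNeg {i} {j} p q = subst (_≤ i * j) (*-zeroʳ i) (*-monoˡ-≤-nonNeg i {{nonNegative p}} q)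

  ≤-by : ∀ {i j} k → 0ℤ ≤ k → i + k ≡ j → i ≤ j
  ≤-by {i} k k≥0 refl = i≤i+j i k {{nonNegative k≥0}}

  -- Third-order Taylor expansion of 1/S² around S, a lower bound since it is truncated at odd order.
  taylor : ∀ g g′ S t {S′} → 0ℤ ≤ S → 0ℤ < S′ → S′ ≡ S + t → g * S ≡ g′ * S′ →
    g * g * (S * S * S - + 2 * t * (S * S) + + 3 * (t * t) * S - + 4 * (t * t * t)) ≤ g′ * g′ * (S * S * S)
  taylor g g′ S t S≥0 S′>0 refl eq =
    *-cancelʳ-≤-pos _ _ (S′ * S′) {{positive (subst (_< S′ * S′) (*-zeroʳ S′) (*-monoˡ-<-pos S′ {{positive S′>0}} S′>0))}}
      -- The remainder of the expansion is t⁴(5S + 4t)/(S⁵(S + t)²), and 5S + 4t = S + 4S′ is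
      -- nonnegative whatever the sign of t.
      (≤-by (g * (t * t) * (g * (t * t)) * (S + + 4 * S′))
        (*-nonNeg (square-nonNeg (g * (t * t))) (+-mono-≤ S≥0 (*-nonNeg {+ 4} (+≤+ z≤n) (<⇒≤ S′>0))))
        (trans (expand g S t) (trans (cong (λ k → k * k * (S * S * S)) eq) (regroup g′ S S′))))
    where
    S′ = S + t
    expand : ∀ g S t → let S′ = S + t in
      g * g * (S * S * S - + 2 * t * (S * S) + + 3 * (t * t) * S - + 4 * (t * t * t)) * (S′ * S′)
        + g * (t * t) * (g * (t * t)) * (S + + 4 * S′) ≡ (g * S) * (g * S) * (S * S * S)
    expand = solve-∀
    regroup : ∀ g′ S S′ → (g′ * S′) * (g′ * S′) * (S * S * S) ≡ g′ * g′ * (S * S * S) * (S′ * S′)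
    regroup = solve-∀

  -- The factor x of the test function weighs the east and west neighbours differently. Beyond the
  -- leading -8dS², their difference contributes (24S - 48)d - 64d³, of either sign. Since p³ ≤ Sp
  -- and p ≤ Sp, the slack 136 = 24 + 48 + 64 suffices.
  cubic-remainder : ∀ {d p r S} → d ≡ p ⊎ d ≡ - p → 0ℤ ≤ p → 0ℤ ≤ r → S ≡ d * d + + 1 + r →
    0ℤ ≤ + 136 * S * p + (+ 24 * S - + 48) * d - + 64 * (d * (d * d))
  cubic-remainder {p = p} {r} (inj₁ refl) p≥0 r≥0 refl =
    subst (0ℤ ≤_) (eq p r) (*-nonNeg p≥0 (+-mono-≤ (+-mono-≤ (*-nonNeg {+ 96} (+≤+ z≤n) (square-nonNeg p)) (+≤+ {_} {112} z≤n)) (*-nonNeg {+ 160} (+≤+ z≤n) r≥0)))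
    where
    eq : ∀ p r → p * (+ 96 * (p * p) + + 112 + + 160 * r) ≡ + 136 * (p * p + + 1 + r) * p + (+ 24 * (p * p + + 1 + r) - + 48) * p - + 64 * (p * (p * p))
    eq = solve-∀
  cubic-remainder {p = p} {r} (inj₂ refl) p≥0 r≥0 refl =
    subst (0ℤ ≤_) (eq p r) (*-nonNeg p≥0 (+-mono-≤ (+-mono-≤ (*-nonNeg {+ 176} (+≤+ z≤n) (square-nonNeg p)) (+≤+ {_} {160} z≤n)) (*-nonNeg {+ 112} (+≤+ z≤n) r≥0)))
    where
    eq : ∀ p r → p * (+ 176 * (p * p) + + 160 + + 112 * r) ≡ + 136 * (- p * - p + + 1 + r) * p + (+ 24 * (- p * - p + + 1 + r) - + 48) * - p - + 64 * (- p * (- p * - p))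
    eq = solve-∀


  -- The Laplacian of xy/S² at (x , y), multiplied by S³: here g is a multiple of 1/S, and the last
  -- summand, with p = ∣d∣ and q = ∣e∣, absorbs the discretisation error.
  laplacian : ∀ {c′ x′ y′ d e p q g gE gW gN gS} →
    0ℤ ≤ c′ → 0ℤ ≤ x′ → 0ℤ ≤ y′ → 0ℤ ≤ p → 0ℤ ≤ q → d ≡ p ⊎ d ≡ - p → e ≡ q ⊎ e ≡ - q →
    let x = + 1 + x′ ; y = + 1 + y′ ; c = + 1 + c′ ; S = d * d + e * e + c in
    g * S ≡ gE * (S + (+ 1 + + 2 * d)) → g * S ≡ gW * (S + (+ 1 - + 2 * d)) →
    g * S ≡ gN * (S + (+ 1 + + 2 * e)) → g * S ≡ gS * (S + (+ 1 - + 2 * e)) →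
    g * g * (+ 4 * (x * y) * (S * S * S) + + 8 * ((x - d) * y + (y - e) * x) * (S * S))
    ≤ (((+ 1 + x) * y * (gE * gE) + x′ * y * (gW * gW)) + (x * (+ 1 + y) * (gN * gN) + x * y′ * (gS * gS))) * (S * S * S)
      + g * g * (S * ((+ 24 * c + + 84) * (x * y) + + 136 * (p * y + q * x)))
  laplacian {c′} {x′} {y′} {d} {e} {p} {q} {g} {gE} {gW} {gN} {gS} c′≥0 x′≥0 y′≥0 p≥0 q≥0 dp eq EqE EqW EqN EqS = begin
    g * g * (+ 4 * (x * y) * (S * S * S) + + 8 * ((x - d) * y + (y - e) * x) * (S * S))
      -- Over the four expansions the terms of order S² collapse to 8(2xy - dy - ex)S² = 8((x - d)y
      -- + (y - e)x)S². What remains after adding the slack is a nonnegative multiple of xy and one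
      -- cubic remainder per axis.
      ≤⟨ ≤-by (g * g * (x * y * (+ 80 + + 96 * c′) + y * (+ 136 * S * p + (+ 24 * S - + 48) * d - + 64 * (d * (d * d))) + x * (+ 136 * S * q + (+ 24 * S - + 48) * e - + 64 * (e * (e * e))))) (*-nonNeg (square-nonNeg g) rem≥0) (identity c′ x′ y′ d e p q g) ⟩
    (((+ 1 + x) * y * (g * g * (S * S * S - + 2 * (+ 1 + + 2 * d) * (S * S) + + 3 * ((+ 1 + + 2 * d) * (+ 1 + + 2 * d)) * S - + 4 * ((+ 1 + + 2 * d) * (+ 1 + + 2 * d) * (+ 1 + + 2 * d)))) + x′ * y * (g * g * (S * S * S - + 2 * (+ 1 - + 2 * d) * (S * S) + + 3 * ((+ 1 - + 2 * d) * (+ 1 - + 2 * d)) * S - + 4 * ((+ 1 - + 2 * d) * (+ 1 - + 2 * d) * (+ 1 - + 2 * d))))) + (x * (+ 1 + y) * (g * g * (S * S * S - + 2 * (+ 1 + + 2 * e) * (S * S) + + 3 * ((+ 1 + + 2 * e) * (+ 1 + + 2 * e)) * S - + 4 * ((+ 1 + + 2 * e) * (+ 1 + + 2 * e) * (+ 1 + + 2 * e)))) + x * y′ * (g * g * (S * S * S - + 2 * (+ 1 - + 2 * e) * (S * S) + + 3 * ((+ 1 - + 2 * e) * (+ 1 - + 2 * e)) * S - + 4 * ((+ 1 - + 2 * e) * (+ 1 - + 2 * e) * (+ 1 - + 2 * e)))))) + g * g * (S * ((+ 24 * c + + 84) * (x * y) + + 136 * (p * y + q * x)))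
      ≤⟨ +-monoˡ-≤ (g * g * (S * ((+ 24 * c + + 84) * (x * y) + + 136 * (p * y + q * x)))) (+-mono-≤
          (+-mono-≤ (scale {(+ 1 + x) * y} (*-nonNeg 1+x≥0 y≥0) (taylor g gE S (+ 1 + + 2 * d) S≥0 (positiveˡ (d + + 1) e (shift d e c′)) refl EqE))
                    (scale {x′ * y} (*-nonNeg x′≥0 y≥0) (taylor g gW S (+ 1 - + 2 * d) S≥0 (positiveˡ (d - + 1) e (shift′ d e c′)) refl EqW)))
          (+-mono-≤ (scale {x * (+ 1 + y)} (*-nonNeg x≥0 1+y≥0) (taylor g gN S (+ 1 + + 2 * e) S≥0 (positiveˡ d (e + + 1) (shift₂ d e c′)) refl EqN))
                    (scale {x * y′} (*-nonNeg x≥0 y′≥0) (taylor g gS S (+ 1 - + 2 * e) S≥0 (positiveˡ d (e - + 1) (shift₂′ d e c′)) refl EqS)))) ⟩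
    (((+ 1 + x) * y * (gE * gE * (S * S * S)) + x′ * y * (gW * gW * (S * S * S))) + (x * (+ 1 + y) * (gN * gN * (S * S * S)) + x * y′ * (gS * gS * (S * S * S)))) + g * g * (S * ((+ 24 * c + + 84) * (x * y) + + 136 * (p * y + q * x)))
      ≡⟨ cong (_+ g * g * (S * ((+ 24 * c + + 84) * (x * y) + + 136 * (p * y + q * x)))) (factor x′ y′ (gE * gE) (gW * gW) (gN * gN) (gS * gS) (S * S * S)) ⟩
    (((+ 1 + x) * y * (gE * gE) + x′ * y * (gW * gW)) + (x * (+ 1 + y) * (gN * gN) + x * y′ * (gS * gS))) * (S * S * S) + g * g * (S * ((+ 24 * c + + 84) * (x * y) + + 136 * (p * y + q * x))) ∎
    where
    open ≤-Reasoning
    x = + 1 + x′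
    y = + 1 + y′
    c = + 1 + c′
    S = d * d + e * e + c
    1≥0 : 0ℤ ≤ + 1
    1≥0 = +≤+ z≤n
    x≥0 : 0ℤ ≤ x
    x≥0 = +-mono-≤ 1≥0 x′≥0
    y≥0 : 0ℤ ≤ y
    y≥0 = +-mono-≤ 1≥0 y′≥0
    1+x≥0 : 0ℤ ≤ + 1 + x
    1+x≥0 = +-mono-≤ 1≥0 x≥0
    1+y≥0 : 0ℤ ≤ + 1 + y
    1+y≥0 = +-mono-≤ 1≥0 y≥0
    c≥0 : 0ℤ ≤ c
    c≥0 = +-mono-≤ 1≥0 c′≥0
    S≥0 : 0ℤ ≤ S
    S≥0 = +-mono-≤ (+-mono-≤ (square-nonNeg d) (square-nonNeg e)) c≥0
    positiveˡ : ∀ {S′} d e → d * d + e * e + c ≡ S′ → 0ℤ < S′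
    positiveˡ d e refl = +-mono-≤-< (+-mono-≤ (square-nonNeg d) (square-nonNeg e)) (+-mono-<-≤ (+<+ (s≤s z≤n)) c′≥0)
    shift : ∀ d e c′ → (d + + 1) * (d + + 1) + e * e + (+ 1 + c′) ≡ d * d + e * e + (+ 1 + c′) + (+ 1 + + 2 * d)
    shift = solve-∀
    shift′ : ∀ d e c′ → (d - + 1) * (d - + 1) + e * e + (+ 1 + c′) ≡ d * d + e * e + (+ 1 + c′) + (+ 1 - + 2 * d)
    shift′ = solve-∀
    shift₂ : ∀ d e c′ → d * d + (e + + 1) * (e + + 1) + (+ 1 + c′) ≡ d * d + e * e + (+ 1 + c′) + (+ 1 + + 2 * e)
    shift₂ = solve-∀
    shift₂′ : ∀ d e c′ → d * d + (e - + 1) * (e - + 1) + (+ 1 + c′) ≡ d * d + e * e + (+ 1 + c′) + (+ 1 - + 2 * e)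
    shift₂′ = solve-∀
    scale : ∀ {k i j} → 0ℤ ≤ k → i ≤ j → k * i ≤ k * j
    scale {k} k≥0 = *-monoˡ-≤-nonNeg k {{nonNegative k≥0}}
    swap₁ : ∀ d e c′ → d * d + e * e + (+ 1 + c′) ≡ d * d + + 1 + (e * e + c′)
    swap₁ = solve-∀
    swap₂ : ∀ d e c′ → d * d + e * e + (+ 1 + c′) ≡ e * e + + 1 + (d * d + c′)
    swap₂ = solve-∀
    rem≥0 : 0ℤ ≤ (x * y * (+ 80 + + 96 * c′) + y * (+ 136 * S * p + (+ 24 * S - + 48) * d - + 64 * (d * (d * d))) + x * (+ 136 * S * q + (+ 24 * S - + 48) * e - + 64 * (e * (e * e))))
    rem≥0 = +-mono-≤ (+-mono-≤ (*-nonNeg (*-nonNeg x≥0 y≥0) (+-mono-≤ (+≤+ {_} {80} z≤n) (*-nonNeg {+ 96} (+≤+ z≤n) c′≥0)))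
        (*-nonNeg y≥0 (cubic-remainder dp p≥0 (+-mono-≤ (square-nonNeg e) c′≥0) (swap₁ d e c′))))
      (*-nonNeg x≥0 (cubic-remainder eq q≥0 (+-mono-≤ (square-nonNeg d) c′≥0) (swap₂ d e c′)))
    factor : ∀ x′ y′ E W N H K → let x = + 1 + x′ ; y = + 1 + y′  in
      (((+ 1 + x) * y * (E * K) + x′ * y * (W * K)) + (x * (+ 1 + y) * (N * K) + x * y′ * (H * K))) ≡ (((+ 1 + x) * y * E + x′ * y * W) + (x * (+ 1 + y) * N + x * y′ * H)) * K
    factor = solve-∀
    identity : ∀ c′ x′ y′ d e p q g → let x = + 1 + x′ ; y = + 1 + y′ ; c = + 1 + c′ ; S = d * d + e * e + c in
      g * g * (+ 4 * (x * y) * (S * S * S) + + 8 * ((x - d) * y + (y - e) * x) * (S * S)) + g * g * (x * y * (+ 80 + + 96 * c′) + y * (+ 136 * S * p + (+ 24 * S - + 48) * d - + 64 * (d * (d * d))) + x * (+ 136 * S * q + (+ 24 * S - + 48) * e - + 64 * (e * (e * e))))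
      ≡ (((+ 1 + x) * y * (g * g * (S * S * S - + 2 * (+ 1 + + 2 * d) * (S * S) + + 3 * ((+ 1 + + 2 * d) * (+ 1 + + 2 * d)) * S - + 4 * ((+ 1 + + 2 * d) * (+ 1 + + 2 * d) * (+ 1 + + 2 * d)))) + x′ * y * (g * g * (S * S * S - + 2 * (+ 1 - + 2 * d) * (S * S) + + 3 * ((+ 1 - + 2 * d) * (+ 1 - + 2 * d)) * S - + 4 * ((+ 1 - + 2 * d) * (+ 1 - + 2 * d) * (+ 1 - + 2 * d))))) + (x * (+ 1 + y) * (g * g * (S * S * S - + 2 * (+ 1 + + 2 * e) * (S * S) + + 3 * ((+ 1 + + 2 * e) * (+ 1 + + 2 * e)) * S - + 4 * ((+ 1 + + 2 * e) * (+ 1 + + 2 * e) * (+ 1 + + 2 * e)))) + x * y′ * (g * g * (S * S * S - + 2 * (+ 1 - + 2 * e) * (S * S) + + 3 * ((+ 1 - + 2 * e) * (+ 1 - + 2 * e)) * S - + 4 * ((+ 1 - + 2 * e) * (+ 1 - + 2 * e) * (+ 1 - + 2 * e)))))) + g * g * (S * ((+ 24 * c + + 84) * (x * y) + + 136 * (p * y + q * x)))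
    identity = solve-∀

  -- Each derived quantity is a variable tied by an equation, so that casts of naturals, which agree
  -- with these expressions only propositionally, can be plugged in.
  laplacian-ℤ : ∀ {a b c′ x′ y′ d e p q g gE gW gN gS S SE SW SN SS} →
    0ℤ ≤ c′ → 0ℤ ≤ x′ → 0ℤ ≤ y′ → 0ℤ ≤ p → 0ℤ ≤ q → d ≡ p ⊎ d ≡ - p → e ≡ q ⊎ e ≡ - q →
    let x = + 1 + x′ ; y = + 1 + y′ ; c = + 1 + c′ in
    a ≡ x - d → b ≡ y - e → S ≡ d * d + e * e + c →
    SE ≡ S + (+ 1 + + 2 * d) → SW ≡ S + (+ 1 - + 2 * d) → SN ≡ S + (+ 1 + + 2 * e) → SS ≡ S + (+ 1 - + 2 * e) →
    g * S ≡ gE * SE → g * S ≡ gW * SW → g * S ≡ gN * SN → g * S ≡ gS * SS →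
    g * g * (+ 4 * (x * y) * (S * S * S) + + 8 * (a * y + b * x) * (S * S))
    ≤ (((+ 1 + x) * y * (gE * gE) + x′ * y * (gW * gW)) + (x * (+ 1 + y) * (gN * gN) + x * y′ * (gS * gS))) * (S * S * S)
      + g * g * (S * ((+ 24 * c + + 84) * (x * y) + + 136 * (p * y + q * x)))
  laplacian-ℤ {g = g} {gE} {gW} {gN} {gS} c′≥0 x′≥0 y′≥0 p≥0 q≥0 dp eq refl refl refl refl refl refl refl =
    laplacian {g = g} {gE} {gW} {gN} {gS} c′≥0 x′≥0 y′≥0 p≥0 q≥0 dp eq

  distance² : ∀ x a → + (∣ x - a ∣ ℕ.* ∣ x - a ∣) ≡ (+ x - + a) * (+ x - + a)
  distance-sign : ∀ x a → (+ x - + a ≡ + ∣ x - a ∣) ⊎ (+ x - + a ≡ - + ∣ x - a ∣)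
  distance-sign x a with ℕ.≤-total a x
  ... | inj₁ a≤x = inj₁ (trans (m-n≡m⊖n x a) (trans (⊖-≥ a≤x) (cong +_ (sym (trans (ℕ.∣-∣-comm x a) (ℕ.m≤n⇒∣m-n∣≡n∸m a≤x))))))
  ... | inj₂ x≤a = inj₂ (trans (m-n≡m⊖n x a) (trans (⊖-≤ x≤a) (cong (λ k → - + k) (sym (ℕ.m≤n⇒∣m-n∣≡n∸m x≤a)))))
  distance² x a with + x - + a | distance-sign x a
  ... | _ | inj₁ refl = pos-* ∣ x - a ∣ ∣ x - a ∣
  ... | _ | inj₂ refl = trans (pos-* ∣ x - a ∣ ∣ x - a ∣) (neg-square (+ ∣ x - a ∣))
    where
    neg-square : ∀ k → k * k ≡ - k * - k
    neg-square = solve-∀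

  -- Syntax without subtraction, so that the integer value of a term is the cast of its natural
  -- value; a single `cast-≤` then brings an inequality back to ℕ.
  data Poly : Set where
    ⟨_⟩     : ℕ → Poly
    _⊕_ _⊗_ : Poly → Poly → Poly

  infixl 6 _⊕_
  infixl 7 _⊗_

  evalℕ : Poly → ℕ
  evalℕ ⟨ n ⟩   = n
  evalℕ (p ⊕ q) = evalℕ p ℕ.+ evalℕ q
  evalℕ (p ⊗ q) = evalℕ p ℕ.* evalℕ q

  evalℤ : Poly → ℤ
  evalℤ ⟨ n ⟩   = + n
  evalℤ (p ⊕ q) = evalℤ p + evalℤ q
  evalℤ (p ⊗ q) = evalℤ p * evalℤ q

  cast : ∀ p → evalℤ p ≡ + evalℕ p
  cast ⟨ n ⟩   = refl
  cast (p ⊕ q) = cong₂ _+_ (cast p) (cast q)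
  cast (p ⊗ q) = trans (cong₂ _*_ (cast p) (cast q)) (sym (pos-* (evalℕ p) (evalℕ q)))

  cast-≤ : ∀ p q → evalℤ p ≤ evalℤ q → evalℕ p ℕ.≤ evalℕ q
  cast-≤ p q p≤q = drop‿+≤+ (subst₂ _≤_ (cast p) (cast q) p≤q)

open import Data.Bool using (Bool; true; false; T; _∧_; not)
import Data.Bool.Properties as Bool
open import Data.Empty using (⊥-elim)
import Data.Integer as ℤ
import Data.Integer.Properties as ℤP
import Data.Integer.Tactic.RingSolver as ℤR
open import Data.List using (List; []; _∷_; map; allFin; tabulate; cartesianProduct)
open import Data.List.Properties using (map-++; map-∘; map-tabulate)
open import Data.Nat
open import Data.Nat.Divisibility using (∣-trans; m∣m*n; m≤n⇒m!∣n!)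
open import Data.Nat.DivMod using (m/n*n≡m; /-monoʳ-≤; m≡m%n+[m/n]*n; m%n<n)
open import Data.Nat.ListAction using (sum)
open import Data.Nat.ListAction.Properties using (sum-++)
open import Data.Nat.Properties
open import Data.Nat.Tactic.RingSolver using (solve-∀)
open import Data.Product using (Σ; _×_; _,_; ∃; proj₁; proj₂)
open import Data.Sum using (_⊎_; inj₁; inj₂)
open import Function using (_∘_; id; flip)
open import Relation.Binary.Construct.Closure.ReflexiveTransitive using (Star; ε; _◅_; _◅◅_)
open import Relation.Binary.PropositionalEquality
open import Relation.Nullary using (¬_; Dec; yes; no; does; _×-dec_; ¬?)
open import Relation.Nullary.Decidable using (toWitness)
open Taylor using (laplacian-ℤ; distance²; distance-sign; Poly; ⟨_⟩; _⊕_; _⊗_; cast-≤)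

private variable
  n : ℕ

-- Finite sums over intervals and squares

Σ< : ℕ → (ℕ → ℕ) → ℕ
Σ< zero    f = 0
Σ< (suc n) f = f 0 + Σ< n (f ∘ suc)

+-interchange : ∀ a b c d → a + b + (c + d) ≡ a + c + (b + d)
+-interchange = solve-∀

Σ<-cong : ∀ n {f g : ℕ → ℕ} → (∀ {i} → i < n → f i ≡ g i) → Σ< n f ≡ Σ< n g
Σ<-cong zero    h = refl
Σ<-cong (suc n) h = cong₂ _+_ (h z<s) (Σ<-cong n (h ∘ s<s))

Σ<-mono : ∀ n {f g : ℕ → ℕ} → (∀ {i} → i < n → f i ≤ g i) → Σ< n f ≤ Σ< n g
Σ<-mono zero    h = z≤n
Σ<-mono (suc n) h = +-mono-≤ (h z<s) (Σ<-mono n (h ∘ s<s))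

Σ<-+ : ∀ n (f g : ℕ → ℕ) → Σ< n (λ i → f i + g i) ≡ Σ< n f + Σ< n g
Σ<-+ zero    f g = refl
Σ<-+ (suc n) f g = trans (cong (f 0 + g 0 +_) (Σ<-+ n (f ∘ suc) (g ∘ suc)))
                         (+-interchange (f 0) (g 0) _ _)

Σ<-*ˡ : ∀ n k (f : ℕ → ℕ) → Σ< n (λ i → k * f i) ≡ k * Σ< n f
Σ<-*ˡ zero    k f = sym (*-zeroʳ k)
Σ<-*ˡ (suc n) k f = trans (cong (k * f 0 +_) (Σ<-*ˡ n k (f ∘ suc)))
                          (sym (*-distribˡ-+ k (f 0) _))

Σ<-0 : ∀ n → Σ< n (λ _ → 0) ≡ 0
Σ<-0 zero    = refl
Σ<-0 (suc n) = Σ<-0 n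

Σ<-const : ∀ n k → Σ< n (λ _ → k) ≡ n * k
Σ<-const zero    k = refl
Σ<-const (suc n) k = cong (k +_) (Σ<-const n k)

Σ<-swap : ∀ m n (f : ℕ → ℕ → ℕ) →
          Σ< m (λ i → Σ< n (λ j → f i j)) ≡ Σ< n (λ j → Σ< m (λ i → f i j))
Σ<-swap zero    n f = sym (Σ<-0 n)
Σ<-swap (suc m) n f = trans (cong (Σ< n (f 0) +_) (Σ<-swap m n (f ∘ suc)))
                            (sym (Σ<-+ n (f 0) _))

Σ<-last : ∀ n (f : ℕ → ℕ) → Σ< (suc n) f ≡ Σ< n f + f n
Σ<-last zero    f = +-comm (f 0) 0
Σ<-last (suc n) f = trans (cong (f 0 +_) (Σ<-last n (f ∘ suc))) (sym (+-assoc (f 0) _ _))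

Σ<-reverse : ∀ n (f : ℕ → ℕ) → Σ< n (λ i → f (n ∸ suc i)) ≡ Σ< n f
Σ<-reverse zero    f = refl
Σ<-reverse (suc n) f = trans (cong (f n +_) (Σ<-reverse n f))
                             (trans (+-comm (f n) _) (sym (Σ<-last n f)))

term≤Σ< : ∀ n (f : ℕ → ℕ) {i} → i < n → f i ≤ Σ< n f
term≤Σ< (suc n) f {zero}  _         = m≤m+n _ _
term≤Σ< (suc n) f {suc i} (s<s i<n) = ≤-trans (term≤Σ< n (f ∘ suc) i<n) (m≤n+m _ _)

-- The distances ∣ i - a ∣ take each value at most twice.
Σ<-distance : ∀ n a (f : ℕ → ℕ) → Σ< n (λ i → f ∣ i - a ∣) ≤ Σ< n f + Σ< (suc a) f
Σ<-distance n       zero    f = ≤-trans (≤-reflexive (Σ<-cong n λ {i} _ → cong f (∣-∣-identityʳ i))) (m≤m+n _ _)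
Σ<-distance zero    (suc a) f = z≤n
Σ<-distance (suc n) (suc a) f = begin
  f (suc a) + Σ< n (λ i → f ∣ i - a ∣)        ≤⟨ +-monoʳ-≤ (f (suc a)) (Σ<-distance n a f) ⟩
  f (suc a) + (Σ< n f + Σ< (suc a) f)         ≡⟨ lem (f (suc a)) (Σ< n f) (Σ< (suc a) f) ⟩
  Σ< n f + (Σ< (suc a) f + f (suc a))         ≡⟨ cong (Σ< n f +_) (Σ<-last (suc a) f) ⟨
  Σ< n f + Σ< (suc (suc a)) f                 ≤⟨ +-monoˡ-≤ _ (≤-trans (m≤m+n _ (f n)) (≤-reflexive (sym (Σ<-last n f)))) ⟩
  Σ< (suc n) f + Σ< (suc (suc a)) f           ∎
  where
    open ≤-Reasoning
    lem : ∀ p q r → p + (q + r) ≡ q + (r + p)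
    lem = solve-∀

opaque
  -- Coordinates run from 1 to n; the indices 0 and n + 1 are left to the ring of zeros that stands
  -- for the sink.
  ΣΣ : ℕ → (ℕ → ℕ → ℕ) → ℕ
  ΣΣ n f = Σ< n λ i → Σ< n λ j → f (suc i) (suc j)

  ΣΣ-mono : ∀ n {f g : ℕ → ℕ → ℕ} →
            (∀ {i j} → i < n → j < n → f (suc i) (suc j) ≤ g (suc i) (suc j)) → ΣΣ n f ≤ ΣΣ n g
  ΣΣ-mono n h = Σ<-mono n λ i<n → Σ<-mono n λ j<n → h i<n j<n

  ΣΣ-cong : ∀ n {f g : ℕ → ℕ → ℕ} →
            (∀ {i j} → i < n → j < n → f (suc i) (suc j) ≡ g (suc i) (suc j)) → ΣΣ n f ≡ ΣΣ n g
  ΣΣ-cong n h = Σ<-cong n λ i<n → Σ<-cong n λ j<n → h i<n j<n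

  ΣΣ-+ : ∀ n (f g : ℕ → ℕ → ℕ) → ΣΣ n (λ x y → f x y + g x y) ≡ ΣΣ n f + ΣΣ n g
  ΣΣ-+ n f g = trans (Σ<-cong n λ _ → Σ<-+ n _ _) (Σ<-+ n _ _)

  ΣΣ-*ˡ : ∀ n k (f : ℕ → ℕ → ℕ) → ΣΣ n (λ x y → k * f x y) ≡ k * ΣΣ n f
  ΣΣ-*ˡ n k f = trans (Σ<-cong n λ _ → Σ<-*ˡ n k _) (Σ<-*ˡ n k _)

  ΣΣ-swap : ∀ n (f : ℕ → ℕ → ℕ) → ΣΣ n f ≡ ΣΣ n (λ x y → f y x)
  ΣΣ-swap n f = Σ<-swap n n _

  ΣΣ≤ : ∀ n k {f : ℕ → ℕ → ℕ} → (∀ {i j} → i < n → j < n → f (suc i) (suc j) ≤ k) → ΣΣ n f ≤ n * (n * k)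
  ΣΣ≤ n k {f} h = begin
    ΣΣ n f                        ≤⟨ ΣΣ-mono n {f} {λ _ _ → k} h ⟩
    Σ< n (λ i → Σ< n λ j → k)     ≡⟨ Σ<-cong n (λ _ → Σ<-const n k) ⟩
    Σ< n (λ i → n * k)            ≡⟨ Σ<-const n (n * k) ⟩
    n * (n * k)                   ∎
    where open ≤-Reasoning

  ΣΣ-product : ∀ n (f g : ℕ → ℕ) → ΣΣ n (λ x y → f x * g y) ≡ Σ< n (f ∘ suc) * Σ< n (g ∘ suc)
  ΣΣ-product n f g = begin
    Σ< n (λ i → Σ< n λ j → f (suc i) * g (suc j))    ≡⟨ Σ<-cong n (λ {i} _ → trans (Σ<-*ˡ n (f (suc i)) (g ∘ suc)) (*-comm (f (suc i)) _)) ⟩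
    Σ< n (λ i → Σ< n (g ∘ suc) * f (suc i))          ≡⟨ Σ<-*ˡ n (Σ< n (g ∘ suc)) (f ∘ suc) ⟩
    Σ< n (g ∘ suc) * Σ< n (f ∘ suc)                  ≡⟨ *-comm (Σ< n (g ∘ suc)) _ ⟩
    Σ< n (f ∘ suc) * Σ< n (g ∘ suc)                  ∎
    where open ≡-Reasoning

-- Green's formula on the square

neighbours : (ℕ → ℕ → ℕ) → ℕ → ℕ → ℕ
neighbours u x y = (u (suc x) y + u (pred x) y) + (u x (suc y) + u x (pred y))

record VanishesOnRing (n : ℕ) (u : ℕ → ℕ → ℕ) : Set where
  field
    left   : ∀ y → u 0 y ≡ 0
    right  : ∀ y → u (suc n) y ≡ 0
    bottom : ∀ x → u x 0 ≡ 0
    top    : ∀ x → u x (suc n) ≡ 0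

private
  shift : ∀ n (u h : ℕ → ℕ) → u 0 ≡ 0 → h (suc n) ≡ 0 →
          Σ< n (λ i → u (suc i) * h (suc (suc i))) ≡ Σ< n (λ i → u i * h (suc i))
  shift n u h u₀ hₙ = begin
    Σ< n (λ i → u (suc i) * h (suc (suc i)))   ≡⟨ cong (λ k → k * h 1 + Σ< n (λ i → u (suc i) * h (suc (suc i)))) u₀ ⟨
    Σ< (suc n) (λ i → u i * h (suc i))         ≡⟨ Σ<-last n _ ⟩
    Σ< n (λ i → u i * h (suc i)) + u n * h (suc n) ≡⟨ cong (λ k → Σ< n (λ i → u i * h (suc i)) + u n * k) hₙ ⟩
    Σ< n (λ i → u i * h (suc i)) + u n * 0     ≡⟨ cong (Σ< n (λ i → u i * h (suc i)) +_) (*-zeroʳ (u n)) ⟩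
    Σ< n (λ i → u i * h (suc i)) + 0           ≡⟨ +-identityʳ _ ⟩
    Σ< n (λ i → u i * h (suc i))               ∎
    where open ≡-Reasoning

-- Summation by parts: `shift` moves the index offset from one factor to the other, and the end
-- terms vanish with u and h.
green₁ : ∀ n (u h : ℕ → ℕ) → u 0 ≡ 0 → u (suc n) ≡ 0 → h 0 ≡ 0 → h (suc n) ≡ 0 →
         Σ< n (λ i → u (suc i) * (h (suc (suc i)) + h i)) ≡ Σ< n (λ i → h (suc i) * (u (suc (suc i)) + u i))
green₁ n u h u₀ uₙ h₀ hₙ = begin
  Σ< n (λ i → u (suc i) * (h (suc (suc i)) + h i))
    ≡⟨ Σ<-cong n (λ {i} _ → *-distribˡ-+ (u (suc i)) _ _) ⟩
  Σ< n (λ i → u (suc i) * h (suc (suc i)) + u (suc i) * h i)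
    ≡⟨ Σ<-+ n _ _ ⟩
  Σ< n (λ i → u (suc i) * h (suc (suc i))) + Σ< n (λ i → u (suc i) * h i)
    ≡⟨ cong₂ _+_ (shift n u h u₀ hₙ) (Σ<-cong n (λ {i} _ → *-comm (u (suc i)) (h i))) ⟩
  Σ< n (λ i → u i * h (suc i)) + Σ< n (λ i → h i * u (suc i))
    ≡⟨ cong₂ _+_ (Σ<-cong n (λ {i} _ → *-comm (u i) (h (suc i)))) (sym (shift n h u h₀ uₙ)) ⟩
  Σ< n (λ i → h (suc i) * u i) + Σ< n (λ i → h (suc i) * u (suc (suc i)))
    ≡⟨ +-comm (Σ< n (λ i → h (suc i) * u i)) _ ⟩
  Σ< n (λ i → h (suc i) * u (suc (suc i))) + Σ< n (λ i → h (suc i) * u i)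
    ≡⟨ Σ<-+ n _ _ ⟨
  Σ< n (λ i → h (suc i) * u (suc (suc i)) + h (suc i) * u i)
    ≡⟨ Σ<-cong n (λ {i} _ → *-distribˡ-+ (h (suc i)) _ _) ⟨
  Σ< n (λ i → h (suc i) * (u (suc (suc i)) + u i)) ∎
  where open ≡-Reasoning

module _ {n} {u h : ℕ → ℕ → ℕ} (U : VanishesOnRing n u) (H : VanishesOnRing n h) where
  private
    module U = VanishesOnRing U
    module H = VanishesOnRing H

  opaque
    unfolding ΣΣ

    private
      horizontal : ΣΣ n (λ x y → u x y * (h (suc x) y + h (pred x) y)) ≡ ΣΣ n (λ x y → h x y * (u (suc x) y + u (pred x) y))
      horizontal = trans (Σ<-swap n n _)
        (trans (Σ<-cong n λ {j} _ → green₁ n (λ x → u x (suc j)) (λ x → h x (suc j)) (U.left _) (U.right _) (H.left _) (H.right _))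
               (sym (Σ<-swap n n _)))

      vertical : ΣΣ n (λ x y → u x y * (h x (suc y) + h x (pred y))) ≡ ΣΣ n (λ x y → h x y * (u x (suc y) + u x (pred y)))
      vertical = Σ<-cong n λ {i} _ → green₁ n (u (suc i)) (h (suc i)) (U.bottom _) (U.top _) (H.bottom _) (H.top _)

  green : ΣΣ n (λ x y → u x y * neighbours h x y) ≡ ΣΣ n (λ x y → h x y * neighbours u x y)
  green = begin
    ΣΣ n (λ x y → u x y * neighbours h x y)
      ≡⟨ ΣΣ-cong n (λ {i} {j} _ _ → *-distribˡ-+ (u (suc i) (suc j)) _ _) ⟩
    ΣΣ n (λ x y → u x y * (h (suc x) y + h (pred x) y) + u x y * (h x (suc y) + h x (pred y)))
      ≡⟨ ΣΣ-+ n _ _ ⟩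
    ΣΣ n (λ x y → u x y * (h (suc x) y + h (pred x) y)) + ΣΣ n (λ x y → u x y * (h x (suc y) + h x (pred y)))
      ≡⟨ cong₂ _+_ horizontal vertical ⟩
    ΣΣ n (λ x y → h x y * (u (suc x) y + u (pred x) y)) + ΣΣ n (λ x y → h x y * (u x (suc y) + u x (pred y)))
      ≡⟨ ΣΣ-+ n _ _ ⟨
    ΣΣ n (λ x y → h x y * (u (suc x) y + u (pred x) y) + h x y * (u x (suc y) + u x (pred y)))
      ≡⟨ ΣΣ-cong n (λ {i} {j} _ _ → sym (*-distribˡ-+ (h (suc i) (suc j)) _ _)) ⟩
    ΣΣ n (λ x y → h x y * neighbours u x y) ∎
    where open ≡-Reasoning

-- Odometers and their pairing with test functions

record Odometer (n : ℕ) (u : ℕ → ℕ → ℕ) : Set where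
  field
    ring  : VanishesOnRing n u
    almostSuperharmonic : ∀ {i j} → i < n → j < n →
      neighbours u (suc i) (suc j) ≤ 4 * u (suc i) (suc j) + 3

module _ {n} {u : ℕ → ℕ → ℕ} (O : Odometer n u) where
  open Odometer O

  -- The Laplacian is symmetric, so the hypothesis on h weighted by u can be played against Δu ≤ 3
  -- weighted by h. The common term 4 Σ u h is kept on both sides and cancelled at the end, which
  -- avoids subtraction.
  duality : ∀ {h p g : ℕ → ℕ → ℕ} → VanishesOnRing n h →
    (∀ {i j} → i < n → j < n → 4 * h (suc i) (suc j) + p (suc i) (suc j) ≤ neighbours h (suc i) (suc j) + g (suc i) (suc j)) →
    ΣΣ n (λ x y → u x y * p x y) ≤ ΣΣ n (λ x y → u x y * g x y) + 3 * ΣΣ n h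
  duality {h} {p} {g} H sub = +-cancelˡ-≤ X _ _ (begin
    X + ΣΣ n (λ x y → u x y * p x y)
      ≡⟨ cong (_+ ΣΣ n (λ x y → u x y * p x y)) (ΣΣ-*ˡ n 4 _) ⟨
    ΣΣ n (λ x y → 4 * (u x y * h x y)) + ΣΣ n (λ x y → u x y * p x y)
      ≡⟨ ΣΣ-+ n _ _ ⟨
    ΣΣ n (λ x y → 4 * (u x y * h x y) + u x y * p x y)
      ≤⟨ ΣΣ-mono n step₁ ⟩
    ΣΣ n (λ x y → u x y * neighbours h x y + u x y * g x y)
      ≡⟨ ΣΣ-+ n _ _ ⟩
    ΣΣ n (λ x y → u x y * neighbours h x y) + ΣΣ n (λ x y → u x y * g x y)
      ≡⟨ cong (_+ ΣΣ n (λ x y → u x y * g x y)) (green ring H) ⟩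
    ΣΣ n (λ x y → h x y * neighbours u x y) + ΣΣ n (λ x y → u x y * g x y)
      ≤⟨ +-monoˡ-≤ _ (ΣΣ-mono n step₂) ⟩
    ΣΣ n (λ x y → 4 * (u x y * h x y) + 3 * h x y) + ΣΣ n (λ x y → u x y * g x y)
      ≡⟨ cong (_+ ΣΣ n (λ x y → u x y * g x y)) (trans (ΣΣ-+ n _ _) (cong₂ _+_ (ΣΣ-*ˡ n 4 _) (ΣΣ-*ˡ n 3 h))) ⟩
    X + 3 * ΣΣ n h + ΣΣ n (λ x y → u x y * g x y)
      ≡⟨ trans (+-assoc X _ _) (cong (X +_) (+-comm (3 * ΣΣ n h) _)) ⟩
    X + (ΣΣ n (λ x y → u x y * g x y) + 3 * ΣΣ n h) ∎)
    where
    open ≤-Reasoning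
    X = 4 * ΣΣ n (λ x y → u x y * h x y)
    lem₁ : ∀ a b c → 4 * (a * b) + a * c ≡ a * (4 * b + c)
    lem₁ = solve-∀
    lem₂ : ∀ a b → b * (4 * a + 3) ≡ 4 * (a * b) + 3 * b
    lem₂ = solve-∀
    step₁ : ∀ {i j} → i < n → j < n → 4 * (u (suc i) (suc j) * h (suc i) (suc j)) + u (suc i) (suc j) * p (suc i) (suc j)
          ≤ u (suc i) (suc j) * neighbours h (suc i) (suc j) + u (suc i) (suc j) * g (suc i) (suc j)
    step₁ {i} {j} i<n j<n = ≤-trans (≤-reflexive (lem₁ (u (suc i) (suc j)) _ _))
      (≤-trans (*-monoʳ-≤ (u (suc i) (suc j)) (sub i<n j<n)) (≤-reflexive (*-distribˡ-+ (u (suc i) (suc j)) _ _)))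
    step₂ : ∀ {i j} → i < n → j < n → h (suc i) (suc j) * neighbours u (suc i) (suc j)
          ≤ 4 * (u (suc i) (suc j) * h (suc i) (suc j)) + 3 * h (suc i) (suc j)
    step₂ {i} {j} i<n j<n = ≤-trans (*-monoʳ-≤ (h (suc i) (suc j)) (almostSuperharmonic i<n j<n))
      (≤-reflexive (lem₂ (u (suc i) (suc j)) _))

-- The truncated test function

-- An integral substitute for the function T/S.
record Reciprocal (K T : ℕ) (G : ℕ → ℕ) : Set where
  field
    exact    : ∀ {S} → 1 ≤ S → S ≤ K → G S * S ≡ T
    antitone : ∀ {S S′} → 1 ≤ S → S ≤ S′ → G S′ ≤ G S

-- Every S from 1 to K divides K!, so division is exact on that range; rounding down keeps it
-- antitone beyond.
reciprocal : ∀ K → Σ ℕ λ T → Σ (ℕ → ℕ) λ G → 1 ≤ T × Reciprocal K T G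
reciprocal K = K ! , G , 1≤n! K , record { exact = exact ; antitone = antitone }
  where
  G : ℕ → ℕ
  G zero    = 0
  G (suc s) = K ! / suc s
  exact : ∀ {S} → 1 ≤ S → S ≤ K → G S * S ≡ K !
  exact {suc s} _ S≤K = m/n*n≡m (∣-trans (m∣m*n (s !)) (m≤n⇒m!∣n! S≤K))
  antitone : ∀ {S S′} → 1 ≤ S → S ≤ S′ → G S′ ≤ G S
  antitone {suc s} {suc s′} _ S≤S′ = /-monoʳ-≤ (K !) S≤S′

on : ∀ {P : Set} → Dec P → ℕ → ℕ
on (yes _) k = k
on (no _)  k = 0

on-mono : ∀ {P Q : Set} (p : Dec P) (q : Dec Q) {k l} → (P → Q × k ≤ l) → on p k ≤ on q l
on-mono (no _)  q       f = z≤n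
on-mono (yes p) (yes _) f = proj₂ (f p)
on-mono (yes p) (no ¬q) f with () ← ¬q (proj₁ (f p))

on-*ˡ : ∀ {P : Set} (p : Dec P) k l → k * on p l ≡ on p (k * l)
on-*ˡ (yes _) k l = refl
on-*ˡ (no _)  k l = *-zeroʳ k

module Kernel {K T G} (R : Reciprocal K T G) (a b c′ : ℕ) where
  open Reciprocal R

  c : ℕ
  c = suc c′

  ρ : ℕ → ℕ → ℕ
  ρ x y = ∣ x - a ∣ * ∣ x - a ∣ + ∣ y - b ∣ * ∣ y - b ∣ + c

  -- The numerator, over S⁴, of all that counts against the leading term: 24c comes from the
  -- constant c in S, while 84 and 136 come from the discretisation.
  error : ℕ → ℕ → ℕ
  error x y = (24 * c + 84) * (x * y) + 136 * (∣ x - a ∣ * y + ∣ y - b ∣ * x)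

  ρ≥1 : ∀ x y → 1 ≤ ρ x y
  ρ≥1 x y = ≤-trans (s≤s z≤n) (m≤n+m c _)

  F : ℕ → ℕ → ℕ
  F x y = x * y * (G (ρ x y) * G (ρ x y))

  module _ (x′ y′ : ℕ) (S≤K : ρ (suc x′) (suc y′) ≤ K)
    (E≤K : ρ (suc (suc x′)) (suc y′) ≤ K) (W≤K : ρ x′ (suc y′) ≤ K)
    (N≤K : ρ (suc x′) (suc (suc y′)) ≤ K) (S′≤K : ρ (suc x′) y′ ≤ K) where

    private
      x = suc x′
      y = suc y′
      S = ρ x y
      g = G S

      balance : ∀ x₁ y₁ → ρ x₁ y₁ ≤ K → (ℤ.+ g) ℤ.* (ℤ.+ S) ≡ (ℤ.+ G (ρ x₁ y₁)) ℤ.* (ℤ.+ ρ x₁ y₁)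
      balance x₁ y₁ ≤K = trans (sym (ℤP.pos-* g S)) (trans (cong ℤ.+_ (trans (exact (ρ≥1 x y) S≤K) (sym (exact (ρ≥1 x₁ y₁) ≤K)))) (ℤP.pos-* (G (ρ x₁ y₁)) (ρ x₁ y₁)))

      d = ℤ.+ x ℤ.- ℤ.+ a
      e = ℤ.+ y ℤ.- ℤ.+ b

      ρ-cast : ∀ x y → ℤ.+ ρ x y ≡ (ℤ.+ x ℤ.- ℤ.+ a) ℤ.* (ℤ.+ x ℤ.- ℤ.+ a) ℤ.+ (ℤ.+ y ℤ.- ℤ.+ b) ℤ.* (ℤ.+ y ℤ.- ℤ.+ b) ℤ.+ (ℤ.+ 1 ℤ.+ ℤ.+ c′)
      ρ-cast x y = cong₂ (λ s t → s ℤ.+ t ℤ.+ (ℤ.+ 1 ℤ.+ ℤ.+ c′)) (distance² x a) (distance² y b)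

      recover : ∀ i j → j ≡ i ℤ.- (i ℤ.- j)
      recover = ℤR.solve-∀

      east : ∀ i a e c → (ℤ.+ 1 ℤ.+ i ℤ.- a) ℤ.* (ℤ.+ 1 ℤ.+ i ℤ.- a) ℤ.+ e ℤ.* e ℤ.+ c ≡ (i ℤ.- a) ℤ.* (i ℤ.- a) ℤ.+ e ℤ.* e ℤ.+ c ℤ.+ (ℤ.+ 1 ℤ.+ ℤ.+ 2 ℤ.* (i ℤ.- a))
      east = ℤR.solve-∀
      west : ∀ i a e c → (i ℤ.- a) ℤ.* (i ℤ.- a) ℤ.+ e ℤ.* e ℤ.+ c ≡ (ℤ.+ 1 ℤ.+ i ℤ.- a) ℤ.* (ℤ.+ 1 ℤ.+ i ℤ.- a) ℤ.+ e ℤ.* e ℤ.+ c ℤ.+ (ℤ.+ 1 ℤ.- ℤ.+ 2 ℤ.* (ℤ.+ 1 ℤ.+ i ℤ.- a))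
      west = ℤR.solve-∀
      north : ∀ i a e c → e ℤ.* e ℤ.+ (ℤ.+ 1 ℤ.+ i ℤ.- a) ℤ.* (ℤ.+ 1 ℤ.+ i ℤ.- a) ℤ.+ c ≡ e ℤ.* e ℤ.+ (i ℤ.- a) ℤ.* (i ℤ.- a) ℤ.+ c ℤ.+ (ℤ.+ 1 ℤ.+ ℤ.+ 2 ℤ.* (i ℤ.- a))
      north = ℤR.solve-∀
      south : ∀ i a e c → e ℤ.* e ℤ.+ (i ℤ.- a) ℤ.* (i ℤ.- a) ℤ.+ c ≡ e ℤ.* e ℤ.+ (ℤ.+ 1 ℤ.+ i ℤ.- a) ℤ.* (ℤ.+ 1 ℤ.+ i ℤ.- a) ℤ.+ c ℤ.+ (ℤ.+ 1 ℤ.- ℤ.+ 2 ℤ.* (ℤ.+ 1 ℤ.+ i ℤ.- a))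
      south = ℤR.solve-∀

      via : ∀ {i j : ℤ.ℤ} k → ℤ.+ ρ x y ≡ k → i ≡ k ℤ.+ j → i ≡ ℤ.+ ρ x y ℤ.+ j
      via k refl eq = eq

    laplacian-ℕ : g * g * (4 * (x * y) * (S * S * S) + 8 * (a * y + b * x) * (S * S))
                  ≤ neighbours F x y * (S * S * S) + g * g * (S * error x y)
    laplacian-ℕ = cast-≤
      (⟨ g ⟩ ⊗ ⟨ g ⟩ ⊗ (⟨ 4 ⟩ ⊗ (⟨ x ⟩ ⊗ ⟨ y ⟩) ⊗ (⟨ S ⟩ ⊗ ⟨ S ⟩ ⊗ ⟨ S ⟩) ⊕ ⟨ 8 ⟩ ⊗ (⟨ a ⟩ ⊗ ⟨ y ⟩ ⊕ ⟨ b ⟩ ⊗ ⟨ x ⟩) ⊗ (⟨ S ⟩ ⊗ ⟨ S ⟩)))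
      (((⟨ suc x ⟩ ⊗ ⟨ y ⟩ ⊗ sq (suc x) y ⊕ ⟨ x′ ⟩ ⊗ ⟨ y ⟩ ⊗ sq x′ y) ⊕ (⟨ x ⟩ ⊗ ⟨ suc y ⟩ ⊗ sq x (suc y) ⊕ ⟨ x ⟩ ⊗ ⟨ y′ ⟩ ⊗ sq x y′)) ⊗ (⟨ S ⟩ ⊗ ⟨ S ⟩ ⊗ ⟨ S ⟩)
        ⊕ ⟨ g ⟩ ⊗ ⟨ g ⟩ ⊗ (⟨ S ⟩ ⊗ ((⟨ 24 ⟩ ⊗ ⟨ c ⟩ ⊕ ⟨ 84 ⟩) ⊗ (⟨ x ⟩ ⊗ ⟨ y ⟩) ⊕ ⟨ 136 ⟩ ⊗ (⟨ ∣ x - a ∣ ⟩ ⊗ ⟨ y ⟩ ⊕ ⟨ ∣ y - b ∣ ⟩ ⊗ ⟨ x ⟩))))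
      (laplacian-ℤ {ℤ.+ a} {ℤ.+ b} {ℤ.+ c′} {ℤ.+ x′} {ℤ.+ y′} {d} {e} {ℤ.+ ∣ x - a ∣} {ℤ.+ ∣ y - b ∣} {ℤ.+ g} {ℤ.+ G (ρ (suc x) y)} {ℤ.+ G (ρ x′ y)} {ℤ.+ G (ρ x (suc y))} {ℤ.+ G (ρ x y′)}
        {ℤ.+ S} {ℤ.+ ρ (suc x) y} {ℤ.+ ρ x′ y} {ℤ.+ ρ x (suc y)} {ℤ.+ ρ x y′}
        (ℤ.+≤+ z≤n) (ℤ.+≤+ z≤n) (ℤ.+≤+ z≤n) (ℤ.+≤+ z≤n) (ℤ.+≤+ z≤n) (distance-sign x a) (distance-sign y b)
        (recover (ℤ.+ x) (ℤ.+ a)) (recover (ℤ.+ y) (ℤ.+ b)) (ρ-cast x y)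
        (via _ (ρ-cast x y) (trans (ρ-cast (suc x) y) (east (ℤ.+ x) (ℤ.+ a) e (ℤ.+ c))))
        (via _ (ρ-cast x y) (trans (ρ-cast x′ y) (west (ℤ.+ x′) (ℤ.+ a) e (ℤ.+ c))))
        (via _ (ρ-cast x y) (trans (ρ-cast x (suc y)) (north (ℤ.+ y) (ℤ.+ b) d (ℤ.+ c))))
        (via _ (ρ-cast x y) (trans (ρ-cast x y′) (south (ℤ.+ y′) (ℤ.+ b) d (ℤ.+ c))))
        (balance (suc x) y E≤K) (balance x′ y W≤K) (balance x (suc y) N≤K) (balance x y′ S′≤K))
      where
      sq : ℕ → ℕ → Poly
      sq x y = ⟨ G (ρ x y) ⟩ ⊗ ⟨ G (ρ x y) ⟩

    private
      T≡ : T ≡ g * S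
      T≡ = sym (exact (ρ≥1 x y) S≤K)

    -- After multiplication by g² and the substitution of T for gS, negative powers of S have become
    -- powers of g, and one factor S common to all terms cancels.
    laplacian-scaled : 4 * (T * T * F x y) + 8 * (T * (g * g * g) * (a * y + b * x))
                       ≤ T * T * neighbours F x y + g * g * (g * g) * error x y
    laplacian-scaled = *-cancelʳ-≤ _ _ S {{>-nonZero (ρ≥1 x y)}} (begin
      (4 * (T * T * F x y) + 8 * (T * (g * g * g) * (a * y + b * x))) * S
        ≡⟨ cong (λ t → (4 * (t * t * F x y) + 8 * (t * (g * g * g) * (a * y + b * x))) * S) T≡ ⟩
      (4 * (g * S * (g * S) * F x y) + 8 * (g * S * (g * g * g) * (a * y + b * x))) * S
        ≡⟨ left x y g S (a * y + b * x) ⟩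
      g * g * (g * g * (4 * (x * y) * (S * S * S) + 8 * (a * y + b * x) * (S * S)))
        ≤⟨ *-monoʳ-≤ (g * g) laplacian-ℕ ⟩
      g * g * (neighbours F x y * (S * S * S) + g * g * (S * error x y))
        ≡⟨ right g S (neighbours F x y) (error x y) ⟩
      (g * S * (g * S) * neighbours F x y + g * g * (g * g) * error x y) * S
        ≡⟨ cong (λ t → (t * t * neighbours F x y + g * g * (g * g) * error x y) * S) T≡ ⟨
      (T * T * neighbours F x y + g * g * (g * g) * error x y) * S ∎)
      where
      open ≤-Reasoning
      left : ∀ x y g S M → (4 * (g * S * (g * S) * (x * y * (g * g))) + 8 * (g * S * (g * g * g) * M)) * S
                         ≡ g * g * (g * g * (4 * (x * y) * (S * S * S) + 8 * M * (S * S)))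
      left = solve-∀
      right : ∀ g S N E → g * g * (N * (S * S * S) + g * g * (S * E)) ≡ (g * S * (g * S) * N + g * g * (g * g) * E) * S
      right = solve-∀

  module Truncated (r : ℕ) where

    q : ℕ
    q = G r * G r

    truncated : ℕ → ℕ → ℕ
    truncated x y = x * y * (G (ρ x y) * G (ρ x y) ∸ q)

    F≤truncated : ∀ x y → F x y ≤ truncated x y + x * y * q
    F≤truncated x y = ≤-trans (*-monoʳ-≤ (x * y) (m≤n+m∸n _ q))
      (≤-reflexive (trans (*-distribˡ-+ (x * y) q _) (+-comm (x * y * q) _)))

    truncated≤F : ∀ x y → truncated x y ≤ F x y
    truncated≤F x y = *-monoʳ-≤ (x * y) (m∸n≤m _ q)

    -- At the point where the Laplacian is taken the truncated value enters with a minus sign, hence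
    -- an equality here, against the inequality `F≤truncated` that serves at the neighbours.
    inside : ∀ {x y} → ρ x y ≤ r → F x y ≡ truncated x y + x * y * q
    inside {x} {y} ρ≤r = trans (cong (x * y *_) (sym (m∸n+n≡m (*-mono-≤ G≤ G≤)))) (*-distribˡ-+ (x * y) _ q)
      where
      G≤ : G r ≤ G (ρ x y)
      G≤ = antitone (ρ≥1 x y) ρ≤r

    outside : 1 ≤ r → ∀ {x y} → r ≤ ρ x y → truncated x y ≡ 0
    outside 1≤r {x} {y} r≤ρ = trans (cong (x * y *_) (m≤n⇒m∸n≡0 (*-mono-≤ G≤ G≤))) (*-zeroʳ (x * y))
      where
      G≤ : G (ρ x y) ≤ G r
      G≤ = antitone 1≤r r≤ρ

    module _ (x′ y′ : ℕ) where

      private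
        x = suc x′
        y = suc y′

      -- The function xy is discrete harmonic, its four neighbours adding up to 4xy, so subtracting
      -- q · xy leaves the Laplacian unchanged; cutting off at zero can only raise the neighbours.
      neighbours-F≤ : neighbours F x y ≤ neighbours truncated x y + 4 * (x * y * q)
      neighbours-F≤ = ≤-trans
        (+-mono-≤ (+-mono-≤ (F≤truncated (suc x) y) (F≤truncated x′ y)) (+-mono-≤ (F≤truncated x (suc y)) (F≤truncated x y′)))
        (≤-reflexive (regroup (truncated (suc x) y) (truncated x′ y) (truncated x (suc y)) (truncated x y′) x′ y′ q))
        where
        regroup : ∀ E W N S x′ y′ q → let x = suc x′ ; y = suc y′ in
          E + suc x * y * q + (W + x′ * y * q) + (N + x * suc y * q + (S + x * y′ * q)) ≡ E + W + (N + S) + 4 * (x * y * q)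
        regroup = solve-∀


  module TestFunction
    {n} {u : ℕ → ℕ → ℕ} (O : Odometer n u)
    (ρ≤K : ∀ {x y} → x ≤ suc n → y ≤ suc n → ρ x y ≤ K)
    (r : ℕ) (1≤r : 1 ≤ r)
    (farˣ : r ≤ ∣ suc n - a ∣ * ∣ suc n - a ∣ + c) (farʸ : r ≤ ∣ suc n - b ∣ * ∣ suc n - b ∣ + c)
    (Near : ℕ → ℕ → Set) (near? : ∀ x y → Dec (Near x y))
    (error-small : ∀ {i j} → i < n → j < n → ¬ Near (suc i) (suc j) → ρ (suc i) (suc j) ≤ r →
      error (suc i) (suc j) ≤ 4 * (ρ (suc i) (suc j) * (a * suc j + b * suc i)))
    where
    open Truncated r

    gain : ℕ → ℕ → ℕ
    gain x y = T * (G (ρ x y) * G (ρ x y) * G (ρ x y)) * (a * y + b * x)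

    loss : ℕ → ℕ → ℕ
    loss x y = G (ρ x y) * G (ρ x y) * (G (ρ x y) * G (ρ x y)) * error x y

    far? : ∀ x y → Dec (ρ x y ≤ r × ¬ Near x y)
    far? x y = (ρ x y ≤? r) ×-dec (¬? (near? x y))

    h : ℕ → ℕ → ℕ
    h x y = T * T * truncated x y

    h-ring : VanishesOnRing n h
    h-ring = record
      { left   = λ y → *-zeroʳ (T * T)
      ; right  = λ y → vanish (suc n) y (≤-trans farˣ (+-monoˡ-≤ c (m≤m+n _ _)))
      ; bottom = λ x → trans (cong (λ k → T * T * (k * (G (ρ x 0) * G (ρ x 0) ∸ q))) (*-zeroʳ x)) (*-zeroʳ (T * T))
      ; top    = λ x → vanish x (suc n) (≤-trans farʸ (+-monoˡ-≤ c (m≤n+m _ (∣ x - a ∣ * ∣ x - a ∣))))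
      }
      where
      vanish : ∀ x y → r ≤ ρ x y → h x y ≡ 0
      vanish x y r≤ρ = trans (cong (T * T *_) (outside 1≤r {x} {y} r≤ρ)) (*-zeroʳ (T * T))

    module _ {i j} (i<n : i < n) (j<n : j < n) where

      private
        x = suc i
        y = suc j

      h-subharmonic : ρ x y ≤ r → 4 * h x y + 8 * gain x y ≤ neighbours h x y + loss x y
      h-subharmonic ρ≤r = +-cancelˡ-≤ X _ _ (begin
        X + (4 * h x y + 8 * gain x y)
          ≡⟨ collect (T * T) (truncated x y) (x * y * q) (8 * gain x y) ⟩
        4 * (T * T * (truncated x y + x * y * q)) + 8 * gain x y
          ≡⟨ cong (λ k → 4 * (T * T * k) + 8 * gain x y) (inside {x} {y} ρ≤r) ⟨
        4 * (T * T * F x y) + 8 * gain x y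
          ≤⟨ laplacian-scaled i j (ρ≤K x≤ y≤) (ρ≤K (s≤s i<n) y≤) (ρ≤K (<⇒≤ x≤) y≤) (ρ≤K x≤ (s≤s j<n)) (ρ≤K x≤ (<⇒≤ y≤)) ⟩
        T * T * neighbours F x y + loss x y
          ≤⟨ +-monoˡ-≤ _ (*-monoʳ-≤ (T * T) (neighbours-F≤ i j)) ⟩
        T * T * (neighbours truncated x y + 4 * (x * y * q)) + loss x y
          ≡⟨ expand (T * T) (truncated (suc x) y) (truncated i y) (truncated x (suc y)) (truncated x j) (x * y * q) (loss x y) ⟩
        X + (neighbours h x y + loss x y) ∎)
        where
        open ≤-Reasoning
        X = T * T * (4 * (x * y * q))
        x≤ : x ≤ suc n
        x≤ = m≤n⇒m≤1+n i<n
        y≤ : y ≤ suc n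
        y≤ = m≤n⇒m≤1+n j<n
        collect : ∀ t h k g → t * (4 * k) + (4 * (t * h) + g) ≡ 4 * (t * (h + k)) + g
        collect = solve-∀
        expand : ∀ t E W N S k l → t * (E + W + (N + S) + 4 * k) + l ≡ t * (4 * k) + (t * E + t * W + (t * N + t * S) + l)
        expand = solve-∀

      loss≤gain : ¬ Near x y → ρ x y ≤ r → loss x y ≤ 4 * gain x y
      loss≤gain ¬near ρ≤r = begin
        loss x y                                          ≤⟨ *-monoʳ-≤ (g * g * (g * g)) (error-small i<n j<n ¬near ρ≤r) ⟩
        g * g * (g * g) * (4 * (ρ x y * M))               ≡⟨ regroup g (ρ x y) M ⟩
        4 * (g * ρ x y * (g * g * g) * M)                 ≡⟨ cong (λ t → 4 * (t * (g * g * g) * M)) (exact (ρ≥1 x y) (ρ≤K (m≤n⇒m≤1+n i<n) (m≤n⇒m≤1+n j<n))) ⟩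
        4 * gain x y                                      ∎
        where
        open ≤-Reasoning
        g = G (ρ x y)
        M = a * y + b * x
        regroup : ∀ g S M → g * g * (g * g) * (4 * (S * M)) ≡ 4 * (g * S * (g * g * g) * M)
        regroup = solve-∀

      -- Off `Near`, half of the gain pays for the loss and the other half survives. On `Near` the
      -- gain is given up and the loss kept. Outside the disc h vanishes, and so does the surviving
      -- gain.
      pointwise : 4 * h x y + on (far? x y) (4 * gain x y) ≤ neighbours h x y + on (near? x y) (loss x y)
      pointwise with ρ x y ≤? r | near? x y
      ... | yes ρ≤r | yes _    = ≤-trans (≤-reflexive (+-identityʳ _)) (≤-trans (m≤m+n _ _) (h-subharmonic ρ≤r))
      ... | yes ρ≤r | no ¬near = +-cancelʳ-≤ (4 * gain x y) _ _ (begin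
        4 * h x y + 4 * gain x y + 4 * gain x y    ≡⟨ double (h x y) (gain x y) ⟩
        4 * h x y + 8 * gain x y                   ≤⟨ h-subharmonic ρ≤r ⟩
        neighbours h x y + loss x y                ≤⟨ +-mono-≤ (≤-reflexive (sym (+-identityʳ _))) (loss≤gain ¬near ρ≤r) ⟩
        neighbours h x y + 0 + 4 * gain x y        ∎)
        where
        open ≤-Reasoning
        double : ∀ h g → 4 * h + 4 * g + 4 * g ≡ 4 * h + 8 * g
        double = solve-∀
      ... | no ρ≰r  | _ = ≤-trans (≤-reflexive (trans (+-identityʳ _) (trans (cong (λ k → 4 * (T * T * k)) (outside 1≤r {x} {y} (≰⇒≥ ρ≰r))) (cong (4 *_) (*-zeroʳ (T * T)))))) z≤n

    test-bound : ΣΣ n (λ x y → u x y * on (far? x y) (4 * gain x y))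
                 ≤ ΣΣ n (λ x y → u x y * on (near? x y) (loss x y)) + 3 * (T * T * ΣΣ n F)
    test-bound = ≤-trans
      (duality O {h} {λ x y → on (far? x y) (4 * gain x y)} {λ x y → on (near? x y) (loss x y)} h-ring pointwise)
      (+-monoʳ-≤ (ΣΣ n (λ x y → u x y * on (near? x y) (loss x y))) (*-monoʳ-≤ 3 Σh≤))
      where
      Σh≤ : ΣΣ n h ≤ T * T * ΣΣ n F
      Σh≤ = ≤-trans (ΣΣ-mono n λ {i} {j} _ _ → *-monoʳ-≤ (T * T) (truncated≤F (suc i) (suc j))) (≤-reflexive (ΣΣ-*ˡ n (T * T) F))

-- Transport of mass out of the ball

≤-by : ∀ {a b} k → a + k ≡ b → a ≤ b
≤-by {a} k refl = m≤m+n a k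

-- A ball for the maximum norm, of radius 4t about (16t, 16t); it is used in grids with 64t ≤ n + 1
-- ≤ 68t.
Ball : ℕ → ℕ → ℕ → Set
Ball t x y = ∣ x - t * 16 ∣ ≤ t * 4 × ∣ y - t * 16 ∣ ≤ t * 4

ball? : ∀ t x y → Dec (Ball t x y)
ball? t x y = (∣ x - t * 16 ∣ ≤? t * 4) ×-dec (∣ y - t * 16 ∣ ≤? t * 4)

ballMass : ℕ → ℕ → (ℕ → ℕ → ℕ) → ℕ
ballMass n t u = ΣΣ n (λ x y → u x y * on (ball? t x y) 1)

distance≤ : ∀ {x k l} → x ≤ l → k ≤ l → ∣ x - k ∣ ≤ l
distance≤ {x} {k} x≤l k≤l = ≤-trans (∣m-n∣≤m⊔n x k) (⊔-lub x≤l k≤l)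

16≤68 : ∀ t → t * 16 ≤ t * 68
16≤68 t = ≤-by (t * 52) (lem t)
  where
  lem : ∀ t → t * 16 + t * 52 ≡ t * 68
  lem = solve-∀

-- Transport of mass away from the ball, by a test function smoothed at the scale of the ball.
module Spread {n t} {u : ℕ → ℕ → ℕ} (O : Odometer n u)
  (16≤t : 16 ≤ t) (64t≤m : t * 64 ≤ suc n) (m≤68t : suc n ≤ t * 68) where

  private
    k = t * 16

    1≤t : 1 ≤ t
    1≤t = ≤-trans (s≤s z≤n) 16≤t

    instance
      t≢0 : NonZero t
      t≢0 = >-nonZero 1≤t

    K = t * 68 * (t * 68) + t * 68 * (t * 68) + suc (t * t)

  -- The radius 48t = 64t - 16t is the largest one that 64t ≤ n + 1 allows if the disc is to end
  -- before the two far sides.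
  Region : ℕ → ℕ → Set
  Region x y = ∣ x - k ∣ * ∣ x - k ∣ + ∣ y - k ∣ * ∣ y - k ∣ ≤ t * 48 * (t * 48) × ¬ Ball t x y

  private
   module Bound {T G} (1≤T : 1 ≤ T) (R : Reciprocal K T G) where
    open Kernel R k k (t * t) hiding (module TestFunction)
    open Reciprocal R

    r = t * 48 * (t * 48) + suc (t * t)

    ρ≤K : ∀ {x y} → x ≤ suc n → y ≤ suc n → ρ x y ≤ K
    ρ≤K x≤ y≤ = +-monoˡ-≤ (suc (t * t)) (+-mono-≤ (*-mono-≤ dx dx) (*-mono-≤ dy dy))
      where
      dx = distance≤ (≤-trans x≤ m≤68t) (16≤68 t)
      dy = distance≤ (≤-trans y≤ m≤68t) (16≤68 t)

    far : r ≤ ∣ suc n - k ∣ * ∣ suc n - k ∣ + suc (t * t)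
    far = +-monoˡ-≤ (suc (t * t)) (*-mono-≤ 48t≤ 48t≤)
      where
      lem : ∀ t → t * 48 + t * 16 ≡ t * 64
      lem = solve-∀
      48t≤ : t * 48 ≤ ∣ suc n - k ∣
      48t≤ = +-cancelʳ-≤ k _ _ (≤-trans (≤-reflexive (lem t)) (≤-trans 64t≤m (m≤∣m-n∣+n (suc n) k)))

    t²≥ : 2048 ≤ 8 * (t * t)
    t²≥ = *-monoʳ-≤ 8 (*-mono-≤ 16≤t 16≤t)

    interior : ∀ {i} → i < n → suc i ≤ t * 68
    interior i<n = ≤-trans (m≤n⇒m≤1+n i<n) m≤68t

    -- With c of order t² the error is of the same order as the leading term, so constants matter.
    -- Outside the ball ρ ≥ 17t², and t ≥ 16 gives 24t² + 380 ≤ 32t². The rest is the equality 32 ·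
    -- 68 = 17 · 128, which ties the ball radius 4t to the side 68t.
    error-small : ∀ {i j} → i < n → j < n → ¬ Ball t (suc i) (suc j) → ρ (suc i) (suc j) ≤ r →
      error (suc i) (suc j) ≤ 4 * (ρ (suc i) (suc j) * (k * suc j + k * suc i))
    error-small {i} {j} i<n j<n ¬ball _ = *-cancelˡ-≤ 2 (begin
      2 * error x y
        ≡⟨ double (t * t) x y ∣ x - k ∣ ∣ y - k ∣ ⟩
      (24 * suc (t * t) + 84) * (x * y + x * y) + 272 * (∣ x - k ∣ * y + ∣ y - k ∣ * x)
        ≤⟨ +-mono-≤ (*-monoʳ-≤ (24 * suc (t * t) + 84) (+-mono-≤ (*-monoˡ-≤ y x≤) (≤-trans (≤-reflexive (*-comm x y)) (*-monoˡ-≤ x y≤))))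
                    (*-monoʳ-≤ 272 (+-mono-≤ (*-monoˡ-≤ y dx≤) (*-monoˡ-≤ x dy≤))) ⟩
      (24 * suc (t * t) + 84) * (t * 68 * y + t * 68 * x) + 272 * (t * 68 * y + t * 68 * x)
        ≡⟨ collect t x y ⟩
      (24 * (t * t) + 380) * (t * 68 * (y + x))
        ≤⟨ *-monoˡ-≤ (t * 68 * (y + x)) (+-monoʳ-≤ (24 * (t * t)) (≤-trans (toWitness {a? = 380 ≤? 2048} _) t²≥)) ⟩
      (24 * (t * t) + 8 * (t * t)) * (t * 68 * (y + x))
        ≡⟨ match t x y ⟩
      17 * (t * t) * (2 * (4 * (k * y + k * x)))
        ≤⟨ *-monoˡ-≤ (2 * (4 * (k * y + k * x))) 17t²≤ρ ⟩
      ρ x y * (2 * (4 * (k * y + k * x)))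
        ≡⟨ pull (ρ x y) (k * y + k * x) ⟩
      2 * (4 * (ρ x y * (k * y + k * x))) ∎)
      where
      open ≤-Reasoning
      x = suc i
      y = suc j
      x≤ = interior i<n
      y≤ = interior j<n
      dx≤ : ∣ x - k ∣ ≤ t * 68
      dx≤ = distance≤ x≤ (16≤68 t)
      dy≤ : ∣ y - k ∣ ≤ t * 68
      dy≤ = distance≤ y≤ (16≤68 t)
      double : ∀ s x y d e → 2 * ((24 * (1 + s) + 84) * (x * y) + 136 * (d * y + e * x)) ≡ (24 * (1 + s) + 84) * (x * y + x * y) + 272 * (d * y + e * x)
      double = solve-∀
      collect : ∀ t x y → (24 * (1 + t * t) + 84) * (t * 68 * y + t * 68 * x) + 272 * (t * 68 * y + t * 68 * x) ≡ (24 * (t * t) + 380) * (t * 68 * (y + x))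
      collect = solve-∀
      match : ∀ t x y → (24 * (t * t) + 8 * (t * t)) * (t * 68 * (y + x)) ≡ 17 * (t * t) * (2 * (4 * (t * 16 * y + t * 16 * x)))
      match = solve-∀
      pull : ∀ S M → S * (2 * (4 * M)) ≡ 2 * (4 * (S * M))
      pull = solve-∀
      square : ∀ {p} → ¬ (p ≤ t * 4) → 16 * (t * t) ≤ p * p
      square {p} p≰ = ≤-trans (≤-reflexive (lem t)) (*-mono-≤ (≰⇒≥ p≰) (≰⇒≥ p≰))
        where
        lem : ∀ t → 16 * (t * t) ≡ t * 4 * (t * 4)
        lem = solve-∀
      16t²≤ : 16 * (t * t) ≤ ∣ x - k ∣ * ∣ x - k ∣ + ∣ y - k ∣ * ∣ y - k ∣
      16t²≤ with ∣ x - k ∣ ≤? t * 4 | ∣ y - k ∣ ≤? t * 4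
      ... | yes p | yes q with () ← ¬ball (p , q)
      ... | no ¬p | _     = ≤-trans (square ¬p) (m≤m+n _ _)
      ... | yes _ | no ¬q = ≤-trans (square ¬q) (m≤n+m _ _)
      17t²≤ρ : 17 * (t * t) ≤ ρ x y
      17t²≤ρ = ≤-trans (≤-by 1 (lem (t * t))) (+-monoˡ-≤ (suc (t * t)) 16t²≤)
        where
        lem : ∀ s → 17 * s + 1 ≡ 16 * s + (1 + s)
        lem = solve-∀

    open Kernel.TestFunction R k k (t * t) O ρ≤K r (≤-trans (s≤s z≤n) (m≤n+m (suc (t * t)) _)) far far (Ball t) (ball? t) error-small

    -- An upper bound for r, as 48² + 1 + 1 = 2306 and 1 ≤ t².
    B = t * t * 2306

    gain-lower : ∀ {x y} → ρ x y ≤ r → x ≤ suc n → y ≤ suc n → T * T * T * T * (t * (x + y)) ≤ B * B * B * (4 * gain x y)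
    gain-lower {x} {y} ρ≤r x≤ y≤ = begin
      T * T * T * T * (t * (x + y))                  ≤⟨ *-monoʳ-≤ (T * T * T * T) (m≤n*m (t * (x + y)) 64) ⟩
      T * T * T * T * (64 * (t * (x + y)))           ≤⟨ *-monoˡ-≤ (64 * (t * (x + y))) (*-monoˡ-≤ T (*-mono-≤ (*-mono-≤ T≤ T≤) T≤)) ⟩
      g * B * (g * B) * (g * B) * T * (64 * (t * (x + y))) ≡⟨ regroup g B T t x y ⟩
      B * B * B * (4 * gain x y)                     ∎
      where
      open ≤-Reasoning
      g = G (ρ x y)
      r≤B : r ≤ B
      r≤B = ≤-trans (+-monoʳ-≤ (t * 48 * (t * 48)) (+-monoˡ-≤ (t * t) (*-mono-≤ 1≤t 1≤t))) (≤-reflexive (lem t))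
        where
        lem : ∀ t → t * 48 * (t * 48) + (t * t + t * t) ≡ t * t * 2306
        lem = solve-∀
      T≤ : T ≤ g * B
      T≤ = ≤-trans (≤-reflexive (sym (exact (ρ≥1 x y) (ρ≤K x≤ y≤)))) (*-monoʳ-≤ g (≤-trans ρ≤r r≤B))
      regroup : ∀ g B T t x y → g * B * (g * B) * (g * B) * T * (64 * (t * (x + y))) ≡ B * B * B * (4 * (T * (g * g * g) * (t * 16 * y + t * 16 * x)))
      regroup = solve-∀

    -- This is what the smoothing is for: 1/S ≤ 1/t² even at the centre, so that u on the ball
    -- enters through its total mass alone.
    Gt²≤T : ∀ {x y} → x ≤ suc n → y ≤ suc n → G (ρ x y) * (t * t) ≤ T
    Gt²≤T {x} {y} x≤ y≤ = ≤-trans (*-monoʳ-≤ (G (ρ x y)) (≤-trans (n≤1+n _) (m≤n+m (suc (t * t)) _))) (≤-reflexive (exact (ρ≥1 x y) (ρ≤K x≤ y≤)))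

    loss-upper : ∀ {x y} → x ≤ suc n → y ≤ suc n → t * t * (t * t) * loss x y ≤ T * T * (T * T) * (404 * (68 * 68))
    loss-upper {x} {y} x≤ y≤ = *-cancelˡ-≤ (t * t * (t * t)) {{m*n≢0 (t * t) (t * t) {{m*n≢0 t t}} {{m*n≢0 t t}}}} (begin
      t * t * (t * t) * (t * t * (t * t) * loss x y)
        ≡⟨ regroup g (t * t) (error x y) ⟩
      g * (t * t) * (g * (t * t)) * (g * (t * t) * (g * (t * t))) * error x y
        ≤⟨ *-mono-≤ (*-mono-≤ (*-mono-≤ g≤ g≤) (*-mono-≤ g≤ g≤)) error≤ ⟩
      T * T * (T * T) * (t * t * (t * t) * (404 * (68 * 68)))
        ≡⟨ regroup′ (T * T) (t * t * (t * t)) (404 * (68 * 68)) ⟩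
      t * t * (t * t) * (T * T * (T * T) * (404 * (68 * 68))) ∎)
      where
      open ≤-Reasoning
      g = G (ρ x y)
      g≤ = Gt²≤T x≤ y≤
      x′≤ = ≤-trans x≤ m≤68t
      y′≤ = ≤-trans y≤ m≤68t
      regroup : ∀ g s E → s * s * (s * s * (g * g * (g * g) * E)) ≡ g * s * (g * s) * (g * s * (g * s)) * E
      regroup = solve-∀
      regroup′ : ∀ T s k → T * T * (s * k) ≡ s * (T * T * k)
      regroup′ = solve-∀
      error≤ : error x y ≤ t * t * (t * t) * (404 * (68 * 68))
      error≤ = begin
        (24 * suc (t * t) + 84) * (x * y) + 136 * (∣ x - k ∣ * y + ∣ y - k ∣ * x)
          ≤⟨ +-mono-≤ (*-monoʳ-≤ (24 * suc (t * t) + 84) (*-mono-≤ x′≤ y′≤))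
               (*-monoʳ-≤ 136 (+-mono-≤ (*-mono-≤ (distance≤ x′≤ (16≤68 t)) y′≤) (*-mono-≤ (distance≤ y′≤ (16≤68 t)) x′≤))) ⟩
        (24 * suc (t * t) + 84) * (t * 68 * (t * 68)) + 136 * (t * 68 * (t * 68) + t * 68 * (t * 68))
          ≡⟨ collect t 68 ⟩
        t * t * (24 * (t * t) + 380 * 1) * (68 * 68)
          ≤⟨ *-monoˡ-≤ (68 * 68) (*-monoʳ-≤ (t * t) (+-monoʳ-≤ (24 * (t * t)) (*-mono-≤ {380} {380} ≤-refl (*-mono-≤ 1≤t 1≤t)))) ⟩
        t * t * (24 * (t * t) + 380 * (t * t)) * (68 * 68)
          ≡⟨ collect′ (t * t) (68 * 68) ⟩
        t * t * (t * t) * (404 * (68 * 68)) ∎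
        where
        collect : ∀ t k → (24 * (1 + t * t) + 84) * (t * k * (t * k)) + 136 * (t * k * (t * k) + t * k * (t * k)) ≡ t * t * (24 * (t * t) + 380 * 1) * (k * k)
        collect = solve-∀
        collect′ : ∀ s k → s * (24 * s + 380 * s) * k ≡ s * s * (404 * k)
        collect′ = solve-∀

    ΣF-upper : ΣΣ n F ≤ T * T * (68 * 68 * (68 * 68))
    ΣF-upper = *-cancelˡ-≤ (t * t * (t * t)) {{m*n≢0 (t * t) (t * t) {{m*n≢0 t t}} {{m*n≢0 t t}}}} (begin
      t * t * (t * t) * ΣΣ n F
        ≡⟨ ΣΣ-*ˡ n (t * t * (t * t)) F ⟨
      ΣΣ n (λ x y → t * t * (t * t) * F x y)
        ≤⟨ ΣΣ≤ n (t * 68 * (t * 68) * (T * T)) F≤ ⟩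
      n * (n * (t * 68 * (t * 68) * (T * T)))
        ≤⟨ *-mono-≤ n≤ (*-monoˡ-≤ (t * 68 * (t * 68) * (T * T)) n≤) ⟩
      t * 68 * (t * 68 * (t * 68 * (t * 68) * (T * T)))
        ≡⟨ collect t 68 (T * T) ⟩
      t * t * (t * t) * (T * T * (68 * 68 * (68 * 68))) ∎)
      where
      open ≤-Reasoning
      n≤ : n ≤ t * 68
      n≤ = ≤-trans (n≤1+n n) m≤68t
      collect : ∀ t k T → t * k * (t * k * (t * k * (t * k) * T)) ≡ t * t * (t * t) * (T * (k * k * (k * k)))
      collect = solve-∀
      F≤ : ∀ {i j} → i < n → j < n → t * t * (t * t) * F (suc i) (suc j) ≤ t * 68 * (t * 68) * (T * T)
      F≤ {i} {j} i<n j<n = begin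
        t * t * (t * t) * F x y           ≡⟨ regroup (t * t) x y (G (ρ x y)) ⟩
        x * y * (G (ρ x y) * (t * t) * (G (ρ x y) * (t * t))) ≤⟨ *-mono-≤ (*-mono-≤ (interior i<n) (interior j<n)) (*-mono-≤ g≤ g≤) ⟩
        t * 68 * (t * 68) * (T * T)       ∎
        where
        x = suc i
        y = suc j
        g≤ = Gt²≤T {x} {y} (m≤n⇒m≤1+n i<n) (m≤n⇒m≤1+n j<n)
        regroup : ∀ s x y g → s * s * (x * y * (g * g)) ≡ x * y * (g * s * (g * s))
        regroup = solve-∀

    module _ (w : ℕ → ℕ → ℕ)
      (w-supported : ∀ {i j} → i < n → j < n → w (suc i) (suc j) ≡ 0 ⊎ (Region (suc i) (suc j) × w (suc i) (suc j) ≤ suc i + suc j)) where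

      gains = ΣΣ n (λ x y → u x y * on (far? x y) (4 * gain x y))
      losses = ΣΣ n (λ x y → u x y * on (ball? t x y) (loss x y))
      tested = ΣΣ n (λ x y → u x y * w x y)

      gains-lower : T * T * T * T * t * tested ≤ B * B * B * gains
      gains-lower = begin
        T * T * T * T * t * tested
          ≡⟨ ΣΣ-*ˡ n (T * T * T * T * t) _ ⟨
        ΣΣ n (λ x y → T * T * T * T * t * (u x y * w x y))
          ≤⟨ ΣΣ-mono n (λ {i} {j} i<n j<n → pointwise′ i<n j<n) ⟩
        ΣΣ n (λ x y → B * B * B * (u x y * on (far? x y) (4 * gain x y)))
          ≡⟨ ΣΣ-*ˡ n (B * B * B) _ ⟩
        B * B * B * gains ∎
        where
        open ≤-Reasoning
        pointwise′ : ∀ {i j} → i < n → j < n → let x = suc i ; y = suc j in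
          T * T * T * T * t * (u x y * w x y) ≤ B * B * B * (u x y * on (far? x y) (4 * gain x y))
        pointwise′ {i} {j} i<n j<n with w-supported i<n j<n
        ... | inj₁ w≡0 = ≤-trans (≤-reflexive (trans (cong (λ k → T * T * T * T * t * (u (suc i) (suc j) * k)) w≡0)
                           (trans (cong (T * T * T * T * t *_) (*-zeroʳ (u (suc i) (suc j)))) (*-zeroʳ (T * T * T * T * t))))) z≤n
        ... | inj₂ ((in-disc , ¬ball) , w≤) with far? (suc i) (suc j)
        ...   | no ¬far with () ← ¬far (+-monoˡ-≤ (suc (t * t)) in-disc , ¬ball)
        ...   | yes (ρ≤r , _) = begin
          T * T * T * T * t * (u x y * w x y)               ≤⟨ *-monoʳ-≤ (T * T * T * T * t) (*-monoʳ-≤ (u x y) w≤) ⟩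
          T * T * T * T * t * (u x y * (x + y))             ≡⟨ regroup (T * T * T * T) t (u x y) (x + y) ⟩
          u x y * (T * T * T * T * (t * (x + y)))           ≤⟨ *-monoʳ-≤ (u x y) (gain-lower ρ≤r (m≤n⇒m≤1+n i<n) (m≤n⇒m≤1+n j<n)) ⟩
          u x y * (B * B * B * (4 * gain x y))              ≡⟨ regroup′ (u x y) (B * B * B) (4 * gain x y) ⟩
          B * B * B * (u x y * (4 * gain x y))              ∎
          where
          x = suc i
          y = suc j
          regroup : ∀ T t u z → T * t * (u * z) ≡ u * (T * (t * z))
          regroup = solve-∀
          regroup′ : ∀ u B z → u * (B * z) ≡ B * (u * z)
          regroup′ = solve-∀

      losses-upper : t * t * (t * t) * losses ≤ T * T * (T * T) * (404 * (68 * 68)) * ballMass n t u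
      losses-upper = begin
        t * t * (t * t) * losses
          ≡⟨ ΣΣ-*ˡ n (t * t * (t * t)) _ ⟨
        ΣΣ n (λ x y → t * t * (t * t) * (u x y * on (ball? t x y) (loss x y)))
          ≤⟨ ΣΣ-mono n (λ {i} {j} i<n j<n → pointwise′ i<n j<n) ⟩
        ΣΣ n (λ x y → T * T * (T * T) * (404 * (68 * 68)) * (u x y * on (ball? t x y) 1))
          ≡⟨ ΣΣ-*ˡ n (T * T * (T * T) * (404 * (68 * 68))) _ ⟩
        T * T * (T * T) * (404 * (68 * 68)) * ballMass n t u ∎
        where
        open ≤-Reasoning
        pointwise′ : ∀ {i j} → i < n → j < n → let x = suc i ; y = suc j in
          t * t * (t * t) * (u x y * on (ball? t x y) (loss x y)) ≤ T * T * (T * T) * (404 * (68 * 68)) * (u x y * on (ball? t x y) 1)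
        pointwise′ {i} {j} i<n j<n = begin
          t * t * (t * t) * (u x y * on (ball? t x y) (loss x y))   ≡⟨ regroup (t * t * (t * t)) (u x y) _ ⟩
          u x y * (t * t * (t * t) * on (ball? t x y) (loss x y))   ≡⟨ cong (u x y *_) (on-*ˡ (ball? t x y) (t * t * (t * t)) (loss x y)) ⟩
          u x y * on (ball? t x y) (t * t * (t * t) * loss x y)     ≤⟨ *-monoʳ-≤ (u x y) (on-mono (ball? t x y) (ball? t x y) (λ b → b , ≤-trans (loss-upper (m≤n⇒m≤1+n i<n) (m≤n⇒m≤1+n j<n)) (≤-reflexive (sym (*-identityʳ Q))))) ⟩
          u x y * on (ball? t x y) (Q * 1)                          ≡⟨ cong (u x y *_) (on-*ˡ (ball? t x y) Q 1) ⟨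
          u x y * (Q * on (ball? t x y) 1)                          ≡⟨ regroup Q (u x y) _ ⟨
          Q * (u x y * on (ball? t x y) 1)                          ∎
          where
          x = suc i
          y = suc j
          Q = T * T * (T * T) * (404 * (68 * 68))
          regroup : ∀ s u z → s * (u * z) ≡ u * (s * z)
          regroup = solve-∀

      conclusion : tested ≤ t * (ballMass n t u * (404 * (68 * 68)) + t * t * (t * t) * (3 * (68 * 68 * (68 * 68)))) * (2306 * 2306 * 2306)
      conclusion = *-cancelˡ-≤ (T * T * T * T * t * (t * t * (t * t))) {{scale≢0}} (begin
        T * T * T * T * t * (t * t * (t * t)) * tested
          ≡⟨ commute (T * T * T * T * t) (t * t * (t * t)) tested ⟩
        t * t * (t * t) * (T * T * T * T * t * tested)
          ≤⟨ *-monoʳ-≤ (t * t * (t * t)) gains-lower ⟩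
        t * t * (t * t) * (B * B * B * gains)
          ≤⟨ *-monoʳ-≤ (t * t * (t * t)) (*-monoʳ-≤ (B * B * B) (≤-trans test-bound (+-monoʳ-≤ losses (*-monoʳ-≤ 3 (*-monoʳ-≤ (T * T) ΣF-upper))))) ⟩
        t * t * (t * t) * (B * B * B * (losses + 3 * (T * T * (T * T * (68 * 68 * (68 * 68))))))
          ≡⟨ split (t * t * (t * t)) (B * B * B) losses (T * T) (68 * 68 * (68 * 68)) ⟩
        B * B * B * (t * t * (t * t) * losses + T * T * (T * T) * (3 * (68 * 68 * (68 * 68))) * (t * t * (t * t)))
          ≤⟨ *-monoʳ-≤ (B * B * B) (+-monoˡ-≤ _ losses-upper) ⟩
        B * B * B * (T * T * (T * T) * (404 * (68 * 68)) * ballMass n t u + T * T * (T * T) * (3 * (68 * 68 * (68 * 68))) * (t * t * (t * t)))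
          ≡⟨ collect 2306 (404 * (68 * 68)) (3 * (68 * 68 * (68 * 68))) t T (ballMass n t u) (t * t * (t * t)) ⟩
        T * T * T * T * t * (t * t * (t * t)) * (t * (ballMass n t u * (404 * (68 * 68)) + t * t * (t * t) * (3 * (68 * 68 * (68 * 68)))) * (2306 * 2306 * 2306)) ∎)
        where
        open ≤-Reasoning
        scale≢0 : NonZero (T * T * T * T * t * (t * t * (t * t)))
        scale≢0 = >-nonZero (*-mono-≤ (*-mono-≤ (*-mono-≤ (*-mono-≤ (*-mono-≤ 1≤T 1≤T) 1≤T) 1≤T) 1≤t) (*-mono-≤ (*-mono-≤ 1≤t 1≤t) (*-mono-≤ 1≤t 1≤t)))
        commute : ∀ a b c → a * b * c ≡ b * (a * c)
        commute = solve-∀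
        split : ∀ s B L T k → s * (B * (L + 3 * (T * (T * k)))) ≡ B * (s * L + T * T * (3 * k) * s)
        split = solve-∀
        collect : ∀ k l m t T D s → t * t * k * (t * t * k) * (t * t * k) * (T * T * (T * T) * l * D + T * T * (T * T) * m * s)
          ≡ T * T * T * T * t * (t * t * (t * t)) * (t * (D * l + s * m) * (k * k * k))
        collect = solve-∀

  -- The gain at (x,y) is at least of order t(x + y)/t⁶, so a weight as large as x + y is
  -- affordable. It reaches order t well inside the grid but is only bounded near the corner, which
  -- is why sides cost one factor t more than balls.
  spread : ∀ (w : ℕ → ℕ → ℕ) →
    (∀ {i j} → i < n → j < n → w (suc i) (suc j) ≡ 0 ⊎ (Region (suc i) (suc j) × w (suc i) (suc j) ≤ suc i + suc j)) →
    ΣΣ n (λ x y → u x y * w x y) ≤ t * (ballMass n t u * (404 * (68 * 68)) + t * t * (t * t) * (3 * (68 * 68 * (68 * 68)))) * (2306 * 2306 * 2306)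
  spread w supp with T , G , 1≤T , R ← reciprocal K = Bound.conclusion 1≤T R w supp

-- Mass on the ball from an untoppled vertex

module _ {K T G} (R : Reciprocal K T G) where
  open Reciprocal R

  private
    -- 1/(k² + 1) ≤ 2/k - 2/(k + 1)
    telescope : ∀ j → let k = suc j in k * k + 1 ≤ K → suc k ≤ K → G (k * k + 1) + 2 * G (suc k) ≤ 2 * G k
    telescope j k²<K k<K = *-cancelʳ-≤ _ _ (k * suc k * (k * k + 1)) {{scale≢0}} (begin
      (G (k * k + 1) + 2 * G (suc k)) * (k * suc k * (k * k + 1))
        ≡⟨ left (G (k * k + 1)) (G (suc k)) k (k * k + 1) ⟩
      G (k * k + 1) * (k * k + 1) * (k * suc k) + 2 * (G (suc k) * suc k) * (k * (k * k + 1))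
        ≡⟨ cong₂ (λ s t → s * (k * suc k) + 2 * t * (k * (k * k + 1))) (exact (m≤n+m 1 (k * k)) k²<K) (exact (s≤s z≤n) k<K) ⟩
      T * (k * suc k) + 2 * T * (k * (k * k + 1))
        ≤⟨ ≤-by (T * (j * j + j + 2)) (middle T j) ⟩
      2 * T * (suc k * (k * k + 1))
        ≡⟨ cong (λ s → 2 * s * (suc k * (k * k + 1))) (exact (s≤s z≤n) (<⇒≤ k<K)) ⟨
      2 * (G k * k) * (suc k * (k * k + 1))
        ≡⟨ right (G k) k (k * k + 1) ⟩
      2 * G k * (k * suc k * (k * k + 1)) ∎)
      where
      open ≤-Reasoning
      k = suc j
      scale≢0 : NonZero (k * suc k * (k * k + 1))
      scale≢0 = >-nonZero (*-mono-≤ {1} {k * suc k} {1} (s≤s z≤n) (m≤n+m 1 (k * k)))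
      left : ∀ p q k s → (p + 2 * q) * (k * (1 + k) * s) ≡ p * s * (k * (1 + k)) + 2 * (q * (1 + k)) * (k * s)
      left = solve-∀
      middle : ∀ T j → let k = 1 + j in T * (k * (1 + k)) + 2 * T * (k * (k * k + 1)) + T * (j * j + j + 2) ≡ 2 * T * ((1 + k) * (k * k + 1))
      middle = solve-∀
      right : ∀ g k s → 2 * (g * k) * ((1 + k) * s) ≡ 2 * g * (k * (1 + k) * s)
      right = solve-∀

  -- The term k = 0 contributes T and the telescoping part at most 2T; `bound` carries the unspent
  -- remainder 2 G(N + 1) through the induction.
  Σ-reciprocal-squares : ∀ N → 1 ≤ K → (∀ {k} → k < N → k * k + 1 ≤ K × suc k ≤ K) → Σ< N (λ k → G (k * k + 1)) ≤ 3 * T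
  Σ-reciprocal-squares zero    1≤K _     = z≤n
  Σ-reciprocal-squares (suc N) 1≤K small = ≤-trans (m≤m+n _ _) (bound N small)
    where
    G1≡T : G 1 ≡ T
    G1≡T = trans (sym (*-identityʳ (G 1))) (exact ≤-refl 1≤K)
    open ≤-Reasoning
    bound : ∀ N → (∀ {k} → k < suc N → k * k + 1 ≤ K × suc k ≤ K) → Σ< (suc N) (λ k → G (k * k + 1)) + 2 * G (suc N) ≤ 3 * T
    bound zero    small = ≤-reflexive (trans (cong₂ _+_ (+-identityʳ (G 1)) refl) (cong (3 *_) G1≡T))
    bound (suc N) small = begin
      Σ< (suc (suc N)) f + 2 * G (suc (suc N))         ≡⟨ cong (_+ 2 * G (suc (suc N))) (Σ<-last (suc N) f) ⟩
      Σ< (suc N) f + f (suc N) + 2 * G (suc (suc N))   ≡⟨ +-assoc (Σ< (suc N) f) _ _ ⟩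
      Σ< (suc N) f + (f (suc N) + 2 * G (suc (suc N))) ≤⟨ +-monoʳ-≤ (Σ< (suc N) f) (telescope N (proj₁ (small ≤-refl)) (proj₂ (small ≤-refl))) ⟩
      Σ< (suc N) f + 2 * G (suc N)                     ≤⟨ bound N (λ k<N → small (m≤n⇒m≤1+n k<N)) ⟩
      3 * T ∎
      where f = λ k → G (k * k + 1)

-- Mass on the ball in terms of an untoppled vertex, by a test function concentrated there.
module Concentrated {n t} {u : ℕ → ℕ → ℕ} (O : Odometer n u)
  (1≤t : 1 ≤ t) (64t≤m : t * 64 ≤ suc n) (m≤68t : suc n ≤ t * 68)
  (a′ b′ : ℕ) (2a≤m : 2 * suc a′ ≤ suc n) (2b≤m : 2 * suc b′ ≤ suc n) where

  private
    a = suc a′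
    b = suc b′

  -- From p = 62 on, p² exceeds the linear expression 27 + 61p of `error-small`. The size depends
  -- neither on n nor on (a,b).
  Near : ℕ → ℕ → Set
  Near x y = ∣ x - a ∣ ≤ 62 × ∣ y - b ∣ ≤ 62

  near? : ∀ x y → Dec (Near x y)
  near? x y = (∣ x - a ∣ ≤? 62) ×-dec (∣ y - b ∣ ≤? 62)

  private
    instance
      t≢0 : NonZero t
      t≢0 = >-nonZero 1≤t

    K = t * 68 * (t * 68) + t * 68 * (t * 68) + 1

    half : ∀ {a} → 2 * a ≤ suc n → t * 32 ≤ ∣ suc n - a ∣ × a ≤ t * 34
    half {a} 2a≤m = *-cancelˡ-≤ 2 (+-cancelʳ-≤ (2 * a) _ _ (begin
        2 * (t * 32) + 2 * a    ≤⟨ +-mono-≤ (≤-trans (≤-reflexive (lem t)) 64t≤m) 2a≤m ⟩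
        suc n + suc n           ≤⟨ +-mono-≤ (m≤∣m-n∣+n (suc n) a) (m≤∣m-n∣+n (suc n) a) ⟩
        ∣ suc n - a ∣ + a + (∣ suc n - a ∣ + a) ≡⟨ lem′ ∣ suc n - a ∣ a ⟩
        2 * ∣ suc n - a ∣ + 2 * a ∎)) ,
      *-cancelˡ-≤ 2 (≤-trans 2a≤m (≤-trans m≤68t (≤-reflexive (lem″ t))))
      where
      open ≤-Reasoning
      lem : ∀ t → 2 * (t * 32) ≡ t * 64
      lem = solve-∀
      lem′ : ∀ s a → s + a + (s + a) ≡ 2 * s + 2 * a
      lem′ = solve-∀
      lem″ : ∀ t → t * 68 ≡ 2 * (t * 34)
      lem″ = solve-∀

    34≤68 : t * 34 ≤ t * 68
    34≤68 = *-monoʳ-≤ t (toWitness {a? = 34 ≤? 68} _)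

    a≤68t : a ≤ t * 68
    a≤68t = ≤-trans (proj₂ (half {a} 2a≤m)) 34≤68
    b≤68t : b ≤ t * 68
    b≤68t = ≤-trans (proj₂ (half {b} 2b≤m)) 34≤68

    module Bound {T G} (1≤T : 1 ≤ T) (R : Reciprocal K T G) where
      open Kernel R a b 0 hiding (module TestFunction)
      open Reciprocal R

      r = t * 32 * (t * 32) + 1

      ρ≤K : ∀ {x y} → x ≤ suc n → y ≤ suc n → ρ x y ≤ K
      ρ≤K x≤ y≤ = +-monoˡ-≤ 1 (+-mono-≤ (*-mono-≤ dx dx) (*-mono-≤ dy dy))
        where
        dx = distance≤ (≤-trans x≤ m≤68t) a≤68t
        dy = distance≤ (≤-trans y≤ m≤68t) b≤68t

      -- Since a ≥ 1, xy ≤ (a + p)y ≤ ay + apy, and the error becomes a combination of ay and bx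
      -- with coefficients at most 4(27 + 61p) and 4(27 + 61q), where 4 · 27 = 108 and 4 · 61 = 108
      -- + 136. This makes the estimate uniform up to the boundary.
      error-small : ∀ {i j} → i < n → j < n → ¬ Near (suc i) (suc j) → ρ (suc i) (suc j) ≤ r →
        error (suc i) (suc j) ≤ 4 * (ρ (suc i) (suc j) * (a * suc j + b * suc i))
      error-small {i} {j} _ _ ¬near _ = begin
        108 * (x * y) + 136 * (p * y + q * x)
          ≤⟨ +-mono-≤ (*-monoʳ-≤ 108 (*-monoˡ-≤ y (m≤n+∣m-n∣ x a))) (*-monoʳ-≤ 136 (+-mono-≤ (m≤n*m (p * y) a) (m≤n*m (q * x) b))) ⟩
        108 * ((a + p) * y) + 136 * (a * (p * y) + b * (q * x))
          ≤⟨ +-monoˡ-≤ _ (*-monoʳ-≤ 108 (≤-trans (≤-reflexive (*-distribʳ-+ y a p)) (+-monoʳ-≤ (a * y) (m≤n*m (p * y) a)))) ⟩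
        108 * (a * y + a * (p * y)) + 136 * (a * (p * y) + b * (q * x))
          ≤⟨ ≤-by (108 * (b * x) + 108 * (b * (q * x))) (collect a b x y p q) ⟩
        4 * (a * y * (27 + 61 * p) + b * x * (27 + 61 * q))
          ≤⟨ *-monoʳ-≤ 4 (+-mono-≤ (*-monoʳ-≤ (a * y) p-small) (*-monoʳ-≤ (b * x) q-small)) ⟩
        4 * (a * y * ρ x y + b * x * ρ x y)
          ≡⟨ cong (4 *_) (trans (sym (*-distribʳ-+ (ρ x y) (a * y) (b * x))) (*-comm (a * y + b * x) (ρ x y))) ⟩
        4 * (ρ x y * (a * y + b * x)) ∎
        where
        open ≤-Reasoning
        x = suc i
        y = suc j
        p = ∣ x - a ∣
        q = ∣ y - b ∣
        collect : ∀ a b x y p q → 108 * (a * y + a * (p * y)) + 136 * (a * (p * y) + b * (q * x)) + (108 * (b * x) + 108 * (b * (q * x)))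
                  ≡ 4 * (a * y * (27 + 61 * p) + b * x * (27 + 61 * q))
        collect = solve-∀
        large : ∀ {p} q → 62 < p → 27 + 61 * p ≤ p * p + q * q
        large {p} q 62<p = ≤-trans (+-monoˡ-≤ (61 * p) (≤-trans (toWitness {a? = 27 ≤? 62} _) (<⇒≤ 62<p))) (≤-trans (*-monoˡ-≤ p (<⇒≤ 62<p)) (m≤m+n _ _))
        small : ∀ {p q} → p ≤ 62 → 62 < q → 27 + 61 * p ≤ p * p + q * q
        small {p} {q} p≤ 62<q = ≤-trans (+-monoʳ-≤ 27 (*-monoʳ-≤ 61 p≤)) (≤-trans (toWitness {a? = 27 + 61 * 62 ≤? 63 * 63} _) (≤-trans (*-mono-≤ 62<q 62<q) (m≤n+m (q * q) (p * p))))
        separated : ∀ p q → ¬ (p ≤ 62 × q ≤ 62) → 27 + 61 * p ≤ p * p + q * q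
        separated p q ¬both with p ≤? 62 | q ≤? 62
        ... | yes p≤ | yes q≤ with () ← ¬both (p≤ , q≤)
        ... | no p≰  | _      = large q (≰⇒> p≰)
        ... | yes p≤ | no q≰  = small p≤ (≰⇒> q≰)
        p-small : 27 + 61 * p ≤ ρ x y
        p-small = ≤-trans (separated p q ¬near) (m≤m+n _ 1)
        q-small : 27 + 61 * q ≤ ρ x y
        q-small = ≤-trans (separated q p (λ (q≤ , p≤) → ¬near (p≤ , q≤))) (≤-trans (≤-reflexive (+-comm (q * q) (p * p))) (m≤m+n _ 1))

      open Kernel.TestFunction R a b 0 O ρ≤K r (m≤n+m 1 _)
        (+-monoˡ-≤ 1 (*-mono-≤ (proj₁ (half {a} 2a≤m)) (proj₁ (half {a} 2a≤m))))
        (+-monoˡ-≤ 1 (*-mono-≤ (proj₁ (half {b} 2b≤m)) (proj₁ (half {b} 2b≤m)))) Near near? error-small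

      f : ℕ → ℕ
      f d = G (d * d + 1)

      ρ-exact : ∀ {i j} → i < n → j < n → G (ρ (suc i) (suc j)) * ρ (suc i) (suc j) ≡ T
      ρ-exact {i} {j} i<n j<n = exact (ρ≥1 (suc i) (suc j)) (ρ≤K (m≤n⇒m≤1+n i<n) (m≤n⇒m≤1+n j<n))

      -- In xy ≤ (a + p)(b + q) the product ab leaves two factors 1/S, one summable in x and one in
      -- y. The cross terms spend one of them on p, q, pq ≤ S; the resulting sum of n equal terms in
      -- y still fits into t(a + b).
      F-upper : ∀ {i j} → i < n → j < n → let x = suc i ; y = suc j in
        F x y ≤ f ∣ x - a ∣ * (a * b * f ∣ y - b ∣ + T * (a + b + 1))
      F-upper {i} {j} i<n j<n = begin
        x * y * (g * g)
          ≤⟨ *-monoˡ-≤ (g * g) (*-mono-≤ (m≤n+∣m-n∣ x a) (m≤n+∣m-n∣ y b)) ⟩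
        (a + p) * (b + q) * (g * g)
          ≡⟨ regroup a b p q g ⟩
        a * b * g * g + (a * q + b * p + p * q) * g * g
          ≤⟨ +-mono-≤ (*-mono-≤ (*-monoʳ-≤ (a * b) g≤fq) g≤fp) (*-mono-≤ cross≤ g≤fp) ⟩
        a * b * f q * f p + T * (a + b + 1) * f p
          ≡⟨ trans (sym (*-distribʳ-+ (f p) (a * b * f q) _)) (*-comm _ (f p)) ⟩
        f p * (a * b * f q + T * (a + b + 1)) ∎
        where
        open ≤-Reasoning
        x = suc i
        y = suc j
        p = ∣ x - a ∣
        q = ∣ y - b ∣
        g = G (ρ x y)
        regroup : ∀ a b p q g → (a + p) * (b + q) * (g * g) ≡ a * b * g * g + (a * q + b * p + p * q) * g * g
        regroup = solve-∀
        g≤fp : g ≤ f p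
        g≤fp = antitone (m≤n+m 1 (p * p)) (+-monoˡ-≤ 1 (m≤m+n (p * p) (q * q)))
        g≤fq : g ≤ f q
        g≤fq = antitone (m≤n+m 1 (q * q)) (+-monoˡ-≤ 1 (m≤n+m (q * q) (p * p)))
        self≤square : ∀ k → k ≤ k * k
        self≤square zero    = z≤n
        self≤square (suc k) = m≤m*n (suc k) (suc k)
        q≤ : q ≤ ρ x y
        q≤ = ≤-trans (self≤square q) (≤-trans (m≤n+m (q * q) (p * p)) (m≤m+n _ 1))
        p≤ : p ≤ ρ x y
        p≤ = ≤-trans (self≤square p) (≤-trans (m≤m+n (p * p) (q * q)) (m≤m+n _ 1))
        pq≤ : p * q ≤ ρ x y
        pq≤ with ≤-total p q
        ... | inj₁ p≤q = ≤-trans (*-monoˡ-≤ q p≤q) (≤-trans (m≤n+m (q * q) (p * p)) (m≤m+n _ 1))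
        ... | inj₂ q≤p = ≤-trans (*-monoʳ-≤ p q≤p) (≤-trans (m≤m+n (p * p) (q * q)) (m≤m+n _ 1))
        cross≤ : (a * q + b * p + p * q) * g ≤ T * (a + b + 1)
        cross≤ = begin
          (a * q + b * p + p * q) * g       ≤⟨ *-monoˡ-≤ g (+-mono-≤ (+-mono-≤ (*-monoʳ-≤ a q≤) (*-monoʳ-≤ b p≤)) pq≤) ⟩
          (a * ρ x y + b * ρ x y + ρ x y) * g ≡⟨ collect a b (ρ x y) g ⟩
          g * ρ x y * (a + b + 1)           ≡⟨ cong (_* (a + b + 1)) (ρ-exact i<n j<n) ⟩
          T * (a + b + 1) ∎
          where
          collect : ∀ a b s g → (a * s + b * s + s) * g ≡ g * s * (a + b + 1)
          collect = solve-∀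

      n≤68t : n ≤ t * 68
      n≤68t = ≤-trans (n≤1+n n) m≤68t

      Σf≤ : ∀ N → N ≤ t * 68 → Σ< N f ≤ 3 * T
      Σf≤ N N≤ = Σ-reciprocal-squares R N (m≤n+m 1 _) λ {k} k<N → +-monoˡ-≤ 1 (≤-trans (*-mono-≤ (≤-trans (<⇒≤ k<N) N≤) (≤-trans (<⇒≤ k<N) N≤)) (m≤m+n _ _)) ,
        ≤-trans (≤-trans k<N N≤) (≤-trans (m≤n*m (t * 68) (t * 68) {{m*n≢0 t 68}}) (≤-trans (m≤m+n _ (t * 68 * (t * 68))) (m≤m+n _ 1)))

      Σf-distance≤ : ∀ {a′} → suc a′ ≤ t * 68 → Σ< n (λ i → f ∣ suc i - suc a′ ∣) ≤ 6 * T
      Σf-distance≤ {a′} a≤ = ≤-trans (Σ<-distance n a′ f) (≤-trans (+-mono-≤ (Σf≤ n n≤68t) (Σf≤ (suc a′) a≤)) (≤-reflexive (lem T)))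
        where
        lem : ∀ T → 3 * T + 3 * T ≡ 6 * T
        lem = solve-∀

      ΣF-upper : ΣΣ n F ≤ T * T * (t * (a + b)) * 3264
      ΣF-upper = begin
        ΣΣ n F
          ≤⟨ ΣΣ-mono n (λ i<n j<n → F-upper i<n j<n) ⟩
        ΣΣ n (λ x y → f ∣ x - a ∣ * (a * b * f ∣ y - b ∣ + T * (a + b + 1)))
          ≡⟨ ΣΣ-product n (λ x → f ∣ x - a ∣) (λ y → a * b * f ∣ y - b ∣ + T * (a + b + 1)) ⟩
        Σ< n (λ i → f ∣ suc i - a ∣) * Σ< n (λ j → a * b * f ∣ suc j - b ∣ + T * (a + b + 1))
          ≡⟨ cong (Σ< n (λ i → f ∣ suc i - a ∣) *_) (trans (Σ<-+ n _ _) (cong₂ _+_ (Σ<-*ˡ n (a * b) _) (Σ<-const n _))) ⟩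
        Σ< n (λ i → f ∣ suc i - a ∣) * (a * b * Σ< n (λ j → f ∣ suc j - b ∣) + n * (T * (a + b + 1)))
          -- Using b ≤ 68t in ab, and 1 ≤ a to replace a + b + 1 by a + b + a, makes every term at
          -- most a multiple of t(a + b).
          ≤⟨ *-mono-≤ (Σf-distance≤ a≤68t) (+-mono-≤ (*-mono-≤ (*-monoʳ-≤ a b≤68t) (Σf-distance≤ b≤68t)) (*-mono-≤ n≤68t (*-monoʳ-≤ T (+-monoʳ-≤ (a + b) (s≤s z≤n))))) ⟩
        6 * T * (a * (t * 68) * (6 * T) + t * 68 * (T * (a + b + a)))
          ≤⟨ ≤-by (T * T * (t * b) * 2856) (collect T t a b) ⟩
        T * T * (t * (a + b)) * 3264 ∎
        where
        open ≤-Reasoning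
        collect : ∀ T t a b → 6 * T * (a * (t * 68) * (6 * T) + t * 68 * (T * (a + b + a))) + T * T * (t * b) * 2856 ≡ T * T * (t * (a + b)) * 3264
        collect = solve-∀

      B = t * t * 1025

      -- Wherever the pole lies in its quadrant, the ball is inside the disc: the coordinates differ
      -- by at most 4t + 18t, and 2 · 22² ≤ 32². On the ball x and y are at least 12t, so ay + bx is
      -- at least 12t(a + b).
      gain-lower : ∀ {i j} → i < n → j < n → let x = suc i ; y = suc j in
        Ball t x y → ρ x y ≤ r × T * T * T * T * (t * (a + b)) ≤ B * B * B * (4 * gain x y)
      gain-lower {i} {j} i<n j<n (x-ball , y-ball) = ρ≤r , (begin
        T * T * T * T * (t * (a + b))                   ≤⟨ *-monoʳ-≤ (T * T * T * T) (≤-by (t * (a + b) * 47) (lem t a b)) ⟩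
        T * T * T * T * (4 * (a * (t * 12) + b * (t * 12))) ≤⟨ *-mono-≤ (*-monoˡ-≤ T (*-mono-≤ (*-mono-≤ T≤ T≤) T≤)) (*-monoʳ-≤ 4 (+-mono-≤ (*-monoʳ-≤ a (12t≤ {y} y-ball)) (*-monoʳ-≤ b (12t≤ {x} x-ball)))) ⟩
        g * B * (g * B) * (g * B) * T * (4 * (a * y + b * x)) ≡⟨ regroup g B T (a * y + b * x) ⟩
        B * B * B * (4 * gain x y) ∎)
        where
        open ≤-Reasoning
        x = suc i
        y = suc j
        g = G (ρ x y)
        lem : ∀ t a b → t * (a + b) + t * (a + b) * 47 ≡ 4 * (a * (t * 12) + b * (t * 12))
        lem = solve-∀
        regroup : ∀ g B T M → g * B * (g * B) * (g * B) * T * (4 * M) ≡ B * B * B * (4 * (T * (g * g * g) * M))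
        regroup = solve-∀
        12t≤ : ∀ {x} → ∣ x - t * 16 ∣ ≤ t * 4 → t * 12 ≤ x
        12t≤ {x} d≤ = +-cancelʳ-≤ (t * 4) _ _ (≤-trans (≤-reflexive (lem₁ t)) (≤-trans (m≤n+∣n-m∣ (t * 16) x) (+-monoʳ-≤ x d≤)))
          where
          lem₁ : ∀ t → t * 12 + t * 4 ≡ t * 16
          lem₁ = solve-∀
        22t : ∀ {x a} → ∣ x - t * 16 ∣ ≤ t * 4 → a ≤ t * 34 → ∣ x - a ∣ ≤ t * 22
        22t {x} {a} d≤ a≤ = ≤-trans (∣-∣-triangle x (t * 16) a) (≤-trans (+-mono-≤ d≤ (18t a a≤)) (≤-reflexive (lem₂ t)))
          where
          lem₂ : ∀ t → t * 4 + t * 18 ≡ t * 22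
          lem₂ = solve-∀
          lem₃ : ∀ t → t * 34 ≡ t * 16 + t * 18
          lem₃ = solve-∀
          18t : ∀ a → a ≤ t * 34 → ∣ t * 16 - a ∣ ≤ t * 18
          18t a a≤ with ≤-total a (t * 16)
          ... | inj₁ a≤16t = ≤-trans (≤-reflexive (m≤n⇒∣n-m∣≡n∸m a≤16t)) (≤-trans (m∸n≤m (t * 16) a) (*-monoʳ-≤ t (toWitness {a? = 16 ≤? 18} _)))
          ... | inj₂ 16t≤a = ≤-trans (≤-reflexive (m≤n⇒∣m-n∣≡n∸m 16t≤a)) (m≤n+o⇒m∸n≤o a (t * 16) (≤-trans a≤ (≤-reflexive (lem₃ t))))
        dx : ∣ x - a ∣ ≤ t * 22
        dx = 22t {x} x-ball (proj₂ (half {a} 2a≤m))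
        dy : ∣ y - b ∣ ≤ t * 22
        dy = 22t {y} y-ball (proj₂ (half {b} 2b≤m))
        ρ≤r : ρ x y ≤ r
        ρ≤r = +-monoˡ-≤ 1 (≤-trans (+-mono-≤ (*-mono-≤ dx dx) (*-mono-≤ dy dy)) (≤-by (t * t * 56) (lem₄ t)))
          where
          lem₄ : ∀ t → t * 22 * (t * 22) + t * 22 * (t * 22) + t * t * 56 ≡ t * 32 * (t * 32)
          lem₄ = solve-∀
        T≤ : T ≤ g * B
        T≤ = ≤-trans (≤-reflexive (sym (ρ-exact i<n j<n))) (*-monoʳ-≤ g (≤-trans ρ≤r (≤-trans (+-monoʳ-≤ (t * 32 * (t * 32)) (*-mono-≤ 1≤t 1≤t)) (≤-reflexive (lem₅ t)))))
          where
          lem₅ : ∀ t → t * 32 * (t * 32) + t * t ≡ t * t * 1025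
          lem₅ = solve-∀

      -- Comparing the loss with F itself, instead of with a constant, lets `ΣF-upper` bound the sum
      -- of the losses, so that this sum is proportional to a + b too.
      loss-upper : ∀ {i j} → i < n → j < n → let x = suc i ; y = suc j in
        Near x y → loss x y ≤ T * T * 16972 * F x y
      loss-upper {i} {j} i<n j<n (p≤ , q≤) = begin
        g * g * (g * g) * error x y                ≤⟨ *-mono-≤ (*-monoˡ-≤ (g * g) (*-mono-≤ g≤T g≤T)) error≤ ⟩
        T * T * (g * g) * (x * y * 16972)          ≡⟨ regroup (T * T) (g * g) (x * y) 16972 ⟩
        T * T * 16972 * (x * y * (g * g))          ∎
        where
        open ≤-Reasoning
        x = suc i
        y = suc j
        g = G (ρ x y)
        g≤T : g ≤ T
        g≤T = ≤-trans (m≤m*n g (ρ x y) {{>-nonZero (ρ≥1 x y)}}) (≤-reflexive (ρ-exact i<n j<n))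
        regroup : ∀ T g z k → T * g * (z * k) ≡ T * k * (z * g)
        regroup = solve-∀
        62xy : ∀ {p y} x → p ≤ 62 → p * y ≤ 62 * (suc x * y)
        62xy {p} {y} x p≤ = ≤-trans (*-monoˡ-≤ y p≤) (*-monoʳ-≤ 62 (m≤n*m y (suc x)))
        error≤ : error x y ≤ x * y * 16972
        error≤ = ≤-trans (+-monoʳ-≤ (108 * (x * y)) (*-monoʳ-≤ 136 (+-mono-≤ (62xy i p≤) (62xy j q≤)))) (≤-reflexive (collect x y))
          where
          collect : ∀ x y → 108 * (x * y) + 136 * (62 * (x * y) + 62 * (y * x)) ≡ x * y * 16972
          collect = solve-∀

      module _ {M} (u≤M : ∀ {i j} → i < n → j < n → Near (suc i) (suc j) → u (suc i) (suc j) ≤ M) where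

        gains = ΣΣ n (λ x y → u x y * on (far? x y) (4 * gain x y))
        losses = ΣΣ n (λ x y → u x y * on (near? x y) (loss x y))

        -- The test inequality yields nothing inside `Near`; that part of the ball is counted
        -- directly with the bound M.
        away? : ∀ x y → Dec (Ball t x y × ¬ Near x y)
        away? x y = ball? t x y ×-dec (¬? (near? x y))

        away = ΣΣ n (λ x y → u x y * on (away? x y) 1)
        nearby = ΣΣ n (λ x y → u x y * on (near? x y) 1)

        gains-lower : T * T * T * T * (t * (a + b)) * away ≤ B * B * B * gains
        gains-lower = begin
          Q * away                                                  ≡⟨ ΣΣ-*ˡ n Q _ ⟨
          ΣΣ n (λ x y → Q * (u x y * on (away? x y) 1))             ≤⟨ ΣΣ-mono n (λ {i} {j} i<n j<n → pointwise′ i<n j<n) ⟩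
          ΣΣ n (λ x y → B * B * B * (u x y * on (far? x y) (4 * gain x y))) ≡⟨ ΣΣ-*ˡ n (B * B * B) _ ⟩
          B * B * B * gains                                         ∎
          where
          open ≤-Reasoning
          Q = T * T * T * T * (t * (a + b))
          regroup : ∀ s u z → s * (u * z) ≡ u * (s * z)
          regroup = solve-∀
          pointwise′ : ∀ {i j} → i < n → j < n → let x = suc i ; y = suc j in
            Q * (u x y * on (away? x y) 1) ≤ B * B * B * (u x y * on (far? x y) (4 * gain x y))
          pointwise′ {i} {j} i<n j<n = begin
            Q * (u x y * on (away? x y) 1)                      ≡⟨ regroup Q (u x y) _ ⟩
            u x y * (Q * on (away? x y) 1)                      ≡⟨ cong (u x y *_) (on-*ˡ (away? x y) Q 1) ⟩
            u x y * on (away? x y) (Q * 1)                      ≤⟨ *-monoʳ-≤ (u x y) (on-mono (away? x y) (far? x y) {Q * 1} {B * B * B * (4 * gain x y)}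
                (λ (ball , ¬near) → let ρ≤r , gain≥ = gain-lower i<n j<n ball in (ρ≤r , ¬near) , ≤-trans (≤-reflexive (*-identityʳ Q)) gain≥)) ⟩
            u x y * on (far? x y) (B * B * B * (4 * gain x y))  ≡⟨ cong (u x y *_) (on-*ˡ (far? x y) (B * B * B) (4 * gain x y)) ⟨
            u x y * (B * B * B * on (far? x y) (4 * gain x y))  ≡⟨ regroup (B * B * B) (u x y) _ ⟨
            B * B * B * (u x y * on (far? x y) (4 * gain x y))  ∎
            where
            x = suc i
            y = suc j

        losses-upper : losses ≤ M * (T * T * 16972) * ΣΣ n F
        losses-upper = ≤-trans (ΣΣ-mono n (λ {i} {j} i<n j<n → pointwise′ i<n j<n)) (≤-reflexive (ΣΣ-*ˡ n (M * (T * T * 16972)) F))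
          where
          open ≤-Reasoning
          pointwise′ : ∀ {i j} → i < n → j < n → let x = suc i ; y = suc j in
            u x y * on (near? x y) (loss x y) ≤ M * (T * T * 16972) * F x y
          pointwise′ {i} {j} i<n j<n with near? (suc i) (suc j)
          ... | no _     = ≤-trans (≤-reflexive (*-zeroʳ (u (suc i) (suc j)))) z≤n
          ... | yes near = ≤-trans (*-mono-≤ (u≤M i<n j<n near) (loss-upper i<n j<n near)) (≤-reflexive (sym (*-assoc M (T * T * 16972) _)))

        nearby≤ : nearby ≤ t * 68 * (t * 68 * M)
        nearby≤ = ≤-trans (ΣΣ≤ n M (λ {i} {j} i<n j<n → pointwise′ i<n j<n)) (*-mono-≤ n≤68t (*-monoˡ-≤ M n≤68t))
          where
          pointwise′ : ∀ {i j} → i < n → j < n → u (suc i) (suc j) * on (near? (suc i) (suc j)) 1 ≤ M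
          pointwise′ {i} {j} i<n j<n with near? (suc i) (suc j)
          ... | no _     = ≤-trans (≤-reflexive (*-zeroʳ (u (suc i) (suc j)))) z≤n
          ... | yes near = ≤-trans (≤-reflexive (*-identityʳ _)) (u≤M i<n j<n near)

        ballMass≤ : ballMass n t u ≤ away + nearby
        ballMass≤ = ≤-trans (ΣΣ-mono n (λ {i} {j} _ _ → pointwise′ (suc i) (suc j))) (≤-reflexive (ΣΣ-+ n _ _))
          where
          split : ∀ x y → on (ball? t x y) 1 ≤ on (away? x y) 1 + on (near? x y) 1
          split x y with ball? t x y | near? x y
          ... | no _  | _     = z≤n
          ... | yes _ | no _  = s≤s z≤n
          ... | yes _ | yes _ = s≤s z≤n
          pointwise′ : ∀ x y → u x y * on (ball? t x y) 1 ≤ u x y * on (away? x y) 1 + u x y * on (near? x y) 1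
          pointwise′ x y = ≤-trans (*-monoʳ-≤ (u x y) (split x y)) (≤-reflexive (*-distribˡ-+ (u x y) _ _))

        away≤ : away ≤ t * t * t * (t * t * t) * ((M * 16972 + 3) * 3264 * (1025 * 1025 * 1025))
        away≤ = *-cancelˡ-≤ (T * T * T * T * (t * (a + b))) {{scale≢0}} (begin
          T * T * T * T * (t * (a + b)) * away
            ≤⟨ gains-lower ⟩
          B * B * B * gains
            ≤⟨ *-monoʳ-≤ (B * B * B) (≤-trans test-bound (+-monoˡ-≤ _ losses-upper)) ⟩
          B * B * B * (M * (T * T * 16972) * ΣΣ n F + 3 * (T * T * ΣΣ n F))
            ≡⟨ factor (B * B * B) M (T * T) 16972 (ΣΣ n F) ⟩
          B * B * B * (T * T * (M * 16972 + 3)) * ΣΣ n F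
            ≤⟨ *-monoʳ-≤ (B * B * B * (T * T * (M * 16972 + 3))) ΣF-upper ⟩
          B * B * B * (T * T * (M * 16972 + 3)) * (T * T * (t * (a + b)) * 3264)
            ≡⟨ collect 1025 (M * 16972 + 3) 3264 t T (a + b) ⟩
          T * T * T * T * (t * (a + b)) * (t * t * t * (t * t * t) * ((M * 16972 + 3) * 3264 * (1025 * 1025 * 1025))) ∎)
          where
          open ≤-Reasoning
          scale≢0 : NonZero (T * T * T * T * (t * (a + b)))
          scale≢0 = >-nonZero (*-mono-≤ (*-mono-≤ (*-mono-≤ (*-mono-≤ 1≤T 1≤T) 1≤T) 1≤T) (*-mono-≤ 1≤t (s≤s {_} {a′ + b} z≤n)))
          factor : ∀ B M T k F → B * (M * (T * k) * F + 3 * (T * F)) ≡ B * (T * (M * k + 3)) * F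
          factor = solve-∀
          collect : ∀ k l m t T s → t * t * k * (t * t * k) * (t * t * k) * (T * T * l) * (T * T * (t * s) * m)
            ≡ T * T * T * T * (t * s) * (t * t * t * (t * t * t) * (l * m * (k * k * k)))
          collect = solve-∀

        conclusion : ballMass n t u ≤ t * t * t * (t * t * t) * ((M * 16972 + 3) * 3264 * (1025 * 1025 * 1025)) + t * 68 * (t * 68 * M)
        conclusion = ≤-trans ballMass≤ (+-mono-≤ away≤ nearby≤)

  concentrated : ∀ {M} → (∀ {i j} → i < n → j < n → Near (suc i) (suc j) → u (suc i) (suc j) ≤ M) →
    ballMass n t u ≤ t * t * t * (t * t * t) * ((M * 16972 + 3) * 3264 * (1025 * 1025 * 1025)) + t * 68 * (t * 68 * M)
  concentrated u≤M with T , G , 1≤T , R ← reciprocal K = Bound.conclusion 1≤T R u≤M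

-- Harnack's inequality by chaining neighbours

geometric : ∀ n (f : ℕ → ℕ) → (∀ {i} → suc i < n → f (suc i) ≤ 4 * f i × f i ≤ 4 * f (suc i)) →
            ∀ {p i} → p < n → i < n → f p ≤ 4 ^ ∣ p - i ∣ * f i
geometric (suc n) f h {zero}  {zero}  _ _ = ≤-reflexive (sym (+-identityʳ (f 0)))
geometric (suc n) f h {suc p} {suc i} (s<s p<n) (s<s i<n) = geometric n (f ∘ suc) (h ∘ s<s) p<n i<n
geometric (suc (suc n)) f h {suc p} {zero} (s<s p<n) _ = begin
  f (suc p)                     ≤⟨ geometric (suc n) (f ∘ suc) (h ∘ s<s) p<n z<s ⟩
  4 ^ ∣ p - 0 ∣ * f 1           ≡⟨ cong (λ k → 4 ^ k * f 1) (∣-∣-identityʳ p) ⟩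
  4 ^ p * f 1                   ≤⟨ *-monoʳ-≤ (4 ^ p) (proj₁ (h (s<s z<s))) ⟩
  4 ^ p * (4 * f 0)             ≡⟨ regroup (4 ^ p) (f 0) ⟩
  4 * 4 ^ p * f 0               ∎
  where
  open ≤-Reasoning
  regroup : ∀ q f → q * (4 * f) ≡ 4 * q * f
  regroup = solve-∀
geometric (suc (suc n)) f h {zero} {suc i} _ (s<s i<n) = begin
  f 0                           ≤⟨ proj₂ (h (s<s z<s)) ⟩
  4 * f 1                       ≤⟨ *-monoʳ-≤ 4 (geometric (suc n) (f ∘ suc) (h ∘ s<s) z<s i<n) ⟩
  4 * (4 ^ i * f (suc i))       ≡⟨ *-assoc 4 (4 ^ i) _ ⟨
  4 * 4 ^ i * f (suc i)         ∎
  where open ≤-Reasoning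

module Harnack {n} {u : ℕ → ℕ → ℕ} (O : Odometer n u) where
  open Odometer O

  private
    -- Passing from u to u + 1 turns the additive 3 into a purely multiplicative comparison, 4z + 3
    -- + 1 = 4(z + 1).
    four : ∀ {v z} → v ≤ 4 * z + 3 → suc v ≤ 4 * suc z
    four {v} {z} v≤ = ≤-trans (s≤s v≤) (≤-reflexive (lem z))
      where
      lem : ∀ z → 1 + (4 * z + 3) ≡ 4 * (1 + z)
      lem = solve-∀

    module _ {i j} (i<n : i < n) (j<n : j < n) where
      toEast : suc (u (suc (suc i)) (suc j)) ≤ 4 * suc (u (suc i) (suc j))
      toEast = four (≤-trans (≤-trans (m≤m+n _ _) (m≤m+n _ _)) (almostSuperharmonic i<n j<n))
      toWest : suc (u i (suc j)) ≤ 4 * suc (u (suc i) (suc j))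
      toWest = four (≤-trans (≤-trans (m≤n+m (u i (suc j)) (u (suc (suc i)) (suc j))) (m≤m+n _ _)) (almostSuperharmonic i<n j<n))
      toNorth : suc (u (suc i) (suc (suc j))) ≤ 4 * suc (u (suc i) (suc j))
      toNorth = four (≤-trans (≤-trans (m≤m+n (u (suc i) (suc (suc j))) (u (suc i) j)) (m≤n+m _ (u (suc (suc i)) (suc j) + u i (suc j)))) (almostSuperharmonic i<n j<n))
      toSouth : suc (u (suc i) j) ≤ 4 * suc (u (suc i) (suc j))
      toSouth = four (≤-trans (≤-trans (m≤n+m (u (suc i) j) (u (suc i) (suc (suc j)))) (m≤n+m _ (u (suc (suc i)) (suc j) + u i (suc j)))) (almostSuperharmonic i<n j<n))

  module _ {a b} (a<n : a < n) (b<n : b < n) (zero-at : u (suc a) (suc b) ≡ 0) where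

    harnack : ∀ {i j} → i < n → j < n → suc (u (suc i) (suc j)) ≤ 4 ^ (∣ i - a ∣ + ∣ j - b ∣)
    harnack {i} {j} i<n j<n = begin
      suc (u (suc i) (suc j))
        ≤⟨ geometric n (λ i → suc (u (suc i) (suc j))) (λ i+1<n → toEast (<⇒≤ i+1<n) j<n , toWest i+1<n j<n) i<n a<n ⟩
      4 ^ ∣ i - a ∣ * suc (u (suc a) (suc j))
        ≤⟨ *-monoʳ-≤ (4 ^ ∣ i - a ∣) (geometric n (λ j → suc (u (suc a) (suc j))) (λ j+1<n → toNorth a<n (<⇒≤ j+1<n) , toSouth a<n j+1<n) j<n b<n) ⟩
      4 ^ ∣ i - a ∣ * (4 ^ ∣ j - b ∣ * suc (u (suc a) (suc b)))
        ≡⟨ cong (λ k → 4 ^ ∣ i - a ∣ * (4 ^ ∣ j - b ∣ * suc k)) zero-at ⟩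
      4 ^ ∣ i - a ∣ * (4 ^ ∣ j - b ∣ * 1)
        ≡⟨ cong (4 ^ ∣ i - a ∣ *_) (*-identityʳ _) ⟩
      4 ^ ∣ i - a ∣ * 4 ^ ∣ j - b ∣
        ≡⟨ ^-distribˡ-+-* 4 ∣ i - a ∣ ∣ j - b ∣ ⟨
      4 ^ (∣ i - a ∣ + ∣ j - b ∣) ∎
      where open ≤-Reasoning

-- Symmetries of the square

module _ (n : ℕ) where

  reflectˣ : (ℕ → ℕ → ℕ) → ℕ → ℕ → ℕ
  reflectˣ u x y = u (suc n ∸ x) y

  reflectʸ : (ℕ → ℕ → ℕ) → ℕ → ℕ → ℕ
  reflectʸ u x y = u x (suc n ∸ y)

  ∸-suc : ∀ {i} → i < n → n ∸ i ≡ suc (n ∸ suc i)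
  ∸-suc i<n = +-∸-assoc 1 i<n

  ∸-suc< : ∀ {i} → i < n → n ∸ suc i < n
  ∸-suc< {i} i<n = ≤-trans (≤-reflexive (sym (∸-suc i<n))) (m∸n≤m n i)

  flip-odometer : ∀ {u} → Odometer n u → Odometer n (flip u)
  flip-odometer {u} O = record
    { ring = record { left = bottom ; right = top ; bottom = left ; top = right }
    ; almostSuperharmonic = λ {i} {j} i<n j<n → ≤-trans (≤-reflexive (+-comm (u (suc j) (suc (suc i)) + u (suc j) i) _)) (almostSuperharmonic j<n i<n)
    }
    where
    open Odometer O
    open VanishesOnRing ring

  reflectˣ-odometer : ∀ {u} → Odometer n u → Odometer n (reflectˣ u)
  reflectˣ-odometer {u} O = record
    { ring = record { left = right ; right = λ y → trans (cong (λ k → u k y) (n∸n≡0 n)) (left y) ; bottom = λ x → bottom _ ; top = λ x → top _ }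
    ; almostSuperharmonic = superharmonic
    }
    where
    open Odometer O
    open VanishesOnRing ring
    superharmonic : ∀ {i j} → i < n → j < n → neighbours (reflectˣ u) (suc i) (suc j) ≤ 4 * reflectˣ u (suc i) (suc j) + 3
    superharmonic {i} {j} i<n j<n
      rewrite +-∸-assoc 1 (<⇒≤ i<n) | ∸-suc i<n =
      ≤-trans (≤-reflexive (cong (_+ (u (suc (n ∸ suc i)) (suc (suc j)) + u (suc (n ∸ suc i)) j)) (+-comm (u (n ∸ suc i) (suc j)) _))) (almostSuperharmonic (∸-suc< i<n) j<n)

  reflectʸ-odometer : ∀ {u} → Odometer n u → Odometer n (reflectʸ u)
  reflectʸ-odometer = flip-odometer ∘ reflectˣ-odometer ∘ flip-odometer

opaque
  unfolding ΣΣ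

  ΣΣ-reflectˣ : ∀ n (f : ℕ → ℕ → ℕ) → ΣΣ n (λ x y → f (suc n ∸ x) y) ≡ ΣΣ n f
  ΣΣ-reflectˣ n f = trans (Σ<-cong n λ {i} i<n → cong (λ k → Σ< n λ j → f k (suc j)) (∸-suc n i<n)) (Σ<-reverse n _)

  row≤ΣΣ : ∀ n (f : ℕ → ℕ → ℕ) → 0 < n → Σ< n (λ j → f 1 (suc j)) ≤ ΣΣ n f
  row≤ΣΣ n f 0<n = term≤Σ< n (λ i → Σ< n λ j → f (suc i) (suc j)) 0<n

ballMass-flip : ∀ n t u → ballMass n t u ≤ ballMass n t (flip u)
ballMass-flip n t u = ≤-trans (≤-reflexive (ΣΣ-swap n _))
  (ΣΣ-mono n λ {i} {j} _ _ → *-monoʳ-≤ (u (suc j) (suc i)) (on-mono (ball? t (suc j) (suc i)) (ball? t (suc i) (suc j)) {1} {1} λ (p , q) → (q , p) , ≤-refl))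

-- The new coefficient of t⁶ in a mass bound after one use of `spread`; the summand without C comes
-- from the sum of the test function, of order t⁴, which is raised to t⁶.
spreadFactor : ℕ → ℕ
spreadFactor C = (C * (404 * (68 * 68)) + 3 * (68 * 68 * (68 * 68))) * (2306 * 2306 * 2306)

C≤spreadFactor : ∀ C → C ≤ spreadFactor C
C≤spreadFactor C = ≤-trans (≤-trans (m≤m*n C (404 * (68 * 68))) (m≤m+n _ _)) (m≤m*n _ (2306 * 2306 * 2306))

module _ (P : ℕ) where

  -- Coefficients of t⁶ in the mass bound for an untoppled vertex in the corner quadrant, in the
  -- adjacent half, and anywhere; then the coefficient of t⁷ for half a side.
  C₀ C₁ C₂ C₃ : ℕ
  C₀ = (4 ^ P * 16972 + 3) * 3264 * (1025 * 1025 * 1025) + 68 * 68 * 4 ^ P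
  C₁ = spreadFactor C₀
  C₂ = spreadFactor C₁
  C₃ = spreadFactor C₂

-- From one quadrant to all four, and to the sides

module Geometry {n t} (16≤t : 16 ≤ t) (64t≤m : t * 64 ≤ suc n) (m≤68t : suc n ≤ t * 68) where

  private
    1≤t : 1 ≤ t
    1≤t = ≤-trans (s≤s z≤n) 16≤t

    instance
      t≢0 : NonZero t
      t≢0 = >-nonZero 1≤t

  t⁶ : ℕ
  t⁶ = t * t * t * (t * t * t)

  private
    spreadBound : ∀ {C D} → D ≤ t⁶ * C →
      t * (D * (404 * (68 * 68)) + t * t * (t * t) * (3 * (68 * 68 * (68 * 68)))) * (2306 * 2306 * 2306) ≤ t * (t⁶ * spreadFactor C)
    spreadBound {C} {D} D≤ = begin
      t * (D * k + t * t * (t * t) * l) * m            ≤⟨ *-monoˡ-≤ m (*-monoʳ-≤ t (+-mono-≤ (*-monoˡ-≤ k D≤) (*-monoˡ-≤ l (t⁴≤t⁶)))) ⟩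
      t * (t⁶ * C * k + t⁶ * l) * m                    ≡⟨ regroup t t⁶ C k l m ⟩
      t * (t⁶ * spreadFactor C)                        ∎
      where
      open ≤-Reasoning
      k = 404 * (68 * 68)
      l = 3 * (68 * 68 * (68 * 68))
      m = 2306 * 2306 * 2306
      regroup : ∀ t s C k l m → t * (s * C * k + s * l) * m ≡ t * (s * ((C * k + l) * m))
      regroup = solve-∀
      t⁴≤t⁶ : t * t * (t * t) ≤ t⁶
      t⁴≤t⁶ = ≤-trans (m≤m*n (t * t * (t * t)) (t * t) {{m*n≢0 t t}}) (≤-reflexive (lem t))
        where
        lem : ∀ t → t * t * (t * t) * (t * t) ≡ t * t * t * (t * t * t)
        lem = solve-∀

  module _ {u : ℕ → ℕ → ℕ} (O : Odometer n u) {C} (mass≤ : ballMass n t u ≤ t⁶ * C) where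
    open Spread O 16≤t 64t≤m m≤68t

    private
      16t = t * 16

      inRegion : ∀ {x y} p q → p * p + q * q ≤ 48 * 48 → ∣ x - 16t ∣ ≤ t * p → ∣ y - 16t ∣ ≤ t * q → t * 4 < ∣ x - 16t ∣ → Region x y
      inRegion {x} {y} p q p²+q²≤ dx≤ dy≤ outside =
        ≤-trans (+-mono-≤ (*-mono-≤ dx≤ dx≤) (*-mono-≤ dy≤ dy≤)) (≤-trans (≤-reflexive (regroup t p q)) (≤-trans (*-monoʳ-≤ (t * t) p²+q²≤) (≤-reflexive (regroup′ t 48)))) ,
        λ (inside , _) → <⇒≱ outside inside
        where
        regroup : ∀ t p q → t * p * (t * p) + t * q * (t * q) ≡ t * t * (p * p + q * q)
        regroup = solve-∀
        regroup′ : ∀ t p → t * t * (p * p) ≡ t * p * (t * p)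
        regroup′ = solve-∀

    -- The weight is t times the indicator of the mirrored ball. There 44t ≤ x ≤ 56t, so the weight
    -- is below x, and 40² + 4² ≤ 48² places the mirrored ball in the disc.
    mass-of-reflection : ballMass n t (reflectˣ n u) ≤ t⁶ * spreadFactor C
    mass-of-reflection = *-cancelˡ-≤ t (begin
      t * ballMass n t (reflectˣ n u)
        ≡⟨ cong (t *_) (ΣΣ-reflectˣ n _) ⟨
      t * ΣΣ n (λ x y → u (suc n ∸ (suc n ∸ x)) y * on (ball? t (suc n ∸ x) y) 1)
        ≡⟨ ΣΣ-*ˡ n t _ ⟨
      ΣΣ n (λ x y → t * (u (suc n ∸ (suc n ∸ x)) y * on (ball? t (suc n ∸ x) y) 1))
        ≡⟨ ΣΣ-cong n (λ {i} {j} i<n j<n → trans (cong (λ x → t * (u x (suc j) * on (ball? t (suc n ∸ suc i) (suc j)) 1)) (m∸[m∸n]≡n (m≤n⇒m≤1+n i<n))) (regroup t (u (suc i) (suc j)) _)) ⟩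
      ΣΣ n (λ x y → u x y * (t * on (ball? t (suc n ∸ x) y) 1))
        ≤⟨ spread (λ x y → t * on (ball? t (suc n ∸ x) y) 1) supported ⟩
      _
        ≤⟨ spreadBound mass≤ ⟩
      t * (t⁶ * spreadFactor C) ∎)
      where
      open ≤-Reasoning
      regroup : ∀ t u z → t * (u * z) ≡ u * (t * z)
      regroup = solve-∀
      supported : ∀ {i j} → i < n → j < n → t * on (ball? t (suc n ∸ suc i) (suc j)) 1 ≡ 0 ⊎ (Region (suc i) (suc j) × t * on (ball? t (suc n ∸ suc i) (suc j)) 1 ≤ suc i + suc j)
      supported {i} {j} i<n j<n with ball? t (suc n ∸ suc i) (suc j)
      ... | no _              = inj₁ (*-zeroʳ t)
      ... | yes (dx′≤ , dy≤) = inj₂ (inRegion {suc i} {suc j} 40 4 (toWitness {a? = 40 * 40 + 4 * 4 ≤? 48 * 48} _) dx≤ dy≤ (≤-trans (≤-trans (≤-reflexive (+-comm 1 (t * 4))) 4t<28t) 28t≤) ,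
                                      ≤-trans (≤-reflexive (*-identityʳ t)) (≤-trans (≤-by (t * 43) (lem₁ t)) (≤-trans 44t≤x (m≤m+n x _))))
        where
        x = suc i
        x′ = suc n ∸ x
        x+x′ : x + x′ ≡ suc n
        x+x′ = m+[n∸m]≡n (m≤n⇒m≤1+n i<n)
        x′≤ : x′ ≤ t * 20
        x′≤ = ≤-trans (m≤n+∣m-n∣ x′ 16t) (≤-trans (+-monoʳ-≤ 16t dx′≤) (≤-reflexive (lem t)))
          where
          lem : ∀ t → t * 16 + t * 4 ≡ t * 20
          lem = solve-∀
        x′≥ : t * 12 ≤ x′
        x′≥ = +-cancelʳ-≤ (t * 4) _ _ (≤-trans (≤-reflexive (lem t)) (≤-trans (m≤n+∣n-m∣ 16t x′) (+-monoʳ-≤ x′ dx′≤)))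
          where
          lem : ∀ t → t * 12 + t * 4 ≡ t * 16
          lem = solve-∀
        44t≤x : t * 44 ≤ x
        44t≤x = +-cancelʳ-≤ (t * 20) _ _ (≤-trans (≤-reflexive (lem t)) (≤-trans 64t≤m (≤-trans (≤-reflexive (sym x+x′)) (+-monoʳ-≤ x x′≤))))
          where
          lem : ∀ t → t * 44 + t * 20 ≡ t * 64
          lem = solve-∀
        x≤56t : x ≤ t * 56
        x≤56t = +-cancelʳ-≤ (t * 12) _ _ (≤-trans (+-monoʳ-≤ x x′≥) (≤-trans (≤-reflexive x+x′) (≤-trans m≤68t (≤-reflexive (lem t)))))
          where
          lem : ∀ t → t * 68 ≡ t * 56 + t * 12
          lem = solve-∀
        28t≤ : t * 28 ≤ ∣ x - 16t ∣
        28t≤ = +-cancelˡ-≤ 16t _ _ (≤-trans (≤-reflexive (lem t)) (≤-trans 44t≤x (m≤n+∣m-n∣ x 16t)))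
          where
          lem : ∀ t → t * 16 + t * 28 ≡ t * 44
          lem = solve-∀
        16t≤x : 16t ≤ x
        16t≤x = ≤-trans (*-monoʳ-≤ t (toWitness {a? = 16 ≤? 44} _)) 44t≤x
        dx≤ : ∣ x - 16t ∣ ≤ t * 40
        dx≤ = ≤-trans (≤-reflexive (m≤n⇒∣n-m∣≡n∸m 16t≤x)) (m≤n+o⇒m∸n≤o x 16t (≤-trans x≤56t (≤-reflexive (lem t))))
          where
          lem : ∀ t → t * 56 ≡ t * 16 + t * 40
          lem = solve-∀
        lem₁ : ∀ t → t + t * 43 ≡ t * 44
        lem₁ = solve-∀
        4t<28t : t * 4 + 1 ≤ t * 28
        4t<28t = ≤-trans (+-monoʳ-≤ (t * 4) 1≤t) (≤-by (t * 23) (lem₃ t))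
          where
          lem₃ : ∀ t → t * 4 + t + t * 23 ≡ t * 28
          lem₃ = solve-∀

    -- The weight is the indicator of the points with x = 1 and y ≤ 34t; they are off the ball, and
    -- 16² + 34² ≤ 48² places them in the disc.
    half-side : Σ< n (λ j → u 1 (suc j) * on (2 * suc j ≤? suc n) 1) ≤ t * (t⁶ * spreadFactor C)
    half-side = begin
      Σ< n (λ j → u 1 (suc j) * on (2 * suc j ≤? suc n) 1)
        ≤⟨ Σ<-mono n (λ {j} _ → *-monoʳ-≤ (u 1 (suc j)) (on-mono (2 * suc j ≤? suc n) (lowerLeft? 1 (suc j)) {1} {1} (λ 2y≤m → (refl , 2y≤m) , ≤-refl))) ⟩
      Σ< n (λ j → u 1 (suc j) * on (lowerLeft? 1 (suc j)) 1)
        ≤⟨ row≤ΣΣ n (λ x y → u x y * on (lowerLeft? x y) 1) 0<n ⟩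
      ΣΣ n (λ x y → u x y * on (lowerLeft? x y) 1)
        ≤⟨ spread (λ x y → on (lowerLeft? x y) 1) supported ⟩
      _
        ≤⟨ spreadBound mass≤ ⟩
      t * (t⁶ * spreadFactor C) ∎
      where
      open ≤-Reasoning
      lowerLeft? : ∀ x y → Dec (x ≡ 1 × 2 * y ≤ suc n)
      lowerLeft? x y = (x ≟ 1) ×-dec (2 * y ≤? suc n)
      0<n : 0 < n
      0<n = s≤s⁻¹ (≤-trans (*-mono-≤ {2} {t} {1} (≤-trans (toWitness {a? = 2 ≤? 16} _) 16≤t) (s≤s z≤n)) 64t≤m)
      supported : ∀ {i j} → i < n → j < n → on (lowerLeft? (suc i) (suc j)) 1 ≡ 0 ⊎ (Region (suc i) (suc j) × on (lowerLeft? (suc i) (suc j)) 1 ≤ suc i + suc j)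
      supported {i} {j} i<n j<n with lowerLeft? (suc i) (suc j)
      ... | no _ = inj₁ refl
      ... | yes (refl , 2y≤m) = inj₂ (inRegion {1} {suc j} 16 34 (toWitness {a? = 16 * 16 + 34 * 34 ≤? 48 * 48} _)
              (distance≤ (≤-trans 1≤t (m≤m*n t 16)) ≤-refl) (distance≤ y≤34t (*-monoʳ-≤ t (toWitness {a? = 16 ≤? 34} _))) outside , s≤s z≤n)
        where
        y≤34t : suc j ≤ t * 34
        y≤34t = *-cancelˡ-≤ 2 (≤-trans 2y≤m (≤-trans m≤68t (≤-reflexive (lem t))))
          where
          lem : ∀ t → t * 68 ≡ 2 * (t * 34)
          lem = solve-∀
        outside : t * 4 < ∣ 1 - 16t ∣
        outside = s≤s⁻¹ (≤-trans (≤-trans (≤-reflexive (+-comm 2 (t * 4))) (≤-trans (+-monoʳ-≤ (t * 4) (≤-trans (toWitness {a? = 2 ≤? 16} _) 16≤t)) (≤-by (t * 11) (lem t)))) (m≤n+∣n-m∣ 16t 1))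
          where
          lem : ∀ t → t * 4 + t + t * 11 ≡ t * 16
          lem = solve-∀

  module _ {P} (2048≤P : 2048 ≤ P) where

    -- On `Near` the zero of u is at most 62 + 62 steps away, so Harnack's inequality bounds u there
    -- by 4 ^ P, whatever n is.
    mass-cornered : ∀ {u} → Odometer n u → ∀ {a b} → a < n → b < n → u (suc a) (suc b) ≡ 0 →
      2 * suc a ≤ suc n → 2 * suc b ≤ suc n → ballMass n t u ≤ t⁶ * C₀ P
    mass-cornered {u} O {a} {b} a<n b<n zero-at 2a≤m 2b≤m = ≤-trans
      (Concentrated.concentrated O 1≤t 64t≤m m≤68t a b 2a≤m 2b≤m {4 ^ P} λ {i} {j} i<n j<n (p , q) →
        ≤-trans (n≤1+n _) (≤-trans (Harnack.harnack O a<n b<n zero-at i<n j<n)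
          (^-monoʳ-≤ 4 (≤-trans (+-mono-≤ p q) (≤-trans (toWitness {a? = 62 + 62 ≤? 2048} _) 2048≤P)))))
      (≤-trans (+-monoʳ-≤ (t⁶ * ((4 ^ P * 16972 + 3) * 3264 * (1025 * 1025 * 1025))) t²≤)
        (≤-reflexive (sym (*-distribˡ-+ t⁶ ((4 ^ P * 16972 + 3) * 3264 * (1025 * 1025 * 1025)) (68 * 68 * 4 ^ P)))))
      where
      t²≤ : t * 68 * (t * 68 * 4 ^ P) ≤ t⁶ * (68 * 68 * 4 ^ P)
      t²≤ = ≤-trans (≤-reflexive (regroup t 68 (4 ^ P))) (*-monoˡ-≤ (68 * 68 * 4 ^ P)
              (≤-trans (m≤m*n (t * t) (t * t * (t * t)) {{m*n≢0 (t * t) (t * t) {{m*n≢0 t t}} {{m*n≢0 t t}}}}) (≤-reflexive (lem t))))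
        where
        regroup : ∀ t k M → t * k * (t * k * M) ≡ t * t * (k * k * M)
        regroup = solve-∀
        lem : ∀ t → t * t * (t * t * (t * t)) ≡ t * t * t * (t * t * t)
        lem = solve-∀

    private
      beyond : ∀ {a} → a < n → ¬ (2 * suc a ≤ suc n) → 2 * suc (n ∸ suc a) ≤ suc n
      beyond {a} a<n 2a≰m = +-cancelʳ-≤ (2 * suc a) _ _ (begin
        2 * suc (n ∸ suc a) + 2 * suc a     ≡⟨ *-distribˡ-+ 2 (suc (n ∸ suc a)) (suc a) ⟨
        2 * suc (n ∸ suc a + suc a)         ≡⟨ cong (λ k → 2 * suc k) (m∸n+n≡m a<n) ⟩
        2 * suc n                           ≡⟨ cong (suc n +_) (+-identityʳ (suc n)) ⟩
        suc n + suc n                       ≤⟨ +-monoʳ-≤ (suc n) (≰⇒≥ 2a≰m) ⟩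
        suc n + 2 * suc a ∎)
        where open ≤-Reasoning

      reflectˣ-involutive : ∀ u → ballMass n t u ≤ ballMass n t (reflectˣ n (reflectˣ n u))
      reflectˣ-involutive u = ≤-reflexive (ΣΣ-cong n λ {i} {j} i<n _ → cong (λ x → u x (suc j) * on (ball? t (suc i) (suc j)) 1) (sym (m∸[m∸n]≡n (m≤n⇒m≤1+n i<n))))

    -- If the zero lies in the far half, the mirrored odometer has its zero in the near half. Its
    -- mass bound is transported to u, the mirror image of that mirror image, at the cost of one
    -- `spreadFactor`.
    mass-half : ∀ {u} → Odometer n u → ∀ {a b} → a < n → b < n → u (suc a) (suc b) ≡ 0 →
      2 * suc b ≤ suc n → ballMass n t u ≤ t⁶ * C₁ P
    mass-half {u} O {a} {b} a<n b<n zero-at 2b≤m with 2 * suc a ≤? suc n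
    ... | yes 2a≤m = ≤-trans (mass-cornered O a<n b<n zero-at 2a≤m 2b≤m) (*-monoʳ-≤ t⁶ (C≤spreadFactor (C₀ P)))
    ... | no 2a≰m  = ≤-trans (reflectˣ-involutive u) (mass-of-reflection O′
            (mass-cornered O′ (∸-suc< n a<n) b<n (trans (cong (λ x → u x (suc b)) (m∸[m∸n]≡n a<n)) zero-at) (beyond a<n 2a≰m) 2b≤m))
      where
      O′ = reflectˣ-odometer n O

    -- The same argument in the other coordinate, conjugated by `flip` so that the horizontal
    -- transport `mass-of-reflection` applies again.
    mass : ∀ {u} → Odometer n u → ∀ {a b} → a < n → b < n → u (suc a) (suc b) ≡ 0 → ballMass n t u ≤ t⁶ * C₂ P
    mass {u} O {a} {b} a<n b<n zero-at with 2 * suc b ≤? suc n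
    ... | yes 2b≤m = ≤-trans (mass-half O a<n b<n zero-at 2b≤m) (*-monoʳ-≤ t⁶ (C≤spreadFactor (C₁ P)))
    ... | no 2b≰m  = ≤-trans (ballMass-flip n t u) (≤-trans (reflectˣ-involutive (flip u))
            (mass-of-reflection (reflectˣ-odometer n (flip-odometer n O)) (≤-trans (ballMass-flip n t (reflectˣ n (flip u)))
              (mass-half (reflectʸ-odometer n O) a<n (∸-suc< n b<n) (trans (cong (u (suc a)) (m∸[m∸n]≡n b<n)) zero-at) (beyond b<n 2b≰m)))))

    side : ∀ {u} → Odometer n u → ∀ {a b} → a < n → b < n → u (suc a) (suc b) ≡ 0 →
      Σ< n (λ j → u 1 (suc j)) ≤ t * (t⁶ * C₃ P) + t * (t⁶ * C₃ P)
    side {u} O {a} {b} a<n b<n zero-at = begin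
      Σ< n (λ j → u 1 (suc j))
        ≤⟨ Σ<-mono n covered ⟩
      Σ< n (λ j → u 1 (suc j) * on (2 * suc j ≤? suc n) 1 + u 1 (suc j) * on (2 * (n ∸ j) ≤? suc n) 1)
        ≡⟨ Σ<-+ n _ _ ⟩
      Σ< n (λ j → u 1 (suc j) * on (2 * suc j ≤? suc n) 1) + Σ< n (λ j → u 1 (suc j) * on (2 * (n ∸ j) ≤? suc n) 1)
        ≡⟨ cong (Σ< n (λ j → u 1 (suc j) * on (2 * suc j ≤? suc n) 1) +_) reversed ⟨
      Σ< n (λ j → u 1 (suc j) * on (2 * suc j ≤? suc n) 1) + Σ< n (λ j → reflectʸ n u 1 (suc j) * on (2 * suc j ≤? suc n) 1)
        ≤⟨ +-mono-≤ (half-side O (mass O a<n b<n zero-at))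
             (half-side (reflectʸ-odometer n O) (mass (reflectʸ-odometer n O) a<n (∸-suc< n b<n) (trans (cong (u (suc a)) (m∸[m∸n]≡n b<n)) zero-at))) ⟩
      t * (t⁶ * C₃ P) + t * (t⁶ * C₃ P) ∎
      where
      open ≤-Reasoning
      -- The two positions j + 1 and n - j add up to n + 1, so at least one of them lies in the
      -- lower half.
      covered : ∀ {j} → j < n → u 1 (suc j) ≤ u 1 (suc j) * on (2 * suc j ≤? suc n) 1 + u 1 (suc j) * on (2 * (n ∸ j) ≤? suc n) 1
      covered {j} j<n with 2 * suc j ≤? suc n | 2 * (n ∸ j) ≤? suc n
      ... | yes _ | _     = ≤-trans (≤-reflexive (sym (*-identityʳ _))) (m≤m+n _ _)
      ... | no _  | yes _ = ≤-trans (≤-reflexive (sym (*-identityʳ _))) (m≤n+m _ (u 1 (suc j) * 0))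
      ... | no p  | no q  with () ← <⇒≱ (+-mono-< (≰⇒> p) (≰⇒> q)) (≤-trans (≤-reflexive (sym (*-distribˡ-+ 2 (suc j) (n ∸ j)))) (≤-reflexive (trans (cong (λ k → 2 * suc k) (m+[n∸m]≡n (<⇒≤ j<n))) (cong (suc n +_) (+-identityʳ (suc n))))))
      reversed : Σ< n (λ j → reflectʸ n u 1 (suc j) * on (2 * suc j ≤? suc n) 1) ≡ Σ< n (λ j → u 1 (suc j) * on (2 * (n ∸ j) ≤? suc n) 1)
      reversed = trans (Σ<-cong n λ {j} j<n → cong₂ (λ y k → u 1 y * on (2 * k ≤? suc n) 1) (∸-suc n j<n) (sym (m∸[m∸n]≡n j<n))) (Σ<-reverse n _)

-- Opaque, so that the type checker never evaluates 4 ^ 2048.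
opaque
  exponent : ℕ
  exponent = 2048

  2048≤exponent : 2048 ≤ exponent
  2048≤exponent = ≤-refl


-- Sides and boundary, for all n

sideConstant : ℕ
sideConstant = C₃ exponent * 2 + 4 ^ exponent

module _ {n} {u : ℕ → ℕ → ℕ} (O : Odometer n u) {a b} (a<n : a < n) (b<n : b < n) (zero-at : u (suc a) (suc b) ≡ 0) where

  private
    t = suc n / 64

    m≡ : suc n ≡ suc n % 64 + t * 64
    m≡ = m≡m%n+[m/n]*n (suc n) 64

    r≤64 : suc n % 64 ≤ 64
    r≤64 = <⇒≤ (m%n<n (suc n) 64)

    64t≤m : t * 64 ≤ suc n
    64t≤m = ≤-trans (m≤n+m (t * 64) (suc n % 64)) (≤-reflexive (sym m≡))

    t≤m : t ≤ suc n
    t≤m = ≤-trans (m≤m*n t 64) 64t≤m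

    large : 16 ≤ t → Σ< n (λ j → u 1 (suc j)) ≤ suc n ^ 7 * (C₃ exponent * 2)
    large 16≤t = ≤-trans (Geometry.side 16≤t 64t≤m m≤68t 2048≤exponent O a<n b<n zero-at)
      (≤-trans (≤-reflexive (regroup t (C₃ exponent))) (*-monoˡ-≤ (C₃ exponent * 2) (^-monoˡ-≤ 7 t≤m)))
      where
      -- The remainder modulo 64 is at most 64, hence at most 4t exactly when t ≥ 16; this sets the
      -- threshold between the two regimes.
      m≤68t : suc n ≤ t * 68
      m≤68t = ≤-trans (≤-reflexive m≡) (≤-trans (+-monoˡ-≤ (t * 64) (≤-trans r≤64 (*-monoˡ-≤ 4 16≤t))) (≤-reflexive (lem t)))
        where
        lem : ∀ t → t * 4 + t * 64 ≡ t * 68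
        lem = solve-∀
      regroup : ∀ t C → t * (t * t * t * (t * t * t) * C) + t * (t * t * t * (t * t * t) * C) ≡ t * (t * (t * (t * (t * (t * (t * 1)))))) * (C * 2)
      regroup = solve-∀

    small : t < 16 → Σ< n (λ j → u 1 (suc j)) ≤ suc n ^ 7 * 4 ^ exponent
    small t<16 = begin
      Σ< n (λ j → u 1 (suc j))        ≤⟨ Σ<-mono n (λ j<n → ≤-trans (n≤1+n _) (≤-trans (Harnack.harnack O a<n b<n zero-at (≤-trans z<s a<n) j<n) (^-monoʳ-≤ 4 (≤-trans (+-mono-≤ (distance≤ z≤n (<⇒≤ a<n)) (distance≤ (<⇒≤ j<n) (<⇒≤ b<n))) 2n≤)))) ⟩
      Σ< n (λ j → 4 ^ exponent)       ≡⟨ Σ<-const n (4 ^ exponent) ⟩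
      n * 4 ^ exponent                ≤⟨ *-monoˡ-≤ (4 ^ exponent) (≤-trans (n≤1+n n) (≤-trans (≤-reflexive (sym (^-identityʳ (suc n)))) (^-monoʳ-≤ (suc n) (s≤s {0} {6} z≤n)))) ⟩
      suc n ^ 7 * 4 ^ exponent        ∎
      where
      open ≤-Reasoning
      -- For t ≤ 15 the side is at most 64 + 15 · 64 = 1024, and two points are at most 2 · 1024 =
      -- 2048 steps apart; hence the value of `exponent`.
      n≤1024 : n ≤ 1024
      n≤1024 = ≤-trans (n≤1+n n) (≤-trans (≤-reflexive m≡) (+-mono-≤ r≤64 (*-monoˡ-≤ 64 (s≤s⁻¹ t<16))))
      2n≤ : n + n ≤ exponent
      2n≤ = ≤-trans (+-mono-≤ n≤1024 n≤1024) 2048≤exponent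

  side-bound : Σ< n (λ j → u 1 (suc j)) ≤ suc n ^ 7 * sideConstant
  side-bound with 16 ≤? t
  ... | yes 16≤t = ≤-trans (large 16≤t) (*-monoʳ-≤ (suc n ^ 7) (m≤m+n _ _))
  ... | no 16≰t  = ≤-trans (small (≰⇒> 16≰t)) (*-monoʳ-≤ (suc n ^ 7) (m≤n+m _ (C₃ exponent * 2)))

-- A corner is counted once for each side that it lies on, matching its edges to the sink.
boundarySum : ℕ → (ℕ → ℕ → ℕ) → ℕ
boundarySum n u = Σ< n (λ j → u 1 (suc j)) + Σ< n (λ j → u n (suc j)) + Σ< n (λ i → u (suc i) 1) + Σ< n (λ i → u (suc i) n)

boundary-bound : ∀ {n u} → Odometer n u → ∀ {a b} → a < n → b < n → u (suc a) (suc b) ≡ 0 →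
                 boundarySum n u ≤ suc n ^ 7 * (sideConstant * 4)
boundary-bound {n} {u} O {a} {b} a<n b<n zero-at = ≤-trans
  (+-mono-≤ (+-mono-≤ (+-mono-≤
    (side-bound O a<n b<n zero-at)
    (side-bound (reflectˣ-odometer n O) (∸-suc< n a<n) b<n (trans (cong (λ x → u x (suc b)) (m∸[m∸n]≡n a<n)) zero-at)))
    (side-bound (flip-odometer n O) b<n a<n zero-at))
    (side-bound (reflectˣ-odometer n (flip-odometer n O)) (∸-suc< n b<n) a<n (trans (cong (u (suc a)) (m∸[m∸n]≡n b<n)) zero-at)))
  (≤-reflexive (lem (suc n ^ 7) sideConstant))
  where
  lem : ∀ s c → s * c + s * c + s * c + s * c ≡ s * (c * 4)
  lem = solve-∀

-- Sums over lists

Σ[_] : ∀ {A : Set} → List A → (A → ℕ) → ℕ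
Σ[ xs ] f = sum (map f xs)

module _ {A : Set} where

  Σ-cong : ∀ (xs : List A) {f g : A → ℕ} → (∀ x → f x ≡ g x) → Σ[ xs ] f ≡ Σ[ xs ] g
  Σ-cong []       h = refl
  Σ-cong (x ∷ xs) h = cong₂ _+_ (h x) (Σ-cong xs h)

  Σ-mono : ∀ (xs : List A) {f g : A → ℕ} → (∀ x → f x ≤ g x) → Σ[ xs ] f ≤ Σ[ xs ] g
  Σ-mono []       h = z≤n
  Σ-mono (x ∷ xs) h = +-mono-≤ (h x) (Σ-mono xs h)

  Σ-+ : ∀ (xs : List A) (f g : A → ℕ) → Σ[ xs ] (λ x → f x + g x) ≡ Σ[ xs ] f + Σ[ xs ] g
  Σ-+ []       f g = refl
  Σ-+ (x ∷ xs) f g = trans (cong (f x + g x +_) (Σ-+ xs f g)) (+-interchange (f x) (g x) _ _)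

  Σ-*ˡ : ∀ (xs : List A) k (f : A → ℕ) → Σ[ xs ] (λ x → k * f x) ≡ k * Σ[ xs ] f
  Σ-*ˡ []       k f = sym (*-zeroʳ k)
  Σ-*ˡ (x ∷ xs) k f = trans (cong (k * f x +_) (Σ-*ˡ xs k f)) (sym (*-distribˡ-+ k (f x) _))

  Σ-0 : ∀ (xs : List A) → Σ[ xs ] (λ _ → 0) ≡ 0
  Σ-0 []       = refl
  Σ-0 (x ∷ xs) = Σ-0 xs

Σ-swap : ∀ {A B : Set} (xs : List A) (ys : List B) (f : A → B → ℕ) →
         Σ[ xs ] (λ x → Σ[ ys ] (f x)) ≡ Σ[ ys ] (λ y → Σ[ xs ] (λ x → f x y))
Σ-swap []       ys f = sym (Σ-0 ys)
Σ-swap (x ∷ xs) ys f = trans (cong (Σ[ ys ] (f x) +_) (Σ-swap xs ys f)) (sym (Σ-+ ys (f x) _))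

Σ-cartesianProduct : ∀ {A B : Set} (xs : List A) (ys : List B) (f : A × B → ℕ) →
                     Σ[ cartesianProduct xs ys ] f ≡ Σ[ xs ] (λ x → Σ[ ys ] (λ y → f (x , y)))
Σ-cartesianProduct []       ys f = refl
Σ-cartesianProduct (x ∷ xs) ys f = trans (cong sum (map-++ f (map (x ,_) ys) _))
  (trans (sum-++ (map f (map (x ,_) ys)) _) (cong₂ _+_ (cong sum (sym (map-∘ ys))) (Σ-cartesianProduct xs ys f)))

-- Toppling invariants of a sandpile

bit : Bool → ℕ
bit true  = 1
bit false = 0

indicator : ∀ {A : Set} → Dec A → ℕ
indicator (yes _) = 1
indicator (no _)  = 0

-- The parameter `select` is the form in which "each vertex is listed exactly once" enters; `search`
-- is the finiteness of V.
module Dynamics (S : Sandpile)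
  (select : ∀ v (f : Sandpile.V S → ℕ) → Σ[ Sandpile.verts S ] (λ w → indicator (Sandpile._≟V_ S w v) * f w) ≡ f v)
  (search : ∀ (F : Sandpile.V S → Bool) → (∃ λ v → F v ≡ true) ⊎ (∀ v → F v ≡ false))
  where

  open Sandpile S

  δ : V → V → ℕ
  δ w v = indicator (w ≟V v)

  δ-refl : ∀ v → δ v v ≡ 1
  δ-refl v with v ≟V v
  ... | yes _  = refl
  ... | no v≢v with () ← v≢v refl

  δ-≢ : ∀ {w v} → w ≢ v → δ w v ≡ 0
  δ-≢ {w} {v} w≢v with w ≟V v
  ... | yes w≡v with () ← w≢v w≡v
  ... | no _    = refl

  δ-*-deg : ∀ w v → δ w v * deg w ≡ δ w v * deg v
  δ-*-deg w v with w ≟V v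
  ... | yes refl = refl
  ... | no _     = refl

  add≡ : ∀ x c v → add x c v ≡ c v + δ v x
  add≡ x c v with v ≟V x
  ... | yes _ = +-comm 1 (c v)
  ... | no _  = sym (+-identityʳ (c v))

  topple≡ : ∀ x c → deg x ≤ c x → ∀ v → topple x c v + δ v x * deg x ≡ c v + mult x v
  topple≡ x c d≤c v with v ≟V x
  ... | yes refl = trans (cong (c x + mult x x ∸ deg x +_) (+-identityʳ (deg x))) (m∸n+n≡m (≤-trans d≤c (m≤m+n (c x) (mult x x))))
  ... | no _     = +-identityʳ _

  Σδ : ∀ v k → Σ[ verts ] (λ w → δ w v * k) ≡ k
  Σδ v k = select v (λ _ → k)

  Σδ1 : ∀ v → Σ[ verts ] (λ w → δ w v) ≡ 1
  Σδ1 v = trans (Σ-cong verts (λ w → sym (*-identityʳ (δ w v)))) (Σδ v 1)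

  remove : V → (V → Bool) → V → Bool
  remove x F w = F w ∧ not (does (w ≟V x))

  bit-remove : ∀ x F → F x ≡ true → ∀ w → bit (F w) ≡ bit (remove x F w) + δ w x
  bit-remove x F Fx w with w ≟V x
  ... | yes refl rewrite Fx = refl
  ... | no _ rewrite Bool.∧-identityʳ (F w) = sym (+-identityʳ _)

  remove⊆ : ∀ x F w → remove x F w ≡ true → F w ≡ true × w ≢ x
  remove⊆ x F w eq with F w | w ≟V x
  ... | true | no w≢x = refl , w≢x

  inflow : (V → Bool) → V → ℕ
  inflow F v = Σ[ verts ] (λ w → bit (F w) * mult w v)

  inflow-remove : ∀ x F → F x ≡ true → ∀ v → inflow F v ≡ inflow (remove x F) v + mult x v
  inflow-remove x F Fx v = begin
    Σ[ verts ] (λ w → bit (F w) * mult w v)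
      ≡⟨ Σ-cong verts (λ w → trans (cong (_* mult w v) (bit-remove x F Fx w)) (*-distribʳ-+ (mult w v) (bit (remove x F w)) (δ w x))) ⟩
    Σ[ verts ] (λ w → bit (remove x F w) * mult w v + δ w x * mult w v)
      ≡⟨ Σ-+ verts _ _ ⟩
    inflow (remove x F) v + Σ[ verts ] (λ w → δ w x * mult w v)
      ≡⟨ cong (inflow (remove x F) v +_) (select x (λ w → mult w v)) ⟩
    inflow (remove x F) v + mult x v ∎
    where open ≡-Reasoning

  inflow-empty : ∀ F → (∀ w → F w ≡ false) → ∀ v → inflow F v ≡ 0
  inflow-empty F empty v = trans (Σ-cong verts (λ w → cong (λ b → bit b * mult w v) (empty w))) (Σ-0 verts)

  -- No forbidden subconfiguration: within F some vertex holds at least as many particles as it has neighbours in F.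
  Ample : Config → (V → Bool) → Set
  Ample c F = ∃ λ v → F v ≡ true × inflow F v ≤ c v

  -- Here u counts topplings and j counts added particles. The additions at a single vertex are not
  -- recorded, so `balance` is an inequality. Being restricted to sets of toppled vertices, `ample`
  -- is vacuous at the start and becomes the burning criterion once u is positive everywhere.
  record Inv (c u : Config) (j : ℕ) : Set where
    field
      particles : Σ[ verts ] c + Σ[ verts ] (λ v → sinkMult v * u v) ≡ j
      balance   : ∀ v → Σ[ verts ] (λ w → mult w v * u w) ≤ c v + deg v * u v
      ample     : ∀ F → (∃ λ v → F v ≡ true) → (∀ v → F v ≡ true → 1 ≤ u v) → Ample c F

  inv-empty : Inv empty empty 0
  inv-empty = record
    { particles = cong₂ _+_ (Σ-0 verts) (trans (Σ-cong verts (λ v → *-zeroʳ (sinkMult v))) (Σ-0 verts))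
    ; balance   = λ v → ≤-trans (≤-reflexive (trans (Σ-cong verts (λ w → *-zeroʳ (mult w v))) (Σ-0 verts))) z≤n
    ; ample     = λ F (v , Fv) toppled → ⊥-elim (1+n≰n (toppled v Fv))
    }

  inv-add : ∀ {c u j} x → Inv c u j → Inv (add x c) u (suc j)
  inv-add {c} {u} {j} x I = record
    { particles = trans (cong (_+ Σ[ verts ] (λ v → sinkMult v * u v)) (trans (Σ-cong verts (add≡ x c)) (trans (Σ-+ verts c _) (trans (cong (Σ[ verts ] c +_) (Σδ1 x)) (+-comm _ 1)))))
                    (cong suc (particles))
    ; balance   = λ v → ≤-trans (balance v) (+-monoˡ-≤ _ (c≤ v))
    ; ample     = λ F nonempty toppled → let v , Fv , ≤c = ample F nonempty toppled in v , Fv , ≤-trans ≤c (c≤ v)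
    }
    where
    open Inv I
    c≤ : ∀ v → c v ≤ add x c v
    c≤ v = ≤-trans (m≤m+n (c v) (δ v x)) (≤-reflexive (sym (add≡ x c v)))

  module _ {c u : Config} {j} {c′ : Config} {x} (I : Inv c u j) (unstable : deg x ≤ c x) (c′≡ : ∀ v → c′ v ≡ topple x c v) where
    private
      open Inv I

      u′ : Config
      u′ v = u v + δ v x

      c′+ : ∀ v → c′ v + δ v x * deg x ≡ c v + mult x v
      c′+ v = trans (cong (_+ δ v x * deg x) (c′≡ v)) (topple≡ x c unstable v)

      off : ∀ {v} → v ≢ x → c′ v ≡ c v + mult x v
      off {v} v≢x = trans (sym (trans (cong (λ k → c′ v + k * deg x) (δ-≢ v≢x)) (+-identityʳ (c′ v)))) (c′+ v)

      particles′ : Σ[ verts ] c′ + Σ[ verts ] (λ v → sinkMult v * u′ v) ≡ j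
      particles′ = +-cancelʳ-≡ (Σ[ verts ] (mult x)) _ _ (begin
        Σ[ verts ] c′ + Σ[ verts ] (λ v → sinkMult v * u′ v) + Σ[ verts ] (mult x)
          ≡⟨ cong (λ k → Σ[ verts ] c′ + k + Σ[ verts ] (mult x)) Σsink ⟩
        Σ[ verts ] c′ + (Σ[ verts ] (λ v → sinkMult v * u v) + sinkMult x) + Σ[ verts ] (mult x)
          ≡⟨ regroup (Σ[ verts ] c′) _ (sinkMult x) (Σ[ verts ] (mult x)) ⟩
        Σ[ verts ] c′ + deg x + Σ[ verts ] (λ v → sinkMult v * u v)
          ≡⟨ cong (_+ Σ[ verts ] (λ v → sinkMult v * u v)) Σc′ ⟩
        Σ[ verts ] c + Σ[ verts ] (mult x) + Σ[ verts ] (λ v → sinkMult v * u v)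
          ≡⟨ regroup′ (Σ[ verts ] c) (Σ[ verts ] (mult x)) _ ⟩
        Σ[ verts ] c + Σ[ verts ] (λ v → sinkMult v * u v) + Σ[ verts ] (mult x)
          ≡⟨ cong (_+ Σ[ verts ] (mult x)) particles ⟩
        j + Σ[ verts ] (mult x) ∎)
        where
        open ≡-Reasoning
        regroup : ∀ a b s m → a + (b + s) + m ≡ a + (m + s) + b
        regroup = solve-∀
        regroup′ : ∀ a m b → a + m + b ≡ a + b + m
        regroup′ = solve-∀
        Σsink : Σ[ verts ] (λ v → sinkMult v * u′ v) ≡ Σ[ verts ] (λ v → sinkMult v * u v) + sinkMult x
        Σsink = trans (Σ-cong verts (λ v → trans (*-distribˡ-+ (sinkMult v) (u v) (δ v x)) (cong (sinkMult v * u v +_) (*-comm (sinkMult v) (δ v x)))))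
                  (trans (Σ-+ verts _ _) (cong (Σ[ verts ] (λ v → sinkMult v * u v) +_) (select x sinkMult)))
        Σc′ : Σ[ verts ] c′ + deg x ≡ Σ[ verts ] c + Σ[ verts ] (mult x)
        Σc′ = trans (cong (Σ[ verts ] c′ +_) (sym (Σδ x (deg x))))
                (trans (sym (Σ-+ verts _ _)) (trans (Σ-cong verts c′+) (Σ-+ verts _ _)))

      balance′ : ∀ v → Σ[ verts ] (λ w → mult w v * u′ w) ≤ c′ v + deg v * u′ v
      balance′ v = begin
        Σ[ verts ] (λ w → mult w v * u′ w)
          ≡⟨ Σ-cong verts (λ w → trans (*-distribˡ-+ (mult w v) (u w) (δ w x)) (cong (mult w v * u w +_) (*-comm (mult w v) (δ w x)))) ⟩
        Σ[ verts ] (λ w → mult w v * u w + δ w x * mult w v)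
          ≡⟨ trans (Σ-+ verts _ _) (cong (Σ[ verts ] (λ w → mult w v * u w) +_) (select x (λ w → mult w v))) ⟩
        Σ[ verts ] (λ w → mult w v * u w) + mult x v
          ≤⟨ +-monoˡ-≤ (mult x v) (balance v) ⟩
        c v + deg v * u v + mult x v
          ≡⟨ regroup (c v) (deg v * u v) (mult x v) ⟩
        c v + mult x v + deg v * u v
          ≡⟨ cong (_+ deg v * u v) (trans (sym (c′+ v)) (cong (c′ v +_) (sym (δ-*-deg v x)))) ⟩
        c′ v + δ v x * deg v + deg v * u v
          ≡⟨ regroup′ (c′ v) (δ v x) (deg v) (u v) ⟩
        c′ v + deg v * u′ v ∎
        where
        open ≤-Reasoning
        regroup : ∀ a b s → a + b + s ≡ a + s + b
        regroup = solve-∀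
        regroup′ : ∀ c δ d u → c + δ * d + d * u ≡ c + d * (u + δ)
        regroup′ = solve-∀

      F-≢x : ∀ (F : V → Bool) → F x ≡ false → ∀ {v} → F v ≡ true → v ≢ x
      F-≢x F Fx Fv refl with () ← trans (sym Fv) Fx

      -- The order of topplings need not be stored. The vertex x toppling now is the latest one, and
      -- the remaining vertices of F had all toppled before; an ample vertex for them receives from
      -- x as many particles as x adds to its inflow.
      ample′ : ∀ F → (∃ λ v → F v ≡ true) → (∀ v → F v ≡ true → 1 ≤ u′ v) → Ample c′ F
      ample′ F nonempty toppled with F x in Fx
      ... | false with v , Fv , ≤c ← ample F nonempty (λ v Fv → subst (1 ≤_) (trans (cong (u v +_) (δ-≢ (F-≢x F Fx Fv))) (+-identityʳ _)) (toppled v Fv))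
        = v , Fv , ≤-trans ≤c (≤-trans (m≤m+n (c v) (mult x v)) (≤-reflexive (sym (off (F-≢x F Fx Fv)))))
      ... | true with search (remove x F)
      -- Here F is just x. Since x was unstable, it still holds the particles that it sends to
      -- itself.
      ...   | inj₂ none = x , Fx , (begin
        inflow F x                                 ≡⟨ inflow-remove x F Fx x ⟩
        inflow (remove x F) x + mult x x           ≡⟨ cong (_+ mult x x) (inflow-empty (remove x F) none x) ⟩
        mult x x                                   ≤⟨ +-cancelʳ-≤ (deg x) _ _ (≤-trans (≤-trans (+-monoʳ-≤ (mult x x) unstable) (≤-reflexive (+-comm (mult x x) (c x)))) (≤-reflexive (trans (sym (c′+ x)) (cong (c′ x +_) (trans (cong (_* deg x) (δ-refl x)) (+-identityʳ _)))))) ⟩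
        c′ x ∎)
        where open ≤-Reasoning
      ...   | inj₁ some with v , F′v , ≤c ← ample (remove x F) some (λ v F′v → let Fv , v≢x = remove⊆ x F v F′v in
                                subst (1 ≤_) (trans (cong (u v +_) (δ-≢ v≢x)) (+-identityʳ _)) (toppled v Fv))
        = let Fv , v≢x = remove⊆ x F v F′v in v , Fv ,
          ≤-trans (≤-reflexive (inflow-remove x F Fx v)) (≤-trans (+-monoˡ-≤ (mult x v) ≤c) (≤-reflexive (sym (off v≢x))))

    inv-topple : ∃ λ u′ → Inv c′ u′ j
    inv-topple = u′ , record { particles = particles′ ; balance = balance′ ; ample = ample′ }

  inv-relax : ∀ {c c′ u j} → Inv c u j → Star TopStep c c′ → ∃ λ u′ → Inv c′ u′ j
  inv-relax I ε = _ , I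
  inv-relax I ((x , unstable , eq) ◅ steps) = inv-relax (proj₂ (inv-topple I unstable eq)) steps

  -- Configurations are functions, so reachability is stated up to pointwise equality.
  infix 4 _⇝_
  _⇝_ : Config → Config → Set
  A ⇝ E = ∃ λ E′ → Star TopStep A E′ × (∀ v → E′ v ≡ E v)

  step-cong : ∀ {A A′ B} → (∀ v → A′ v ≡ A v) → TopStep A B → TopStep A′ B
  step-cong {A} {A′} eq (x , unstable , B≡) = x , subst (deg x ≤_) (sym (eq x)) unstable , λ v → trans (B≡ v) (topple-cong v)
    where
    topple-cong : ∀ v → topple x A v ≡ topple x A′ v
    topple-cong v with v ≟V x
    ... | yes _ = cong (λ k → k + mult x v ∸ deg x) (sym (eq v))
    ... | no _  = cong (_+ mult x v) (sym (eq v))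

  ⇝-trans : ∀ {A B C} → A ⇝ B → B ⇝ C → A ⇝ C
  ⇝-trans (B′ , A⇒B′ , B′≡B) (_ , ε , B≡C)         = B′ , A⇒B′ , λ v → trans (B′≡B v) (B≡C v)
  ⇝-trans (B′ , A⇒B′ , B′≡B) (C′ , s ◅ ss , C′≡C) = C′ , A⇒B′ ◅◅ (step-cong B′≡B s ◅ ss) , C′≡C

  -- `TopStep` determines its target only pointwise, so the last step of a nonempty sequence may be
  -- redirected to any pointwise equal configuration. An empty sequence has no such freedom, whence
  -- the third hypothesis of `⇝-exact`.
  retarget : ∀ {A B E′ E} → TopStep A B → Star TopStep B E′ → (∀ v → E′ v ≡ E v) → Star TopStep A E
  retarget (x , unstable , B≡) ε         eq = (x , unstable , λ v → trans (sym (eq v)) (B≡ v)) ◅ ε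
  retarget s                   (s′ ◅ ss) eq = s ◅ retarget s′ ss eq

  ⇝-exact : ∀ {A A′ E} → A ⇝ E → (∀ v → A′ v ≡ A v) → ¬ (∀ v → A v ≡ E v) → Star TopStep A′ E
  ⇝-exact (_ , ε      , A≡E)  _  A≢E with () ← A≢E A≡E
  ⇝-exact (_ , s ◅ ss , E′≡E) eq _ = retarget (step-cong eq s) ss E′≡E

  -- Recurrence from the burning criterion

  module Recurrence
    {D} (deg≤D : ∀ v → deg v ≤ D)
    (Σmult≤deg : ∀ v → Σ[ verts ] (λ w → mult w v) ≤ deg v)
    (rank : V → ℕ) {R} (rank<R : ∀ v → rank v < R)
    -- With symmetric multiplicities this says that every vertex has an edge to the sink or to a
    -- vertex of lower rank.
    (descending : ∀ v → inflow (λ w → rank v ≤ᵇ rank w) v < deg v)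
    (origin : V)
    {c} (c-ample : ∀ F → (∃ λ v → F v ≡ true) → Ample c F) where

    inflow≤deg : ∀ F v → inflow F v ≤ deg v
    inflow≤deg F v = ≤-trans (Σ-mono verts bit-mult≤) (Σmult≤deg v)
      where
      bit-mult≤ : ∀ w → bit (F w) * mult w v ≤ mult w v
      bit-mult≤ w with F w
      ... | true  = ≤-reflexive (+-identityʳ _)
      ... | false = z≤n

    -- Every set F can be toppled once, each vertex exactly once, in an order given by `c-ample`.
    fire : ∀ k F A E → Σ[ verts ] (bit ∘ F) ≤ k → (∀ v → c v ≤ E v) →
           (∀ v → A v + inflow F v ≡ E v + bit (F v) * deg v) → A ⇝ E
    fire k F A E size c≤E eq with search F
    ... | inj₂ none = A , ε , λ v → trans (sym (+-identityʳ (A v))) (trans (cong (A v +_) (sym (inflow-empty F none v)))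
                        (trans (eq v) (trans (cong (λ b → E v + bit b * deg v) (none v)) (+-identityʳ (E v)))))
    ... | inj₁ some with x , Fx , ≤c ← c-ample F some = go k size
      where
      F′ = remove x F
      A′ = topple x A
      -- By `eq`, x holds E x + deg x - inflow F x, and ampleness of x gives inflow F x ≤ c x ≤ E x.
      unstable : deg x ≤ A x
      unstable = +-cancelʳ-≤ (inflow F x) _ _ (begin
        deg x + inflow F x         ≤⟨ +-monoʳ-≤ (deg x) (≤-trans ≤c (c≤E x)) ⟩
        deg x + E x                ≡⟨ +-comm (deg x) (E x) ⟩
        E x + deg x                ≡⟨ cong (E x +_) (trans (cong (λ b → bit b * deg x) Fx) (+-identityʳ (deg x))) ⟨
        E x + bit (F x) * deg x    ≡⟨ eq x ⟨
        A x + inflow F x           ∎)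
        where open ≤-Reasoning
      eq′ : ∀ v → A′ v + inflow F′ v ≡ E v + bit (F′ v) * deg v
      eq′ v = +-cancelʳ-≡ (δ v x * deg x) _ _ (begin
        A′ v + inflow F′ v + δ v x * deg x           ≡⟨ regroup (A′ v) (inflow F′ v) _ ⟩
        A′ v + δ v x * deg x + inflow F′ v           ≡⟨ cong (_+ inflow F′ v) (topple≡ x A unstable v) ⟩
        A v + mult x v + inflow F′ v                 ≡⟨ regroup′ (A v) (mult x v) (inflow F′ v) ⟩
        A v + (inflow F′ v + mult x v)               ≡⟨ cong (A v +_) (inflow-remove x F Fx v) ⟨
        A v + inflow F v                             ≡⟨ eq v ⟩
        E v + bit (F v) * deg v                      ≡⟨ cong (λ b → E v + b * deg v) (bit-remove x F Fx v) ⟩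
        E v + (bit (F′ v) + δ v x) * deg v           ≡⟨ cong (E v +_) (*-distribʳ-+ (deg v) (bit (F′ v)) (δ v x)) ⟩
        E v + (bit (F′ v) * deg v + δ v x * deg v)   ≡⟨ cong (λ k → E v + (bit (F′ v) * deg v + k)) (δ-*-deg v x) ⟩
        E v + (bit (F′ v) * deg v + δ v x * deg x)   ≡⟨ +-assoc (E v) _ _ ⟨
        E v + bit (F′ v) * deg v + δ v x * deg x     ∎)
        where
        open ≡-Reasoning
        regroup : ∀ a i d → a + i + d ≡ a + d + i
        regroup = solve-∀
        regroup′ : ∀ a m i → a + m + i ≡ a + (i + m)
        regroup′ = solve-∀
      sizes : Σ[ verts ] (bit ∘ F) ≡ Σ[ verts ] (bit ∘ F′) + 1
      sizes = trans (Σ-cong verts (bit-remove x F Fx)) (trans (Σ-+ verts _ _) (cong (Σ[ verts ] (bit ∘ F′) +_) (Σδ1 x)))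
      go : ∀ k → Σ[ verts ] (bit ∘ F) ≤ k → A ⇝ E
      go zero    size with () ← ≤-trans (≤-trans (m≤n+m 1 (Σ[ verts ] (bit ∘ F′))) (≤-reflexive (sym sizes))) size
      go (suc k) size with E′ , steps , E′≡E ← fire k F′ A′ E (s≤s⁻¹ (≤-trans (≤-reflexive (trans (+-comm 1 _) (sym sizes))) size)) c≤E eq′
        = E′ , (x , unstable , λ _ → refl) ◅ steps , E′≡E

    -- The last firing is split off, and E₁ is the configuration before it. It stays above c: on F
    -- because a firing takes out deg and returns at most that, off F because those vertices have
    -- only gained since A.
    fires : ∀ M F A E → (∀ v → c v ≤ A v) → (∀ v → c v ≤ E v) →
            (∀ v → A v + M * inflow F v ≡ E v + M * (bit (F v) * deg v)) → A ⇝ E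
    fires zero    F A E c≤A c≤E eq = A , ε , λ v → trans (sym (+-identityʳ (A v))) (trans (eq v) (+-identityʳ (E v)))
    fires (suc M) F A E c≤A c≤E eq = ⇝-trans (fires M F A E₁ c≤A c≤E₁ eq₁) (fire _ F E₁ E ≤-refl c≤E once)
      where
      E₁ : Config
      E₁ v = E v + bit (F v) * deg v ∸ inflow F v
      inflow≤ : ∀ v → inflow F v ≤ E v + bit (F v) * deg v
      inflow≤ v with F v | eq v
      ... | true  | _  = ≤-trans (inflow≤deg F v) (≤-trans (≤-reflexive (sym (+-identityʳ (deg v)))) (m≤n+m _ (E v)))
      ... | false | eq = ≤-trans (≤-trans (≤-trans (m≤m+n _ _) (m≤n+m _ (A v))) (≤-reflexive eq)) (+-monoʳ-≤ (E v) (≤-reflexive (*-zeroʳ (suc M))))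
      once : ∀ v → E₁ v + inflow F v ≡ E v + bit (F v) * deg v
      once v = m∸n+n≡m (inflow≤ v)
      eq₁ : ∀ v → A v + M * inflow F v ≡ E₁ v + M * (bit (F v) * deg v)
      eq₁ v = +-cancelʳ-≡ (inflow F v) _ _ (begin
        A v + M * inflow F v + inflow F v                       ≡⟨ regroup (A v) M (inflow F v) ⟩
        A v + suc M * inflow F v                                ≡⟨ eq v ⟩
        E v + suc M * (bit (F v) * deg v)                       ≡⟨ +-assoc (E v) _ _ ⟨
        E v + bit (F v) * deg v + M * (bit (F v) * deg v)       ≡⟨ cong (_+ M * (bit (F v) * deg v)) (once v) ⟨
        E₁ v + inflow F v + M * (bit (F v) * deg v)             ≡⟨ regroup′ (E₁ v) (inflow F v) _ ⟩
        E₁ v + M * (bit (F v) * deg v) + inflow F v             ∎)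
        where
        open ≡-Reasoning
        regroup : ∀ a M i → a + M * i + i ≡ a + (1 + M) * i
        regroup = solve-∀
        regroup′ : ∀ e i d → e + i + d ≡ e + d + i
        regroup′ = solve-∀
      drop : ∀ e M → e + M * 0 ≡ e
      drop = solve-∀
      c≤E₁ : ∀ v → c v ≤ E₁ v
      c≤E₁ v with F v | once v | eq₁ v
      ... | true  | once | _   = ≤-trans (c≤E v) (+-cancelʳ-≤ (inflow F v) _ _ (≤-trans (+-monoʳ-≤ (E v) (inflow≤deg F v))
                                   (≤-trans (+-monoʳ-≤ (E v) (≤-reflexive (sym (+-identityʳ (deg v))))) (≤-reflexive (sym once)))))
      ... | false | _    | eq₁ = ≤-trans (c≤A v) (≤-trans (m≤m+n (A v) _) (≤-reflexive (trans eq₁ (drop (E v + 0 ∸ inflow F v) M))))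

    -- Read backwards, toppling all vertices of rank at least j adds particles to those of rank exactly j
    -- at the expense of lower ranks.
    elevated : ∀ j M → ∃ λ E → E ⇝ c × (∀ v → c v ≤ E v) × (∀ v → rank v < j → c v + M ≤ E v)
    elevated zero    M = c , (c , ε , λ _ → refl) , (λ _ → ≤-refl) , λ _ ()
    -- Reversing M firings takes at most M · D from a vertex outside F, so a reserve of M + M · D
    -- leaves M.
    elevated (suc j) M with E , E⇝c , c≤E , high ← elevated j (M + M * D) =
      A , ⇝-trans (fires M F A E c≤A c≤E eq) E⇝c , c≤A , high′
      where
      F : V → Bool
      F v = j ≤ᵇ rank v
      A : Config
      A v = E v + M * (bit (F v) * deg v) ∸ M * inflow F v
      below : ∀ v → F v ≡ false → rank v < j
      below v Fv = ≰⇒> λ j≤ → subst Data.Bool.T Fv (≤⇒≤ᵇ j≤)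
      M-inflow≤ : ∀ v → M * inflow F v ≤ E v + M * (bit (F v) * deg v)
      M-inflow≤ v with F v in Fv
      ... | true  = ≤-trans (*-monoʳ-≤ M (≤-trans (inflow≤deg F v) (≤-reflexive (sym (+-identityʳ (deg v)))))) (m≤n+m _ (E v))
      ... | false = ≤-trans (*-monoʳ-≤ M (≤-trans (inflow≤deg F v) (deg≤D v)))
                      (≤-trans (m≤n+m (M * D) (c v + M)) (≤-trans (≤-reflexive (+-assoc (c v) M _)) (≤-trans (high v (below v Fv)) (m≤m+n _ _))))
      eq : ∀ v → A v + M * inflow F v ≡ E v + M * (bit (F v) * deg v)
      eq v = m∸n+n≡m (M-inflow≤ v)
      E≤A : ∀ v → F v ≡ true → E v ≤ A v
      E≤A v Fv = +-cancelʳ-≤ (M * inflow F v) _ _ (≤-trans (+-monoʳ-≤ (E v) (*-monoʳ-≤ M (≤-trans (inflow≤deg F v)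
        (≤-reflexive (trans (sym (+-identityʳ (deg v))) (cong (λ b → bit b * deg v) (sym Fv))))))) (≤-reflexive (sym (eq v))))
      c+M≤A : ∀ v → F v ≡ false → c v + M ≤ A v
      c+M≤A v Fv = +-cancelʳ-≤ (M * inflow F v) _ _ (≤-trans (+-monoʳ-≤ (c v + M) (*-monoʳ-≤ M (≤-trans (inflow≤deg F v) (deg≤D v))))
        (≤-trans (≤-reflexive (+-assoc (c v) M (M * D))) (≤-trans (high v (below v Fv)) (≤-trans (m≤m+n (E v) _) (≤-reflexive (sym (eq v)))))))
      c≤A : ∀ v → c v ≤ A v
      c≤A v = cases (F v) refl
        where
        cases : ∀ b → F v ≡ b → c v ≤ A v
        cases true  Fv = ≤-trans (c≤E v) (E≤A v Fv)
        cases false Fv = ≤-trans (m≤m+n (c v) M) (c+M≤A v Fv)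
      high′ : ∀ v → rank v < suc j → c v + M ≤ A v
      high′ v r<1+j = cases (F v) refl
        where
        cases : ∀ b → F v ≡ b → c v + M ≤ A v
        cases false Fv = c+M≤A v Fv
        cases true  Fv = ≤-trans (+-monoˡ-≤ M (c≤E v)) (+-cancelʳ-≤ (M * inflow F v) _ _ (begin
          E v + M + M * inflow F v              ≡⟨ regroup (E v) M (inflow F v) ⟩
          E v + M * suc (inflow F v)            ≤⟨ +-monoʳ-≤ (E v) (*-monoʳ-≤ M inflow<deg) ⟩
          E v + M * deg v                       ≡⟨ cong (λ k → E v + M * k) (trans (sym (+-identityʳ (deg v))) (cong (λ b → bit b * deg v) (sym Fv))) ⟩
          E v + M * (bit (F v) * deg v)         ≡⟨ eq v ⟨
          A v + M * inflow F v                  ∎))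
          where
          open ≤-Reasoning
          regroup : ∀ e M i → e + M + M * i ≡ e + M * (1 + i)
          regroup = solve-∀
          j≡rank : j ≡ rank v
          j≡rank = ≤-antisym (≤ᵇ⇒≤ j (rank v) (subst Data.Bool.T (sym Fv) _)) (s≤s⁻¹ r<1+j)
          inflow<deg : inflow F v < deg v
          inflow<deg = subst (λ k → inflow (λ w → k ≤ᵇ rank w) v < deg v) (sym j≡rank) (descending v)

    recurrent : Stable c → Recurrent c
    -- The surplus 1 + Σ c₁ exceeds each value of c₁, so E can be reached from c₁ by additions;
    -- being positive, it also makes E differ from c, as `⇝-exact` demands.
    recurrent stable c₁ with E , E⇝c , c≤E , high ← elevated R (suc (Σ[ verts ] c₁)) =
      (λ v → E v ∸ c₁ v) , ⇝-exact E⇝c (λ v → m+[n∸m]≡n (<⇒≤ (c₁<E v))) E≢c , stable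
      where
      c₁<E : ∀ v → c₁ v < E v
      c₁<E v = ≤-trans (s≤s (≤-trans (≤-reflexive (sym (select v c₁))) (Σ-mono verts δ*≤))) (≤-trans (m≤n+m _ (c v)) (high v (rank<R v)))
        where
        δ*≤ : ∀ w → δ w v * c₁ w ≤ c₁ w
        δ*≤ w with w ≟V v
        ... | yes _ = ≤-reflexive (+-identityʳ _)
        ... | no _  = z≤n
      E≢c : ¬ (∀ v → E v ≡ c v)
      E≢c E≡c = m+1+n≰m (c origin) (≤-trans (high origin (rank<R origin)) (≤-reflexive (E≡c origin)))

open import Data.Fin using (Fin; zero; suc; toℕ; inject₁; fromℕ<)
import Data.Fin.Properties as Fin

-- The grid in coordinates

kronecker : ℕ → ℕ → ℕ
kronecker m n = indicator (m ≟ n)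

adjacent : ℕ → ℕ → ℕ
adjacent m n = kronecker (suc m) n + kronecker (suc n) m

-- The helpers in the definition of `GRID` are private. Once the relevant comparisons are decided,
-- both sides compute to the same value.
mult-eq : ∀ n (i j i′ j′ : Fin n) → Sandpile.mult (GRID n) (i , j) (i′ , j′)
          ≡ indicator (i Fin.≟ i′) * adjacent (toℕ j) (toℕ j′) + indicator (j Fin.≟ j′) * adjacent (toℕ i) (toℕ i′)
mult-eq n i j i′ j′
  with i Fin.≟ i′ | j Fin.≟ j′ | suc (toℕ j) ≟ toℕ j′ | suc (toℕ j′) ≟ toℕ j | suc (toℕ i) ≟ toℕ i′ | suc (toℕ i′) ≟ toℕ i
... | yes _ | yes _ | yes _ | yes _ | yes _ | yes _ = refl
... | yes _ | yes _ | yes _ | yes _ | yes _ | no _  = refl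
... | yes _ | yes _ | yes _ | yes _ | no _  | yes _ = refl
... | yes _ | yes _ | yes _ | yes _ | no _  | no _  = refl
... | yes _ | yes _ | yes _ | no _  | yes _ | yes _ = refl
... | yes _ | yes _ | yes _ | no _  | yes _ | no _  = refl
... | yes _ | yes _ | yes _ | no _  | no _  | yes _ = refl
... | yes _ | yes _ | yes _ | no _  | no _  | no _  = refl
... | yes _ | yes _ | no _  | yes _ | yes _ | yes _ = refl
... | yes _ | yes _ | no _  | yes _ | yes _ | no _  = refl
... | yes _ | yes _ | no _  | yes _ | no _  | yes _ = refl
... | yes _ | yes _ | no _  | yes _ | no _  | no _  = refl
... | yes _ | yes _ | no _  | no _  | yes _ | yes _ = refl
... | yes _ | yes _ | no _  | no _  | yes _ | no _  = refl
... | yes _ | yes _ | no _  | no _  | no _  | yes _ = refl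
... | yes _ | yes _ | no _  | no _  | no _  | no _  = refl
... | yes _ | no _  | yes _ | yes _ | _     | _     = refl
... | yes _ | no _  | yes _ | no _  | _     | _     = refl
... | yes _ | no _  | no _  | yes _ | _     | _     = refl
... | yes _ | no _  | no _  | no _  | _     | _     = refl
... | no _  | yes _ | _     | _     | yes _ | yes _ = refl
... | no _  | yes _ | _     | _     | yes _ | no _  = refl
... | no _  | yes _ | _     | _     | no _  | yes _ = refl
... | no _  | yes _ | _     | _     | no _  | no _  = refl
... | no _  | no _  | _     | _     | _     | _     = refl

sink-eq : ∀ n (i j : Fin n) → Sandpile.sinkMult (GRID n) (i , j)
          ≡ kronecker (toℕ i) 0 + kronecker (suc (toℕ i)) n + kronecker (toℕ j) 0 + kronecker (suc (toℕ j)) n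
sink-eq n i j with toℕ i ≟ 0 | suc (toℕ i) ≟ n | toℕ j ≟ 0 | suc (toℕ j) ≟ n
... | yes _ | yes _ | yes _ | yes _ = refl
... | yes _ | yes _ | yes _ | no _  = refl
... | yes _ | yes _ | no _  | yes _ = refl
... | yes _ | yes _ | no _  | no _  = refl
... | yes _ | no _  | yes _ | yes _ = refl
... | yes _ | no _  | yes _ | no _  = refl
... | yes _ | no _  | no _  | yes _ = refl
... | yes _ | no _  | no _  | no _  = refl
... | no _  | yes _ | yes _ | yes _ = refl
... | no _  | yes _ | yes _ | no _  = refl
... | no _  | yes _ | no _  | yes _ = refl
... | no _  | yes _ | no _  | no _  = refl
... | no _  | no _  | yes _ | yes _ = refl
... | no _  | no _  | yes _ | no _  = refl
... | no _  | no _  | no _  | yes _ = refl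
... | no _  | no _  | no _  | no _  = refl

indicator-cong : ∀ {A B : Set} (a : Dec A) (b : Dec B) → (A → B) → (B → A) → indicator a ≡ indicator b
indicator-cong (yes _) (yes _) f g = refl
indicator-cong (yes a) (no ¬b) f g with () ← ¬b (f a)
indicator-cong (no ¬a) (yes b) f g with () ← ¬a (g b)
indicator-cong (no _)  (no _)  f g = refl

kronecker-suc : ∀ m n → kronecker (suc m) (suc n) ≡ kronecker m n
kronecker-suc m n = indicator-cong (suc m ≟ suc n) (m ≟ n) suc-injective (cong suc)

kronecker-comm : ∀ m n → kronecker m n ≡ kronecker n m
kronecker-comm m n = indicator-cong (m ≟ n) (n ≟ m) sym sym

extend : ∀ {n} → (Fin n → ℕ) → ℕ → ℕ
extend {zero}  f k       = 0
extend {suc n} f zero    = f zero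
extend {suc n} f (suc k) = extend (f ∘ suc) k

-- Shifted by one place, to leave the index 0 to the ring.
extendˢ : ∀ {n} → (Fin n → ℕ) → ℕ → ℕ
extendˢ f zero    = 0
extendˢ f (suc k) = extend f k

extend-toℕ : ∀ {n} (f : Fin n → ℕ) i → extend f (toℕ i) ≡ f i
extend-toℕ f zero    = refl
extend-toℕ f (suc i) = extend-toℕ (f ∘ suc) i

extend-cong : ∀ {n} {f g : Fin n → ℕ} → (∀ i → f i ≡ g i) → ∀ k → extend f k ≡ extend g k
extend-cong {zero}  h k       = refl
extend-cong {suc n} h zero    = h zero
extend-cong {suc n} h (suc k) = extend-cong (h ∘ suc) k

extend-0 : ∀ n k → extend {n} (λ _ → 0) k ≡ 0
extend-0 zero    k       = refl
extend-0 (suc n) zero    = refl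
extend-0 (suc n) (suc k) = extend-0 n k

extend-beyond : ∀ {n} (f : Fin n → ℕ) → extend f n ≡ 0
extend-beyond {zero}  f = refl
extend-beyond {suc n} f = extend-beyond (f ∘ suc)

extend≤1 : ∀ {n} {f : Fin n → ℕ} → (∀ i → f i ≤ 1) → ∀ k → extend f k ≤ 1
extend≤1 {zero}  h k       = z≤n
extend≤1 {suc n} h zero    = h zero
extend≤1 {suc n} h (suc k) = extend≤1 (h ∘ suc) k

extendˢ-cong : ∀ {n} {f g : Fin n → ℕ} → (∀ i → f i ≡ g i) → ∀ k → extendˢ f k ≡ extendˢ g k
extendˢ-cong h zero    = refl
extendˢ-cong h (suc k) = extend-cong h k

Σ-allFin-suc : ∀ n (f : Fin (suc n) → ℕ) → Σ[ allFin (suc n) ] f ≡ f zero + Σ[ allFin n ] (f ∘ suc)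
Σ-allFin-suc n f = cong (f zero +_) (cong sum (trans (map-tabulate suc f) (sym (map-tabulate id (f ∘ suc)))))

Σ-allFin : ∀ n (h : ℕ → ℕ) → Σ[ allFin n ] (h ∘ toℕ) ≡ Σ< n h
Σ-allFin zero    h = refl
Σ-allFin (suc n) h = trans (Σ-allFin-suc n (h ∘ toℕ)) (cong (h 0 +_) (Σ-allFin n (h ∘ suc)))

Σ-kronecker : ∀ {n} k (f : Fin n → ℕ) → Σ[ allFin n ] (λ i → kronecker k (toℕ i) * f i) ≡ extend f k
Σ-kronecker {zero}  k       f = refl
Σ-kronecker {suc n} zero    f = trans (Σ-allFin-suc n _) (trans (cong₂ _+_ (+-identityʳ (f zero)) (Σ-0 (allFin n))) (+-identityʳ (f zero)))
Σ-kronecker {suc n} (suc k) f = trans (Σ-allFin-suc n (λ i → kronecker (suc k) (toℕ i) * f i))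
  (trans (Σ-cong (allFin n) (λ i → cong (_* f (suc i)) (kronecker-suc k (toℕ i)))) (Σ-kronecker k (f ∘ suc)))

Σ-kronecker-suc : ∀ {n} k (f : Fin n → ℕ) → Σ[ allFin n ] (λ i → kronecker (suc (toℕ i)) k * f i) ≡ extendˢ f k
Σ-kronecker-suc {n} zero    f = Σ-0 (allFin n)
Σ-kronecker-suc {n} (suc k) f = trans (Σ-cong (allFin n) (λ i → cong (_* f i) (trans (kronecker-suc (toℕ i) k) (kronecker-comm (toℕ i) k)))) (Σ-kronecker k f)

Σ-adjacent : ∀ {n} k (f : Fin n → ℕ) → Σ[ allFin n ] (λ i → adjacent k (toℕ i) * f i) ≡ extend f (suc k) + extendˢ f k
Σ-adjacent {n} k f = trans (Σ-cong (allFin n) (λ i → *-distribʳ-+ (f i) (kronecker (suc k) (toℕ i)) (kronecker (suc (toℕ i)) k)))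
  (trans (Σ-+ (allFin n) _ _) (cong₂ _+_ (Σ-kronecker (suc k) f) (Σ-kronecker-suc k f)))

Σ-indicator : ∀ {n} (i : Fin n) (f : Fin n → ℕ) → Σ[ allFin n ] (λ i′ → indicator (i Fin.≟ i′) * f i′) ≡ f i
Σ-indicator {n} i f = trans (Σ-cong (allFin n) (λ i′ → cong (_* f i′) (indicator-cong (i Fin.≟ i′) (toℕ i ≟ toℕ i′) (cong toℕ) Fin.toℕ-injective)))
  (trans (Σ-kronecker (toℕ i) f) (extend-toℕ f i))

module GridSums (n : ℕ) where
  open Sandpile (GRID n)

  Σ-grid : ∀ (f : V → ℕ) → Σ[ verts ] f ≡ Σ[ allFin n ] (λ i → Σ[ allFin n ] (λ j → f (i , j)))
  Σ-grid f = Σ-cartesianProduct (allFin n) (allFin n) f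

  -- The value at (i , j) is stored at (i + 1 , j + 1), surrounded by zeros.
  pad : (V → ℕ) → ℕ → ℕ → ℕ
  pad f x y = extendˢ (λ i → extendˢ (λ j → f (i , j)) y) x

  pad-toℕʸ : ∀ f x j → pad f x (suc (toℕ j)) ≡ extendˢ (λ i → f (i , j)) x
  pad-toℕʸ f x j = extendˢ-cong (λ i → extend-toℕ (λ j → f (i , j)) j) x

  pad-toℕˣ : ∀ f i y → pad f (suc (toℕ i)) y ≡ extendˢ (λ j → f (i , j)) y
  pad-toℕˣ f i y = extend-toℕ (λ i → extendˢ (λ j → f (i , j)) y) i

  pad-toℕ : ∀ f i j → pad f (suc (toℕ i)) (suc (toℕ j)) ≡ f (i , j)
  pad-toℕ f i j = trans (pad-toℕˣ f i (suc (toℕ j))) (extend-toℕ (λ j → f (i , j)) j)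

  pad-ring : ∀ f → VanishesOnRing n (pad f)
  pad-ring f = record
    { left   = λ y → refl
    ; right  = λ y → extend-beyond (λ i → extendˢ (λ j → f (i , j)) y)
    ; bottom = λ x → zeros (λ i → refl) x
    ; top    = λ x → zeros (λ i → extend-beyond (λ j → f (i , j))) x
    }
    where
    zeros : ∀ {g : Fin n → ℕ} → (∀ i → g i ≡ 0) → ∀ x → extendˢ g x ≡ 0
    zeros h zero    = refl
    zeros h (suc x) = trans (extend-cong h x) (extend-0 n x)

  Σ-mult : ∀ i j f → Σ[ verts ] (λ w → mult (i , j) w * f w) ≡ neighbours (pad f) (suc (toℕ i)) (suc (toℕ j))
  Σ-mult i j f = begin
    Σ[ verts ] (λ w → mult (i , j) w * f w)
      ≡⟨ Σ-grid _ ⟩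
    Σ[ allFin n ] (λ i′ → Σ[ allFin n ] (λ j′ → mult (i , j) (i′ , j′) * f (i′ , j′)))
      ≡⟨ Σ-cong (allFin n) inner ⟩
    Σ[ allFin n ] (λ i′ → indicator (i Fin.≟ i′) * Σ[ allFin n ] (λ j′ → adjacent (toℕ j) (toℕ j′) * f (i′ , j′)) + adjacent (toℕ i) (toℕ i′) * f (i′ , j))
      ≡⟨ Σ-+ (allFin n) _ _ ⟩
    Σ[ allFin n ] (λ i′ → indicator (i Fin.≟ i′) * Σ[ allFin n ] (λ j′ → adjacent (toℕ j) (toℕ j′) * f (i′ , j′))) + Σ[ allFin n ] (λ i′ → adjacent (toℕ i) (toℕ i′) * f (i′ , j))
      ≡⟨ cong₂ _+_ (trans (Σ-indicator i _) (Σ-adjacent (toℕ j) (λ j′ → f (i , j′)))) (Σ-adjacent (toℕ i) (λ i′ → f (i′ , j))) ⟩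
    extend (λ j′ → f (i , j′)) (suc (toℕ j)) + extendˢ (λ j′ → f (i , j′)) (toℕ j) + (extend (λ i′ → f (i′ , j)) (suc (toℕ i)) + extendˢ (λ i′ → f (i′ , j)) (toℕ i))
      ≡⟨ +-comm (extend (λ j′ → f (i , j′)) (suc (toℕ j)) + extendˢ (λ j′ → f (i , j′)) (toℕ j)) _ ⟩
    extend (λ i′ → f (i′ , j)) (suc (toℕ i)) + extendˢ (λ i′ → f (i′ , j)) (toℕ i) + (extend (λ j′ → f (i , j′)) (suc (toℕ j)) + extendˢ (λ j′ → f (i , j′)) (toℕ j))
      ≡⟨ cong₂ _+_ (cong₂ _+_ (pad-toℕʸ f (suc (suc (toℕ i))) j) (pad-toℕʸ f (toℕ i) j)) (cong₂ _+_ (pad-toℕˣ f i (suc (suc (toℕ j)))) (pad-toℕˣ f i (toℕ j))) ⟨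
    neighbours (pad f) (suc (toℕ i)) (suc (toℕ j)) ∎
    where
    open ≡-Reasoning
    inner : ∀ i′ → Σ[ allFin n ] (λ j′ → mult (i , j) (i′ , j′) * f (i′ , j′))
            ≡ indicator (i Fin.≟ i′) * Σ[ allFin n ] (λ j′ → adjacent (toℕ j) (toℕ j′) * f (i′ , j′)) + adjacent (toℕ i) (toℕ i′) * f (i′ , j)
    inner i′ = begin
      Σ[ allFin n ] (λ j′ → mult (i , j) (i′ , j′) * f (i′ , j′))
        ≡⟨ Σ-cong (allFin n) (λ j′ → trans (cong (_* f (i′ , j′)) (mult-eq n i j i′ j′)) (regroup (indicator (i Fin.≟ i′)) (adjacent (toℕ j) (toℕ j′)) (indicator (j Fin.≟ j′)) (adjacent (toℕ i) (toℕ i′)) (f (i′ , j′)))) ⟩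
      Σ[ allFin n ] (λ j′ → indicator (i Fin.≟ i′) * (adjacent (toℕ j) (toℕ j′) * f (i′ , j′)) + adjacent (toℕ i) (toℕ i′) * (indicator (j Fin.≟ j′) * f (i′ , j′)))
        ≡⟨ Σ-+ (allFin n) _ _ ⟩
      Σ[ allFin n ] (λ j′ → indicator (i Fin.≟ i′) * (adjacent (toℕ j) (toℕ j′) * f (i′ , j′))) + Σ[ allFin n ] (λ j′ → adjacent (toℕ i) (toℕ i′) * (indicator (j Fin.≟ j′) * f (i′ , j′)))
        ≡⟨ cong₂ _+_ (Σ-*ˡ (allFin n) (indicator (i Fin.≟ i′)) _) (trans (Σ-*ˡ (allFin n) (adjacent (toℕ i) (toℕ i′)) _) (cong (adjacent (toℕ i) (toℕ i′) *_) (Σ-indicator j (λ j′ → f (i′ , j′))))) ⟩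
      indicator (i Fin.≟ i′) * Σ[ allFin n ] (λ j′ → adjacent (toℕ j) (toℕ j′) * f (i′ , j′)) + adjacent (toℕ i) (toℕ i′) * f (i′ , j) ∎
      where
      regroup : ∀ d a e b f → (d * a + e * b) * f ≡ d * (a * f) + b * (e * f)
      regroup = solve-∀

  mult-comm : ∀ v w → mult v w ≡ mult w v
  mult-comm (i , j) (i′ , j′) = trans (mult-eq n i j i′ j′) (trans
    (cong₂ _+_ (cong₂ _*_ (indicator-cong (i Fin.≟ i′) (i′ Fin.≟ i) sym sym) (+-comm (kronecker (suc (toℕ j)) (toℕ j′)) _))
               (cong₂ _*_ (indicator-cong (j Fin.≟ j′) (j′ Fin.≟ j) sym sym) (+-comm (kronecker (suc (toℕ i)) (toℕ i′)) _)))
    (sym (mult-eq n i′ j′ i j)))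

  Σ-mult-comm : ∀ v → Σ[ verts ] (λ w → mult w v) ≡ Σ[ verts ] (mult v)
  Σ-mult-comm v = Σ-cong verts (λ w → mult-comm w v)

  Σ-sink : ∀ f → Σ[ verts ] (λ v → sinkMult v * f v) ≡ boundarySum n (pad f)
  Σ-sink f = begin
    Σ[ verts ] (λ v → sinkMult v * f v)
      ≡⟨ Σ-cong verts (λ (i , j) → trans (cong (_* f (i , j)) (sink-eq n i j)) (expand (kronecker (toℕ i) 0) (kronecker (suc (toℕ i)) n) (kronecker (toℕ j) 0) (kronecker (suc (toℕ j)) n) (f (i , j)))) ⟩
    Σ[ verts ] (λ (i , j) → kronecker (toℕ i) 0 * f (i , j) + kronecker (suc (toℕ i)) n * f (i , j) + kronecker (toℕ j) 0 * f (i , j) + kronecker (suc (toℕ j)) n * f (i , j))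
      ≡⟨ trans (Σ-+ verts _ _) (cong (_+ Σ[ verts ] (λ (i , j) → kronecker (suc (toℕ j)) n * f (i , j))) (trans (Σ-+ verts _ _) (cong (_+ Σ[ verts ] (λ (i , j) → kronecker (toℕ j) 0 * f (i , j))) (Σ-+ verts _ _)))) ⟩
    Σ[ verts ] (λ (i , j) → kronecker (toℕ i) 0 * f (i , j)) + Σ[ verts ] (λ (i , j) → kronecker (suc (toℕ i)) n * f (i , j))
      + Σ[ verts ] (λ (i , j) → kronecker (toℕ j) 0 * f (i , j)) + Σ[ verts ] (λ (i , j) → kronecker (suc (toℕ j)) n * f (i , j))
      ≡⟨ cong₂ _+_ (cong₂ _+_ (cong₂ _+_ (row (λ i → kronecker (toℕ i) 0) 1 first) (row (λ i → kronecker (suc (toℕ i)) n) n (Σ-kronecker-suc n)))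
                             (column (λ j → kronecker (toℕ j) 0) 1 first)) (column (λ j → kronecker (suc (toℕ j)) n) n (Σ-kronecker-suc n)) ⟩
    boundarySum n (pad f) ∎
    where
    open ≡-Reasoning
    expand : ∀ a b c d f → (a + b + c + d) * f ≡ a * f + b * f + c * f + d * f
    expand = solve-∀
    first : ∀ (g : Fin n → ℕ) → Σ[ allFin n ] (λ i → kronecker (toℕ i) 0 * g i) ≡ extendˢ g 1
    first g = trans (Σ-cong (allFin n) (λ i → cong (_* g i) (kronecker-comm (toℕ i) 0))) (Σ-kronecker 0 g)
    row : ∀ (κ : Fin n → ℕ) x → (∀ g → Σ[ allFin n ] (λ i → κ i * g i) ≡ extendˢ g x) →
          Σ[ verts ] (λ (i , j) → κ i * f (i , j)) ≡ Σ< n (λ j → pad f x (suc j))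
    row κ x select = begin
      Σ[ verts ] (λ (i , j) → κ i * f (i , j))                               ≡⟨ Σ-grid _ ⟩
      Σ[ allFin n ] (λ i → Σ[ allFin n ] (λ j → κ i * f (i , j)))            ≡⟨ Σ-swap (allFin n) (allFin n) _ ⟩
      Σ[ allFin n ] (λ j → Σ[ allFin n ] (λ i → κ i * f (i , j)))            ≡⟨ Σ-cong (allFin n) (λ j → trans (select (λ i → f (i , j))) (sym (pad-toℕʸ f x j))) ⟩
      Σ[ allFin n ] (λ j → pad f x (suc (toℕ j)))                            ≡⟨ Σ-allFin n (λ j → pad f x (suc j)) ⟩
      Σ< n (λ j → pad f x (suc j))                                           ∎
    column : ∀ (κ : Fin n → ℕ) y → (∀ g → Σ[ allFin n ] (λ j → κ j * g j) ≡ extendˢ g y) →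
             Σ[ verts ] (λ (i , j) → κ j * f (i , j)) ≡ Σ< n (λ i → pad f (suc i) y)
    column κ y select = begin
      Σ[ verts ] (λ (i , j) → κ j * f (i , j))                               ≡⟨ Σ-grid _ ⟩
      Σ[ allFin n ] (λ i → Σ[ allFin n ] (λ j → κ j * f (i , j)))            ≡⟨ Σ-cong (allFin n) (λ i → trans (select (λ j → f (i , j))) (sym (pad-toℕˣ f i y))) ⟩
      Σ[ allFin n ] (λ i → pad f (suc (toℕ i)) y)                            ≡⟨ Σ-allFin n (λ i → pad f (suc i) y) ⟩
      Σ< n (λ i → pad f (suc i) y)                                           ∎

  -- In each direction there is at most one of a neighbour and an edge to the sink: where the sink
  -- edge is present, the padded constant function 1 vanishes.
  deg≤4 : ∀ v → deg v ≤ 4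
  deg≤4 (i , j) = begin
    Σ[ verts ] (mult (i , j)) + sinkMult (i , j)
      ≡⟨ cong₂ _+_ (trans (Σ-cong verts (λ w → sym (*-identityʳ (mult (i , j) w)))) (Σ-mult i j (λ _ → 1))) (sink-eq n i j) ⟩
    neighbours one (suc (toℕ i)) (suc (toℕ j)) + (kronecker (toℕ i) 0 + kronecker (suc (toℕ i)) n + kronecker (toℕ j) 0 + kronecker (suc (toℕ j)) n)
      ≡⟨ regroup (one (suc (suc (toℕ i))) (suc (toℕ j))) (one (toℕ i) (suc (toℕ j))) (one (suc (toℕ i)) (suc (suc (toℕ j)))) (one (suc (toℕ i)) (toℕ j))
                 (kronecker (toℕ i) 0) (kronecker (suc (toℕ i)) n) (kronecker (toℕ j) 0) (kronecker (suc (toℕ j)) n) ⟩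
    (one (suc (suc (toℕ i))) (suc (toℕ j)) + kronecker (suc (toℕ i)) n) + (one (toℕ i) (suc (toℕ j)) + kronecker (toℕ i) 0)
      + (one (suc (toℕ i)) (suc (suc (toℕ j))) + kronecker (suc (toℕ j)) n) + (one (suc (toℕ i)) (toℕ j) + kronecker (toℕ j) 0)
      ≤⟨ +-mono-≤ (+-mono-≤ (+-mono-≤
           (bounded (suc (toℕ i)) n (λ eq → trans (cong (λ x → one (suc x) (suc (toℕ j))) eq) (right (suc (toℕ j)))) (one≤1 (suc (suc (toℕ i))) (suc (toℕ j))))
           (bounded (toℕ i) 0 (λ eq → cong (λ x → one x (suc (toℕ j))) eq) (one≤1 (toℕ i) (suc (toℕ j)))))
           (bounded (suc (toℕ j)) n (λ eq → trans (cong (λ y → one (suc (toℕ i)) (suc y)) eq) (top (suc (toℕ i)))) (one≤1 (suc (toℕ i)) (suc (suc (toℕ j))))))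
           (bounded (toℕ j) 0 (λ eq → trans (cong (one (suc (toℕ i))) eq) (bottom (suc (toℕ i)))) (one≤1 (suc (toℕ i)) (toℕ j))) ⟩
    4 ∎
    where
    open ≤-Reasoning
    one : ℕ → ℕ → ℕ
    one = pad (λ _ → 1)
    open VanishesOnRing (pad-ring (λ _ → 1))
    regroup : ∀ E W N S w e s n → E + W + (N + S) + (w + e + s + n) ≡ (E + e) + (W + w) + (N + n) + (S + s)
    regroup = solve-∀
    extendˢ≤1 : ∀ {f : Fin n → ℕ} → (∀ i → f i ≤ 1) → ∀ k → extendˢ f k ≤ 1
    extendˢ≤1 h zero    = z≤n
    extendˢ≤1 h (suc k) = extend≤1 h k
    one≤1 : ∀ x y → one x y ≤ 1
    one≤1 x y = extendˢ≤1 (λ i → extendˢ≤1 (λ j → ≤-refl) y) x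
    bounded : ∀ {v} x y → (x ≡ y → v ≡ 0) → v ≤ 1 → v + kronecker x y ≤ 1
    bounded x y zero-at v≤1 with x ≟ y
    ... | yes x≡y = ≤-reflexive (cong (_+ 1) (zero-at x≡y))
    ... | no _    = ≤-trans (≤-reflexive (+-identityʳ _)) v≤1

indicator-× : ∀ {A B P : Set} (a : Dec A) (b : Dec B) (p : Dec P) → (A → B → P) → (P → A × B) → indicator p ≡ indicator a * indicator b
indicator-× (yes a) (yes b) (yes _) f g = refl
indicator-× (yes a) (yes b) (no ¬p) f g with () ← ¬p (f a b)
indicator-× (yes a) (no ¬b) (yes p) f g with () ← ¬b (proj₂ (g p))
indicator-× (yes a) (no ¬b) (no _)  f g = refl
indicator-× (no ¬a) b       (yes p) f g with () ← ¬a (proj₁ (g p))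
indicator-× (no ¬a) b       (no _)  f g = refl

-- Counting particles on the grid

module GridDynamics (n : ℕ) where
  open Sandpile (GRID n)
  open GridSums n

  select : ∀ v (f : V → ℕ) → Σ[ verts ] (λ w → indicator (w ≟V v) * f w) ≡ f v
  select v@(i , j) f = begin
    Σ[ verts ] (λ w → indicator (w ≟V v) * f w)
      ≡⟨ Σ-cong verts (λ w@(i′ , j′) → trans (cong (_* f w) (indicator-× (i Fin.≟ i′) (j Fin.≟ j′) (w ≟V v) (λ { refl refl → refl }) (λ { refl → refl , refl }))) (*-assoc (indicator (i Fin.≟ i′)) _ _)) ⟩
    Σ[ verts ] (λ (i′ , j′) → indicator (i Fin.≟ i′) * (indicator (j Fin.≟ j′) * f (i′ , j′)))
      ≡⟨ Σ-grid _ ⟩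
    Σ[ allFin n ] (λ i′ → Σ[ allFin n ] (λ j′ → indicator (i Fin.≟ i′) * (indicator (j Fin.≟ j′) * f (i′ , j′))))
      ≡⟨ Σ-cong (allFin n) (λ i′ → trans (Σ-*ˡ (allFin n) (indicator (i Fin.≟ i′)) _) (cong (indicator (i Fin.≟ i′) *_) (Σ-indicator j (λ j′ → f (i′ , j′))))) ⟩
    Σ[ allFin n ] (λ i′ → indicator (i Fin.≟ i′) * f (i′ , j))
      ≡⟨ Σ-indicator i (λ i′ → f (i′ , j)) ⟩
    f v ∎
    where open ≡-Reasoning

  search : ∀ (F : V → Bool) → (∃ λ v → F v ≡ true) ⊎ (∀ v → F v ≡ false)
  search F with Fin.any? (λ i → Fin.any? (λ j → F (i , j) Bool.≟ true))
  ... | yes (i , j , Fv) = inj₁ ((i , j) , Fv)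
  ... | no none          = inj₂ λ (i , j) → Bool.¬-not (λ Fv → none (i , j , Fv))

  open Dynamics (GRID n) select search public

  rank : V → ℕ
  rank (i , j) = toℕ i

  -- Row 0 has an edge to the sink. Any other row has an edge to the preceding one, whose rank is
  -- too small for the inflow to count it.
  descending : ∀ v → inflow (λ w → rank v ≤ᵇ rank w) v < deg v
  descending v@(zero , j) = begin
    suc (inflow (λ w → rank v ≤ᵇ rank w) v)     ≤⟨ s≤s (≤-reflexive (Σ-cong verts (λ w → +-identityʳ (mult w v)))) ⟩
    suc (Σ[ verts ] (λ w → mult w v))           ≡⟨ cong suc (Σ-mult-comm v) ⟩
    suc (Σ[ verts ] (mult v))                   ≡⟨ +-comm 1 _ ⟩
    Σ[ verts ] (mult v) + 1                     ≤⟨ +-monoʳ-≤ (Σ[ verts ] (mult v)) (≤-trans (m≤m+n 1 _) (≤-reflexive (sym (sink-eq n zero j)))) ⟩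
    deg v                                       ∎
    where open ≤-Reasoning
  descending v@(suc i , j) = begin
    suc (inflow F v)                                                ≡⟨ +-comm 1 _ ⟩
    inflow F v + 1                                                  ≤⟨ +-monoʳ-≤ (inflow F v) edge ⟩
    inflow F v + mult below v                                       ≡⟨ cong (inflow F v +_) (select below (λ w → mult w v)) ⟨
    inflow F v + Σ[ verts ] (λ w → indicator (w ≟V below) * mult w v) ≡⟨ Σ-+ verts (λ w → bit (F w) * mult w v) (λ w → indicator (w ≟V below) * mult w v) ⟨
    Σ[ verts ] (λ w → bit (F w) * mult w v + indicator (w ≟V below) * mult w v) ≤⟨ Σ-mono verts disjoint ⟩
    Σ[ verts ] (λ w → mult w v)                                     ≡⟨ Σ-mult-comm v ⟩
    Σ[ verts ] (mult v)                                             ≤⟨ m≤m+n _ _ ⟩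
    deg v                                                           ∎
    where
    open ≤-Reasoning
    F : V → Bool
    F w = rank v ≤ᵇ rank w
    below : V
    below = inject₁ i , j
    edge : 1 ≤ mult below v
    edge = ≤-trans (≤-trans (≤-reflexive (sym edges≡1)) (m≤n+m _ _)) (≤-reflexive (sym (mult-eq n (inject₁ i) j (suc i) j)))
      where
      edges≡1 : indicator (j Fin.≟ j) * adjacent (toℕ (inject₁ i)) (suc (toℕ i)) ≡ 1
      edges≡1 rewrite Fin.toℕ-inject₁ i with j Fin.≟ j | suc (toℕ i) ≟ suc (toℕ i) | suc (suc (toℕ i)) ≟ toℕ i
      ... | yes _ | yes _ | no _  = refl
      ... | no ¬p | _     | _     with () ← ¬p refl
      ... | _     | no ¬p | _     with () ← ¬p refl
      ... | _     | _     | yes p with () ← m≢1+n+m (toℕ i) {1} (sym p)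
    F-below : F below ≡ false
    F-below rewrite Fin.toℕ-inject₁ i = Bool.¬-not (λ eq → 1+n≰n (≤ᵇ⇒≤ (suc (toℕ i)) (toℕ i) (subst T (sym eq) _)))
    disjoint : ∀ w → bit (F w) * mult w v + indicator (w ≟V below) * mult w v ≤ mult w v
    disjoint w with w ≟V below
    ... | yes refl rewrite F-below = ≤-reflexive (+-identityʳ _)
    ... | no _ with F w
    ...   | true  = ≤-reflexive (trans (+-identityʳ _) (+-identityʳ _))
    ...   | false = z≤n

  odometer : ∀ {c u j} → (∀ v → c v < deg v) → Inv c u j → Odometer n (pad u)
  odometer {c} {u} stable I = record { ring = pad-ring u ; almostSuperharmonic = superharmonic }
    where
    open Inv I
    at : ∀ i j → neighbours (pad u) (suc (toℕ i)) (suc (toℕ j)) ≤ 4 * pad u (suc (toℕ i)) (suc (toℕ j)) + 3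
    at i j = begin
      neighbours (pad u) (suc (toℕ i)) (suc (toℕ j))     ≡⟨ Σ-mult i j u ⟨
      Σ[ verts ] (λ w → mult (i , j) w * u w)            ≡⟨ Σ-cong verts (λ w → cong (_* u w) (mult-comm (i , j) w)) ⟩
      Σ[ verts ] (λ w → mult w (i , j) * u w)            ≤⟨ balance (i , j) ⟩
      c (i , j) + deg (i , j) * u (i , j)                ≤⟨ +-mono-≤ (s≤s⁻¹ (≤-trans (stable (i , j)) (deg≤4 (i , j)))) (*-monoˡ-≤ (u (i , j)) (deg≤4 (i , j))) ⟩
      3 + 4 * u (i , j)                                  ≡⟨ +-comm 3 _ ⟩
      4 * u (i , j) + 3                                  ≡⟨ cong (λ k → 4 * k + 3) (pad-toℕ u i j) ⟨
      4 * pad u (suc (toℕ i)) (suc (toℕ j)) + 3          ∎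
      where open ≤-Reasoning
    superharmonic : ∀ {i j} → i < n → j < n → neighbours (pad u) (suc i) (suc j) ≤ 4 * pad u (suc i) (suc j) + 3
    superharmonic i<n j<n = subst₂ (λ i j → neighbours (pad u) (suc i) (suc j) ≤ 4 * pad u (suc i) (suc j) + 3)
      (Fin.toℕ-fromℕ< i<n) (Fin.toℕ-fromℕ< j<n) (at (fromℕ< i<n) (fromℕ< j<n))

  few-particles : ∀ {c u j} → (∀ v → c v < deg v) → Inv c u j → (∃ λ v → u v ≡ 0) → j ≤ suc n ^ 7 * (sideConstant * 4 + 3)
  few-particles {c} {u} {j} stable I ((a , b) , untoppled) = begin
    j
      ≡⟨ particles ⟨
    Σ[ verts ] c + Σ[ verts ] (λ v → sinkMult v * u v)
      ≤⟨ +-mono-≤ (Σ-mono verts (λ v → s≤s⁻¹ (≤-trans (stable v) (deg≤4 v)))) (≤-reflexive (Σ-sink u)) ⟩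
    Σ[ verts ] (λ _ → 3) + boundarySum n (pad u)
      ≤⟨ +-mono-≤ (≤-reflexive (trans (Σ-grid _) (trans (Σ-cong (allFin n) (λ _ → trans (Σ-allFin n (λ _ → 3)) (Σ<-const n 3))) (trans (Σ-allFin n (λ _ → n * 3)) (Σ<-const n (n * 3))))))
           (boundary-bound (odometer stable I) (Fin.toℕ<n a) (Fin.toℕ<n b) (trans (pad-toℕ u a b) untoppled)) ⟩
    n * (n * 3) + suc n ^ 7 * (sideConstant * 4)
      ≤⟨ +-monoˡ-≤ (suc n ^ 7 * (sideConstant * 4)) (≤-trans (≤-reflexive (sym (*-assoc n n 3))) (*-monoˡ-≤ 3 n²≤)) ⟩
    suc n ^ 7 * 3 + suc n ^ 7 * (sideConstant * 4)
      ≡⟨ trans (+-comm (suc n ^ 7 * 3) _) (sym (*-distribˡ-+ (suc n ^ 7) (sideConstant * 4) 3)) ⟩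
    suc n ^ 7 * (sideConstant * 4 + 3) ∎
    where
    open ≤-Reasoning
    open Inv I
    n²≤ : n * n ≤ suc n ^ 7
    n²≤ = ≤-trans (*-mono-≤ (n≤1+n n) (≤-trans (n≤1+n n) (≤-reflexive (sym (*-identityʳ (suc n)))))) (^-monoʳ-≤ (suc n) {2} {7} (s≤s (s≤s z≤n)))

  module _ (origin : V) where
    -- Only configurations that receive a particle are known to be non-recurrent, hence to have an
    -- untoppled vertex. The final one may lie beyond, which accounts for the additional particle in
    -- the bound.
    bounded : ∀ {c u j k} → (∀ v → c v < deg v) → Inv c u j → j ≤ suc (suc n ^ 7 * (sideConstant * 4 + 3)) →
              NonRecRun c k → k + j ≤ suc (suc n ^ 7 * (sideConstant * 4 + 3))
    bounded stable I j≤ (done _) = j≤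
    bounded {c} {u} {j} stable I j≤ (step {k = k} v ¬recurrent (steps , stable′) run) with search (λ v → u v ≡ᵇ 0)
    ... | inj₁ (w , uw) = ≤-trans (≤-reflexive (sym (+-suc k j)))
            (bounded stable′ (proj₂ (inv-relax (inv-add v I) steps)) (s≤s (few-particles stable I (w , ≡ᵇ⇒≡ (u w) 0 (subst T (sym uw) _)))) run)
    ... | inj₂ toppled  = ⊥-elim (¬recurrent (Recurrence.recurrent deg≤4 (λ v → ≤-trans (≤-reflexive (Σ-mult-comm v)) (m≤m+n _ _))
            rank (λ (i , j) → Fin.toℕ<n i) descending origin (λ F nonempty → Inv.ample I F nonempty (λ v _ → positive (u v) (toppled v))) stable))
      where
      positive : ∀ k → (k ≡ᵇ 0) ≡ false → 1 ≤ k
      positive (suc k) _ = s≤s z≤n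

    tcl≤ : TclAtMost (suc (suc n ^ 7 * (sideConstant * 4 + 3)))
    -- The empty configuration is stable because `descending` forces every degree to be positive.
    tcl≤ k run = ≤-trans (≤-reflexive (sym (+-identityʳ k))) (bounded (λ v → ≤-trans (s≤s z≤n) (descending v)) inv-empty z≤n run)

theorem7 : Σ ℕ λ C → ∀ n → n ≥ 1 → Sandpile.TclAtMost (GRID n) (C * n ^ 7)
-- The factor 128 = 2⁷ comes from n + 1 ≤ 2n; the 4 is the 3 of `tcl≤` plus one for its additional
-- particle.
theorem7 = 128 * (sideConstant * 4 + 4) , bound
  where
  bound : ∀ n → n ≥ 1 → Sandpile.TclAtMost (GRID n) (128 * (sideConstant * 4 + 4) * n ^ 7)
  bound n@(suc _) n≥1 k run = begin
    k                                              ≤⟨ GridDynamics.tcl≤ n (zero , zero) k run ⟩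
    suc (suc n ^ 7 * (sideConstant * 4 + 3))       ≤⟨ +-monoˡ-≤ (suc n ^ 7 * (sideConstant * 4 + 3)) (m^n>0 (suc n) 7) ⟩
    suc n ^ 7 + suc n ^ 7 * (sideConstant * 4 + 3) ≡⟨ collect (suc n ^ 7) sideConstant ⟩
    suc n ^ 7 * (sideConstant * 4 + 4)             ≤⟨ *-monoˡ-≤ (sideConstant * 4 + 4) (^-monoˡ-≤ 7 (+-monoˡ-≤ n n≥1)) ⟩
    (n + n) ^ 7 * (sideConstant * 4 + 4)           ≡⟨ double n (sideConstant * 4 + 4) ⟩
    128 * (sideConstant * 4 + 4) * n ^ 7           ∎
    where
    open ≤-Reasoning
    collect : ∀ m s → m + m * (s * 4 + 3) ≡ m * (s * 4 + 4)
    collect = solve-∀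
    double : ∀ n s → ((n + n) * ((n + n) * ((n + n) * ((n + n) * ((n + n) * ((n + n) * ((n + n) * 1))))))) * s ≡ 128 * s * (n * (n * (n * (n * (n * (n * (n * 1)))))))
    double = solve-∀
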